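{- Let $n\equiv 1\pmod 4$ be a positive integer and define \[B(n,q)=\frac{(n^2-1)(1-q)^2}{24}+\sum_{k=1}^{(n-1)/4}\frac{q^{4k-2}}{[4k-2]^2}.\] Then, modulo $[n]\Phi_n(q)^3$, \[\sum_{k=0}^{(n-1) / 2}[6 k+1] \frac{(q ; q^{4})_{k}(q ; q^{2})_{k}^{3}}{\left(q^{2} ; q^{2}\right)_{k}(q^{4} ; q^{4})_{k}^{3}} q^{k^{2}+k} \equiv \frac{\left(q^{2} ; q^{4}\right)_{(n-1)/4}}{\left(q^{4} ; q^{4}\right)_{(n-1)/4}}[n] q^{(1-n) / 4}\big\{1+[n]^2B(n,q)\big\}.\]
   Context: $(a;q)_m=(1-a)(1-aq)\cdots(1-aq^{m-1})$ (with $(a;q)_0=1$) is the $q$-shifted factorial. The $q$-integer is $[m]=(1-q^m)/(1-q)$. $\Phi_n(q)$ denotes the $n$-th cyclotomic polynomial. A congruence between rational functions modulo a polynomial $P(q)$ means that the numerator of the reduced difference is divisible by $P(q)$ while its denominator is coprime to $P(q)$. -}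

module Defs where

open import Data.Nat as ℕ using (ℕ; zero; suc; _∸_; _≤?_)
open import Data.Nat.Divisibility using (_∣?_)
open import Data.Integer as ℤ using (+_)
open import Data.Rational as ℚ using (ℚ; 0ℚ; 1ℚ)
open import Data.Rational.Properties using () renaming (_≟_ to _≟ℚ_)
open import Data.List using (List; []; _∷_; map; replicate; _++_; reverse; length; filter; foldr; upTo)
open import Data.List.Relation.Unary.All using (All)
open import Data.Product using (Σ; _×_)
open import Relation.Binary.PropositionalEquality using (_≡_)
open import Relation.Nullary using (yes; no)

-- Polynomials in q with rational coefficients, as coefficient lists
-- (lowest degree first; trailing zeros allowed).

Poly : Set
Poly = List ℚ

infixl 6 _+P_ _-P_
infixl 7 _*P_

_+P_ : Poly → Poly → Poly
[] +P ys = ys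
(x ∷ xs) +P [] = x ∷ xs
(x ∷ xs) +P (y ∷ ys) = (x ℚ.+ y) ∷ (xs +P ys)

scaleP : ℚ → Poly → Poly
scaleP c = map (c ℚ.*_)

negP : Poly → Poly
negP = map (λ x → ℚ.- x)

_-P_ : Poly → Poly → Poly
p -P r = p +P negP r

_*P_ : Poly → Poly → Poly
[] *P ys = []
(x ∷ xs) *P ys = scaleP x ys +P (0ℚ ∷ (xs *P ys))

constP : ℚ → Poly
constP c = c ∷ []

oneP : Poly
oneP = constP 1ℚ

qpow : ℕ → Poly
qpow k = replicate k 0ℚ ++ (1ℚ ∷ [])

_^P_ : Poly → ℕ → Poly
p ^P zero = oneP
p ^P suc k = p *P (p ^P k)

IsZeroP : Poly → Set
IsZeroP p = All (_≡ 0ℚ) p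

infix 4 _≈P_
_≈P_ : Poly → Poly → Set
p ≈P r = IsZeroP (p -P r)

prodP : ℕ → (ℕ → Poly) → Poly
prodP zero f = oneP
prodP (suc m) f = prodP m f *P f m

poch : Poly → Poly → ℕ → Poly
poch a b m = prodP m (λ i → oneP -P (a *P (b ^P i)))

qint : ℕ → Poly
qint m = foldr _+P_ [] (map qpow (upTo m))

private
  dropZeros : List ℚ → List ℚ
  dropZeros [] = []
  dropZeros (x ∷ xs) with x ≟ℚ 0ℚ
  ... | yes _ = dropZeros xs
  ... | no _ = x ∷ xs

  normP : Poly → Poly
  normP p = reverse (dropZeros (reverse p))

  subPrefix : List ℚ → List ℚ → List ℚ
  subPrefix [] cs = []
  subPrefix ps [] = ps
  subPrefix (p ∷ ps) (c ∷ cs) = (p ℚ.- c) ∷ subPrefix ps cs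

  -- long division, coefficient lists highest degree first,
  -- divisor is 1 ∷ ms (monic); returns the quotient (highest first)
  divHL : ℕ → List ℚ → List ℚ → List ℚ
  divHL zero ps ms = []
  divHL (suc f) [] ms = []
  divHL (suc f) (c ∷ ps) ms with length ms ≤? length ps
  ... | yes _ = c ∷ divHL f (subPrefix ps (map (c ℚ.*_) ms)) ms
  ... | no _ = []

divMonic : Poly → Poly → Poly
divMonic p m with reverse (normP m)
... | [] = []
... | (_ ∷ ms) = reverse (divHL (length p) (reverse (normP p)) ms)

-- Cyclotomic polynomials via q^n - 1 = ∏_{d ∣ n} Φ_d(q), i.e.
-- Φ_n = (q^n - 1) / ∏_{d ∣ n, d < n} Φ_d  (fuel-indexed recursion).
private
  cyc : ℕ → ℕ → Poly
  cyc zero n = oneP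
  cyc (suc f) n =
    divMonic (qpow n -P oneP)
      (foldr _*P_ oneP (map (cyc f) (filter (_∣? n) (map suc (upTo (n ∸ 1))))))

Φ : ℕ → Poly
Φ n = cyc n n

record RatFun : Set where
  constructor _//_
  field
    num : Poly
    den : Poly
open RatFun public

infixl 6 _+R_
infixl 7 _*R_

_+R_ : RatFun → RatFun → RatFun
(a // b) +R (c // d) = ((a *P d) +P (c *P b)) // (b *P d)

_*R_ : RatFun → RatFun → RatFun
(a // b) *R (c // d) = (a *P c) // (b *P d)

polyR : Poly → RatFun
polyR p = p // oneP

sumR : ℕ → ℕ → (ℕ → RatFun) → RatFun
sumR a b f = foldr _+R_ (polyR []) (map (λ i → f (a ℕ.+ i)) (upTo (suc b ∸ a)))

Coprime : Poly → Poly → Set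
Coprime V P = Σ Poly λ S → Σ Poly λ T → (S *P V) +P (T *P P) ≈P oneP

-- Congruence of rational functions modulo a polynomial P:
-- the difference x - y equals P · U / V with V coprime to P
-- (equivalently: numerator of the reduced difference divisible by P,
--  its denominator coprime to P).
_≡R_[mod_] : RatFun → RatFun → Poly → Set
x ≡R y [mod P ] =
  Σ Poly λ U → Σ Poly λ V → Coprime V P ×
    (((num x *P den y) -P (num y *P den x)) *P V ≈P (P *P U) *P (den x *P den y))

q¹ : Poly
q¹ = qpow 1

LHS : ℕ → RatFun
LHS n = sumR 0 ((n ∸ 1) ℕ./ 2) λ k →
  ((qint (6 ℕ.* k ℕ.+ 1) *P poch q¹ (qpow 4) k *P (poch q¹ (qpow 2) k ^P 3)
      *P qpow (k ℕ.* k ℕ.+ k))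
   // (poch (qpow 2) (qpow 2) k *P (poch (qpow 4) (qpow 4) k ^P 3)))

B : ℕ → RatFun
B n = polyR (scaleP ((+ (n ℕ.* n ∸ 1)) ℚ./ 24) ((oneP -P q¹) ^P 2))
  +R sumR 1 ((n ∸ 1) ℕ./ 4) (λ k → qpow (4 ℕ.* k ∸ 2) // (qint (4 ℕ.* k ∸ 2) ^P 2))

RHS : ℕ → RatFun
RHS n =
  (poch (qpow 2) (qpow 4) m // poch (qpow 4) (qpow 4) m)
  *R polyR (qint n)
  *R (oneP // qpow m)                      -- q^{(1-n)/4} = 1 / q^{(n-1)/4}
  *R (polyR oneP +R (polyR (qint n ^P 2) *R B n))
  where
  m = (n ∸ 1) ℕ./ 4

-- With q → q², a = q and b = q/y, the quadratic summation of Gasper and Rahman evaluates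
--   S(z,y) = Σₖ [6k+1] (q;q²)ₖ ∏ᵢ((1-q^(2i+1))² - q^(2i+1) z) (y - q^(4i+1)) q^(k²+k) / …,  k ≤ (n-1)/2,
-- which at z = 0, y = 1 is the left-hand side, on the curves z = z₀ = (1-qⁿ)²/qⁿ and y = qⁿ.
-- Modulo Φₙ one may replace a = q by a = q^(1-n), and then the sum vanishes for all z and y. Since
-- z₀ ≡ 0 mod Φₙ² and qⁿ ≡ 1 mod Φₙ, the second difference S(0,1) - S(z₀,1) - S(0,qⁿ) + S(z₀,qⁿ)
-- is divisible by Φₙ⁴, and the other three values are known products. The sum in B(n,q) comes from
-- the logarithmic derivative of S(z,qⁿ) and from Σ q^j/(1-q^j)² = -(n²-1)/12 over 0 < j < n at a
-- primitive n-th root of unity.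
-- For a proper divisor d of n the sum splits into blocks of length d, each of which is an integral
-- multiple of the vanishing sum for d; the moduli are combined by the Chinese remainder theorem.
-- Each of the three evaluations is proved by a contiguous relation, i.e. a telescoping certificate
-- for the shift b → b/p², c → c/p² or a → a/p² with p = q².

module Submission where

-- The second difference cannot be read off from the four values: modulo Φₙ⁴ the increments z₀ and
-- w₀ = qⁿ - 1 are nilpotent, so values do not determine divided differences. These are therefore
-- carried along, by forming the series once over R[z,w]/(z² - z₀z, w² - w₀w) with R = ℚ[q]/(Φₙ⁴)
-- and y = 1 + w. There S = Φₙ c, and the alternating sum of the four values is z₀w₀Φₙ times one
-- coefficient of c. An element of this ring is a unit as soon as its four values are, which takes
-- care of the denominators. The summation formulas are thus needed in several rings with zero
-- divisors: in R, and in the extended ring modulo Φₙ. So a series is given by its term ratio with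
-- denominators cleared, every certificate is a polynomial identity, and the proofs are carried out
-- over an arbitrary commutative ring in which the factors to be cancelled are units. That Φₙ is
-- coprime to qʲ - 1 unless n divides j is derived by strong induction on n from Bézout identities
-- between the polynomials qᵏ - 1.

open import Algebra.Bundles
open import Algebra.Solver.Ring.AlmostCommutativeRing using (fromCommutativeRing; _-Raw-AlmostCommutative⟶_)
import Algebra.Properties.Ring
import Algebra.Properties.Semiring.Exp as Exp
import Algebra.Properties.Semiring.Mult.TCOptimised
import Algebra.Solver.Ring
open import Data.Fin as Fin using (Fin; toℕ)
open import Data.Integer as ℤ using (ℤ; +_; -[1+_]; _⊖_)
import Data.Integer.Properties as ℤ
open import Data.List using (List; []; _∷_; _∷ʳ_; map; foldr; filter; upTo; applyUpTo; reverse; length)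
import Data.List.Properties as List
open import Data.List.Membership.Propositional using (_∈_)
import Data.List.Membership.Propositional.Properties as ∈
open import Data.List.Relation.Unary.All as All using (All; []; _∷_)
open import Data.List.Relation.Unary.AllPairs using (AllPairs; []; _∷_)
open import Data.List.Relation.Unary.Any using (here; there)
import Data.List.Relation.Unary.Unique.Propositional.Properties as Unique
open import Data.Maybe as Maybe using (Maybe; just; nothing)
open import Data.Nat as ℕ using (ℕ; zero; suc; _≤_; _<_; _≤?_; _∸_; _%_; z≤n; s≤s; z<s; s<s; NonZero)
open import Data.Nat.Divisibility as ∣ℕ using (_∣_; _∣?_; divides)
import Data.Nat.DivMod as ℕ
open import Data.Nat.GCD using (gcd; gcd[m,n]∣m; gcd[m,n]∣n; module Bézout; gcd-GCD)
open import Data.Nat.Induction using (<-rec)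
import Data.Nat.Properties as ℕ
import Data.Nat.Solver
open import Data.Product using (Σ; _×_; _,_; proj₁; proj₂; ∃)
open import Data.Rational as ℚ using (ℚ; 0ℚ; 1ℚ)
import Data.Rational.Properties as ℚ
import Data.Rational.Unnormalised as ℚᵘ
import Data.Rational.Unnormalised.Properties as ℚᵘ
open import Data.Sum using (_⊎_; inj₁; inj₂)
open import Data.Vec using (Vec; lookup)
open import Level using (_⊔_; 0ℓ)
open import Relation.Binary.Definitions using (tri<; tri≈; tri>)
open import Relation.Binary.PropositionalEquality as ≡ using (_≡_; _≢_)
import Relation.Binary.Reasoning.Setoid
import Relation.Binary.Reflection
open import Relation.Nullary using (¬_; Dec; yes; no; contradiction)
open import Relation.Nullary.Decidable using (dec⇒maybe; True; toWitness)

-- A ring solver with integer coefficients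

module ExprSyntax where
  infix 9 :-_
  infixl 8 _:*_
  infixl 7 _:+_ _:-_
  infix 4 _:=_

  -- No index counts the variables: the size-indexed syntax of Algebra.Solver.Ring leaves a
  -- metavariable at every node, which large identities cannot afford.
  data Expr : Set where
    var : ℕ → Expr
    con : ℤ → Expr
    _:+_ _:*_ : Expr → Expr → Expr
    :-_ : Expr → Expr

  :0 :1 : Expr
  :0 = con (+ 0)
  :1 = con (+ 1)

  _:-_ : Expr → Expr → Expr
  a :- b = a :+ :- b

  _:=_ : Expr → Expr → Expr × Expr
  _:=_ = _,_

  index : ∀ n → ℕ → Maybe (Fin n)
  index zero i = nothing
  index (suc n) zero = just Fin.zero
  index (suc n) (suc i) = Maybe.map Fin.suc (index n i)

open ExprSyntax using (Expr; var; con; index)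

module ℤSolver {c ℓ} (R : CommutativeRing c ℓ) where
  open CommutativeRing R
  open ExprSyntax hiding (Expr; var; con; index)
  open Algebra.Properties.Ring ring
  open Algebra.Properties.Semiring.Mult.TCOptimised semiring renaming (_×_ to _·_)
  open Relation.Binary.Reasoning.Setoid setoid

  ⟦_⟧ᶻ : ℤ → Carrier
  ⟦ + n ⟧ᶻ = n · 1#
  ⟦ -[1+ n ] ⟧ᶻ = - (suc n · 1#)

  neg-homo : ∀ i → ⟦ ℤ.- i ⟧ᶻ ≈ - ⟦ i ⟧ᶻ
  neg-homo (+ zero) = sym -0#≈0#
  neg-homo (+ suc n) = refl
  neg-homo -[1+ n ] = sym (-‿involutive _)

  ⊖-homo : ∀ m n → ⟦ m ⊖ n ⟧ᶻ ≈ m · 1# - n · 1#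
  ⊖-homo m zero = sym (trans (+-congˡ -0#≈0#) (+-identityʳ _))
  ⊖-homo zero (suc n) = sym (+-identityˡ _)
  ⊖-homo (suc m) (suc n) = begin
    ⟦ suc m ⊖ suc n ⟧ᶻ ≡⟨ ≡.cong ⟦_⟧ᶻ (ℤ.[1+m]⊖[1+n]≡m⊖n m n) ⟩
    ⟦ m ⊖ n ⟧ᶻ ≈⟨ ⊖-homo m n ⟩
    m · 1# - n · 1# ≈⟨ +-congˡ (+-identityˡ _) ⟨
    m · 1# + (0# - n · 1#) ≈⟨ +-congˡ (+-congʳ (-‿inverseʳ 1#)) ⟨
    m · 1# + ((1# - 1#) - n · 1#) ≈⟨ +-congˡ (+-assoc _ _ _) ⟩
    m · 1# + (1# + (- 1# - n · 1#)) ≈⟨ +-assoc _ _ _ ⟨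
    (m · 1# + 1#) + (- 1# - n · 1#) ≈⟨ +-cong (+-comm _ _) (-‿+-comm _ _) ⟩
    (1# + m · 1#) - (1# + n · 1#) ≈⟨ +-cong (1+× m 1#) (-‿cong (1+× n 1#)) ⟨
    suc m · 1# - suc n · 1# ∎

  +-homo : ∀ i j → ⟦ i ℤ.+ j ⟧ᶻ ≈ ⟦ i ⟧ᶻ + ⟦ j ⟧ᶻ
  +-homo (+ m) (+ n) = ×-homo-+ 1# m n
  +-homo (+ m) -[1+ n ] = ⊖-homo m (suc n)
  +-homo -[1+ m ] (+ n) = trans (⊖-homo n (suc m)) (+-comm _ _)
  +-homo -[1+ m ] -[1+ n ] = begin
    - (suc (suc (m ℕ.+ n)) · 1#) ≡⟨ ≡.cong (λ k → - (suc k · 1#)) (≡.sym (ℕ.+-suc m n)) ⟩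
    - ((suc m ℕ.+ suc n) · 1#) ≈⟨ -‿cong (×-homo-+ 1# (suc m) (suc n)) ⟩
    - (suc m · 1# + suc n · 1#) ≈⟨ -‿+-comm _ _ ⟨
    - (suc m · 1#) + - (suc n · 1#) ∎

  *-homo : ∀ i j → ⟦ i ℤ.* j ⟧ᶻ ≈ ⟦ i ⟧ᶻ * ⟦ j ⟧ᶻ
  *-homo (+ m) (+ n) = trans (reflexive (≡.cong ⟦_⟧ᶻ (≡.sym (ℤ.pos-* m n)))) (×1-homo-* m n)
  *-homo (+ m) -[1+ n ] = begin
    ⟦ + m ℤ.* (ℤ.- (+ suc n)) ⟧ᶻ ≡⟨ ≡.cong ⟦_⟧ᶻ (≡.sym (ℤ.neg-distribʳ-* (+ m) (+ suc n))) ⟩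
    ⟦ ℤ.- (+ m ℤ.* + suc n) ⟧ᶻ ≈⟨ neg-homo (+ m ℤ.* + suc n) ⟩
    - ⟦ + m ℤ.* + suc n ⟧ᶻ ≈⟨ -‿cong (*-homo (+ m) (+ suc n)) ⟩
    - (m · 1# * (suc n · 1#)) ≈⟨ -‿distribʳ-* _ _ ⟩
    m · 1# * - (suc n · 1#) ∎
  *-homo -[1+ m ] (+ n) = begin
    ⟦ (ℤ.- (+ suc m)) ℤ.* + n ⟧ᶻ ≡⟨ ≡.cong ⟦_⟧ᶻ (≡.sym (ℤ.neg-distribˡ-* (+ suc m) (+ n))) ⟩
    ⟦ ℤ.- (+ suc m ℤ.* + n) ⟧ᶻ ≈⟨ neg-homo (+ suc m ℤ.* + n) ⟩
    - ⟦ + suc m ℤ.* + n ⟧ᶻ ≈⟨ -‿cong (*-homo (+ suc m) (+ n)) ⟩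
    - (suc m · 1# * (n · 1#)) ≈⟨ -‿distribˡ-* _ _ ⟩
    - (suc m · 1#) * (n · 1#) ∎
  *-homo -[1+ m ] -[1+ n ] = begin
    (suc m ℕ.* suc n) · 1# ≈⟨ ×1-homo-* (suc m) (suc n) ⟩
    suc m · 1# * (suc n · 1#) ≈⟨ -‿involutive _ ⟨
    - - (suc m · 1# * (suc n · 1#)) ≈⟨ -‿cong (-‿distribʳ-* _ _) ⟩
    - (suc m · 1# * - (suc n · 1#)) ≈⟨ -‿distribˡ-* _ _ ⟩
    - (suc m · 1#) * - (suc n · 1#) ∎

  -- The coefficients are integers because the normaliser must decide their equality in order to
  -- cancel terms; equality in R is not assumed to be decidable.
  morphism : ℤ.+-*-rawRing -Raw-AlmostCommutative⟶ fromCommutativeRing R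
  morphism = record
    { ⟦_⟧ = ⟦_⟧ᶻ
    ; +-homo = +-homo
    ; *-homo = *-homo
    ; -‿homo = neg-homo
    ; 0-homo = refl
    ; 1-homo = refl
    }

  private
    module S = Algebra.Solver.Ring ℤ.+-*-rawRing (fromCommutativeRing R) morphism
      (λ i j → Maybe.map (λ e → reflexive (≡.cong ⟦_⟧ᶻ e)) (dec⇒maybe (i ℤ.≟ j)))

  polynomial : ∀ n → Expr → S.Polynomial n
  polynomial n (var i) = Maybe.maybe S.var (S.con (+ 0)) (index n i)
  polynomial n (con i) = S.con i
  polynomial n (a :+ b) = polynomial n a S.:+ polynomial n b
  polynomial n (a :* b) = polynomial n a S.:* polynomial n b
  polynomial n (:- a) = S.:- polynomial n a

  ⟦_⟧ᴱ : Expr → ∀ {n} → Vec Carrier n → Carrier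
  ⟦ var i ⟧ᴱ {n} ρ = Maybe.maybe (lookup ρ) 0# (index n i)
  ⟦ con i ⟧ᴱ ρ = ⟦ i ⟧ᶻ
  ⟦ a :+ b ⟧ᴱ ρ = ⟦ a ⟧ᴱ ρ + ⟦ b ⟧ᴱ ρ
  ⟦ a :* b ⟧ᴱ ρ = ⟦ a ⟧ᴱ ρ * ⟦ b ⟧ᴱ ρ
  ⟦ :- a ⟧ᴱ ρ = - ⟦ a ⟧ᴱ ρ

  polynomial-correct : ∀ e {n} (ρ : Vec Carrier n) → S.⟦ polynomial n e ⟧ ρ ≈ ⟦ e ⟧ᴱ ρ
  polynomial-correct (var i) {n} ρ with index n i
  ... | just j = refl
  ... | nothing = refl
  polynomial-correct (con i) ρ = refl
  polynomial-correct (a :+ b) ρ = +-cong (polynomial-correct a ρ) (polynomial-correct b ρ)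
  polynomial-correct (a :* b) ρ = *-cong (polynomial-correct a ρ) (polynomial-correct b ρ)
  polynomial-correct (:- a) ρ = -‿cong (polynomial-correct a ρ)

  open Relation.Binary.Reflection {Expr = λ _ → Expr} setoid (λ i → var (toℕ i))
    (λ e → ⟦ e ⟧ᴱ) (λ {n} e → S.⟦ polynomial n e ⟧↓)
    (λ {n} e ρ → trans (S.correct (polynomial n e) ρ) (polynomial-correct e ρ)) public
    using (solve)
  open ExprSyntax public using (_:=_; _:+_; _:*_; _:-_; :-_; :0; :1)

-- Units and finite sums in a commutative ring

module Units {c ℓ} (R : CommutativeRing c ℓ) where
  open CommutativeRing R
  open import Algebra.Properties.Ring ring using (x∙y⁻¹≈ε⇒x≈y; x≈y⇒x∙y⁻¹≈ε)
  open ℤSolver R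
  open import Relation.Binary.Reasoning.Setoid setoid

  Unit : Carrier → Set _
  Unit x = Σ Carrier λ y → x * y ≈ 1#

  unit-resp : ∀ {x y} → x ≈ y → Unit x → Unit y
  unit-resp e (i , h) = i , trans (*-congʳ (sym e)) h

  unit-* : ∀ {x y} → Unit x → Unit y → Unit (x * y)
  unit-* {x} {y} (i , h) (j , k) = i * j , (begin
    x * y * (i * j) ≈⟨ solve 4 (λ x y i j → x :* y :* (i :* j) := (x :* i) :* (y :* j)) refl x y i j ⟩
    x * i * (y * j) ≈⟨ *-cong h k ⟩
    1# * 1# ≈⟨ *-identityˡ 1# ⟩
    1# ∎)

  -- The inverses form one total function, so that quotients of sequences can be written without a
  -- proof that the index is in range.
  Invertible : ℕ → (ℕ → Carrier) → Set _
  Invertible K f = Σ (ℕ → Carrier) λ g → ∀ i → i < K → f i * g i ≈ 1#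

  invertible : ∀ K {f} → (∀ i → i < K → Unit (f i)) → Invertible K f
  invertible K {f} h = (λ i → inv i (i ℕ.<? K)) , λ i l → inv-correct i l (i ℕ.<? K)
    where
    inv : ∀ i → Dec (i < K) → Carrier
    inv i (yes l) = proj₁ (h i l)
    -- A default value outside the range.
    inv i (no _) = 0#
    inv-correct : ∀ i → i < K → (d : Dec (i < K)) → f i * inv i d ≈ 1#
    inv-correct i l (yes l′) = proj₂ (h i l′)
    inv-correct i l (no ¬l) = contradiction l ¬l

  diff≈0 : ∀ {x y} → x ≈ y → x - y ≈ 0#
  diff≈0 = x≈y⇒x∙y⁻¹≈ε

  -- In the lemmas combine₁, …, combine₄ the equality L ≈ R is read off a certificate
  -- L - R ≈ Σ cᵢ (Aᵢ - Bᵢ), in which the known equalities Aᵢ ≈ Bᵢ occur.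
  combine₁ : ∀ {L R A B c} → A ≈ B → L - R ≈ c * (A - B) → L ≈ R
  combine₁ h e = x∙y⁻¹≈ε⇒x≈y _ _ (trans e (trans (*-congˡ (diff≈0 h)) (zeroʳ _)))

  combine₂ : ∀ {L R A B c A′ B′ c′} → A ≈ B → A′ ≈ B′ →
    L - R ≈ c * (A - B) + c′ * (A′ - B′) → L ≈ R
  combine₂ h h′ e = x∙y⁻¹≈ε⇒x≈y _ _ (trans e (trans (+-cong (trans (*-congˡ (diff≈0 h)) (zeroʳ _)) (trans (*-congˡ (diff≈0 h′)) (zeroʳ _))) (+-identityˡ 0#)))

  combine₃ : ∀ {L R A B c A′ B′ c′ A″ B″ c″} → A ≈ B → A′ ≈ B′ → A″ ≈ B″ →
    L - R ≈ c * (A - B) + c′ * (A′ - B′) + c″ * (A″ - B″) → L ≈ R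
  combine₃ h h′ h″ e = combine₁ h″ (trans e (trans (+-congʳ (trans (+-cong (trans (*-congˡ (diff≈0 h)) (zeroʳ _)) (trans (*-congˡ (diff≈0 h′)) (zeroʳ _))) (+-identityˡ 0#))) (+-identityˡ _)))

  combine₄ : ∀ {L R A B c A′ B′ c′ A″ B″ c″ A‴ B‴ c‴} → A ≈ B → A′ ≈ B′ → A″ ≈ B″ → A‴ ≈ B‴ →
    L - R ≈ c * (A - B) + c′ * (A′ - B′) + c″ * (A″ - B″) + c‴ * (A‴ - B‴) → L ≈ R
  combine₄ h h′ h″ h‴ e = combine₂ h″ h‴ (trans e (trans (+-assoc _ _ _) (trans (+-congʳ (trans (+-cong (trans (*-congˡ (diff≈0 h)) (zeroʳ _)) (trans (*-congˡ (diff≈0 h′)) (zeroʳ _))) (+-identityˡ 0#))) (+-identityˡ _))))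

  unit-cancel : ∀ {u x y} → Unit u → u * x ≈ u * y → x ≈ y
  unit-cancel {u} {x} {y} (i , h) e = combine₂ e h
    (solve 4 (λ u i x y → x :- y := i :* (u :* x :- u :* y) :+ (y :- x) :* (u :* i :- :1)) refl u i x y)

module Sums {c ℓ} (R : CommutativeRing c ℓ) where
  open CommutativeRing R
  open Units R
  open ℤSolver R
  open import Relation.Binary.Reasoning.Setoid setoid

  ∑ : ℕ → (ℕ → Carrier) → Carrier
  ∑ zero f = 0#
  ∑ (suc n) f = ∑ n f + f n

  ∏ : ℕ → (ℕ → Carrier) → Carrier
  ∏ zero f = 1#
  ∏ (suc n) f = ∏ n f * f n

  ∑-cong : ∀ n {f g} → (∀ i → i < n → f i ≈ g i) → ∑ n f ≈ ∑ n g
  ∑-cong zero h = refl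
  ∑-cong (suc n) h = +-cong (∑-cong n λ i l → h i (ℕ.m<n⇒m<1+n l)) (h n (ℕ.n<1+n n))

  ∏-cong : ∀ n {f g} → (∀ i → i < n → f i ≈ g i) → ∏ n f ≈ ∏ n g
  ∏-cong zero h = refl
  ∏-cong (suc n) h = *-cong (∏-cong n λ i l → h i (ℕ.m<n⇒m<1+n l)) (h n (ℕ.n<1+n n))

  ∑-distribˡ : ∀ n x f → x * ∑ n f ≈ ∑ n (λ i → x * f i)
  ∑-distribˡ zero x f = zeroʳ x
  ∑-distribˡ (suc n) x f = trans (distribˡ x _ _) (+-congʳ (∑-distribˡ n x f))

  ∑-minus : ∀ n f g → ∑ n (λ i → f i - g i) ≈ ∑ n f - ∑ n g
  ∑-minus zero f g = sym (-‿inverseʳ 0#)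
  ∑-minus (suc n) f g = trans (+-congʳ (∑-minus n f g))
    (solve 4 (λ a b c d → (a :- b) :+ (c :- d) := (a :+ c) :- (b :+ d)) refl _ _ _ _)

  -- `H k` is `G (suc k)` rewritten in terms of the k-th summand alone. At the last index
  -- `G (suc n)` would involve a summand about which nothing is known, while `H n` can still be
  -- evaluated.
  telescope : ∀ n (H G : ℕ → Carrier) → (∀ k → k < n → H k ≈ G (suc k)) →
    ∑ (suc n) (λ k → H k - G k) ≈ H n - G 0
  telescope zero H G h = +-identityˡ _
  telescope (suc n) H G h = combine₂ (telescope n H G (λ k l → h k (ℕ.m<n⇒m<1+n l))) (h n (ℕ.n<1+n n))
    (solve 6 (λ s a b c d x → (s :+ (c :- x)) :- (c :- d) := :1 :* (s :- (a :- d)) :+ :1 :* (a :- x)) refl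
      (∑ (suc n) (λ k → H k - G k)) (H n) 0# (H (suc n)) (G 0) (G (suc n)))

module Quadratic {c ℓ} (R : CommutativeRing c ℓ) (p : CommutativeRing.Carrier R) where
  open CommutativeRing R
  open Units R
  open Sums R
  open ℤSolver R
  open import Algebra.Properties.Semiring.Exp semiring using (_^_)
  open import Relation.Binary.Reasoning.Setoid setoid

  -- The summand is (1 - a p³ᵏ) t k; here β = 1/b and s = c + p/c in the notation
  -- (a,c,p/c;p)ₖ (b;p²)ₖ / ((p²,ap²/c,acp;p²)ₖ (ap/b;p)ₖ) (a/b)ᵏ p^(k(k+1)/2) of Gasper and Rahman.
  den num : (a s β P : Carrier) → Carrier
  den a s β P = (1# - p * p * P * P) * (1# - a * p * s * P * P + a * a * p * p * p * P * P * P * P) * (1# - a * p * β * P)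
  num a s β P = (1# - a * P) * (1# - s * P + p * P * P) * (β - P * P) * a * p * P

  -- The term ratio with its denominator cleared, so that it makes sense over any commutative ring.
  Term : (a s β : Carrier) → ℕ → (ℕ → Carrier) → Set _
  Term a s β K t = ∀ k → k < K → t (suc k) * den a s β (p ^ k) ≈ t k * num a s β (p ^ k)

  total : Carrier → ℕ → (ℕ → Carrier) → Carrier
  total a K t = ∑ K λ k → (1# - a * p ^ k * p ^ k * p ^ k) * t k

-- Terminating quadratic summations

module QuadraticZero {c ℓ} (R : CommutativeRing c ℓ) (p : CommutativeRing.Carrier R) where
  open CommutativeRing R
  open Units R
  open Sums R
  open ℤSolver R
  open Quadratic R p
  open import Algebra.Properties.Semiring.Exp semiring using (_^_; ^-homo-*)
  open import Relation.Binary.Reasoning.Setoid setoid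

  -- For s = c + p/c this is (1 - acpx)(1 - ap²x/c). At x = p²ᵏ it is the quadratic factor of `den`,
  -- and at x = β the constant `E` of the contiguous relation.
  sq : Carrier → Carrier → Carrier → Carrier
  sq a s x = 1# - a * x * p * s + a * x * a * x * p * p * p

  module Step (a s β : Carrier) (M : ℕ)
    (hδ : Invertible (suc (suc (suc M))) (λ i → sq a s (p ^ i * p ^ i)))
    (hu : Invertible (suc (suc (suc (suc M)))) (λ i → 1# - a * p * β * p ^ i))
    (τ : ℕ → Carrier) (hτ : Term a s β (suc (suc M)) τ) where

    N = suc (suc M)
    iδ = proj₁ hδ
    iu = proj₁ hu

    -- Up to a constant factor `σ` is the term of the series with ap² in place of a: the quotient of
    -- (ap²;p)ₖ by (a;p)ₖ yields the two factors 1 - apᵏ and 1 - apᵏ⁺¹, the denominators yield δ k,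
    -- u k and u (k+1), and (a/b)ᵏ yields p²ᵏ.
    δ u ω σ : ℕ → Carrier
    δ i = sq a s (p ^ i * p ^ i)
    u i = 1# - a * p * β * p ^ i
    ω k = τ k * iδ k * iu k * iu (suc k)
    σ k = p ^ k * p ^ k * (1# - a * p ^ k) * (1# - a * p * p ^ k) * ω k

    <₁ : ∀ {k} → k < suc N → k < suc (suc N)
    <₁ = ℕ.m<n⇒m<1+n

    τ-ω : ∀ k → k < suc N → τ k ≈ ω k * δ k * u k * u (suc k)
    τ-ω k l = combine₃ (proj₂ hδ k l) (proj₂ hu k (<₁ l)) (proj₂ hu (suc k) (s<s l))
      (solve 7 (λ t d e u v w x → t :- t :* e :* v :* x :* d :* u :* w
         := (:- t) :* (d :* e :- :1) :+ (:- (t :* d :* e)) :* (u :* v :- :1)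
            :+ (:- (t :* d :* e :* u :* v)) :* (w :* x :- :1)) refl
        (τ k) (δ k) (iδ k) (u k) (iu k) (u (suc k)) (iu (suc k)))

    factor : Carrier → Carrier
    factor P = (1# - a * P) * (1# - s * P + p * P * P) * (β - P * P) * a * p * P

    -- The recurrence of τ in terms of ω: the factors δ k, u k and u (k+1) appear on both sides and
    -- are cancelled.
    key : ∀ k → k < N → ω (suc k) * δ (suc k) * u (suc (suc k)) * (1# - p * p * p ^ k * p ^ k)
                       ≈ ω k * factor (p ^ k)
    key k l = unit-cancel (unit-* (unit-* (_ , proj₂ hδ k (ℕ.m<n⇒m<1+n l)) (_ , proj₂ hu k (ℕ.m<n⇒m<1+n (ℕ.m<n⇒m<1+n l)))) (_ , proj₂ hu (suc k) (s<s (ℕ.m<n⇒m<1+n l))))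
      (combine₃ (hτ k l) (τ-ω (suc k) (s<s l)) (τ-ω k (ℕ.m<n⇒m<1+n l))
        (solve 13 (λ a p s β P t t′ w w′ d′ u u′ u″ →
          let d = :1 :- a :* p :* s :* P :* P :+ a :* a :* p :* p :* p :* P :* P :* P :* P
              e = :1 :- a :* (P :* P) :* p :* s :+ a :* (P :* P) :* a :* (P :* P) :* p :* p :* p
              v = :1 :- a :* p :* β :* P
              g = :1 :- p :* p :* P :* P
              f = (:1 :- a :* P) :* (:1 :- s :* P :+ p :* P :* P) :* (β :- P :* P) :* a :* p :* P
          in e :* v :* u′ :* (w′ :* d′ :* u″ :* g) :- e :* v :* u′ :* (w :* f)
             := :1 :* (t′ :* (g :* d :* v) :- t :* f)
             :+ (:- (g :* d :* v)) :* (t′ :- w′ :* d′ :* u′ :* u″)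
             :+ f :* (t :- w :* e :* v :* u′))
          refl a p s β (p ^ k) (τ k) (τ (suc k)) (ω k) (ω (suc k)) (δ (suc k)) (u k) (u (suc k)) (u (suc (suc k)))))

    σ-term : Term (a * p * p) s β M σ
    σ-term k l = combine₁ (key k (ℕ.m<n⇒m<1+n (ℕ.m<n⇒m<1+n l)))
        (solve 7 (λ a p s β P w w′ →
          let X = p :* P
              d′ = :1 :- a :* (X :* X) :* p :* s :+ a :* (X :* X) :* a :* (X :* X) :* p :* p :* p
              u″ = :1 :- a :* p :* β :* (p :* X)
              g = :1 :- p :* p :* P :* P
              f = (:1 :- a :* P) :* (:1 :- s :* P :+ p :* P :* P) :* (β :- P :* P) :* a :* p :* P
              A = a :* p :* p
              D = :1 :- A :* p :* s :* P :* P :+ A :* A :* p :* p :* p :* P :* P :* P :* P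
              U = :1 :- A :* p :* β :* P
              F = (:1 :- A :* P) :* (:1 :- s :* P :+ p :* P :* P) :* (β :- P :* P) :* A :* p :* P
              σ′ = X :* X :* (:1 :- a :* X) :* (:1 :- a :* p :* X) :* w′
              σ = P :* P :* (:1 :- a :* P) :* (:1 :- a :* p :* P) :* w
          in σ′ :* (g :* D :* U) :- σ :* F := X :* X :* (:1 :- a :* X) :* (:1 :- a :* p :* X) :* (w′ :* d′ :* u″ :* g :- w :* f))
          refl a p s β (p ^ k) (ω k) (ω (suc k)))

    E = 1# - a * p * β * s + a * a * p * p * p * β * β

    H G : ℕ → Carrier
    H k = - (ω k * factor (p ^ k) * (1# - a * a * p * p * p * β * p ^ k * p ^ k))
    G k = - (ω k * (1# - p ^ k * p ^ k) * (1# - a * a * p * β * p ^ k * p ^ k) * δ k * u (suc k))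

    H-G : ∀ k → k < N → H k ≈ G (suc k)
    H-G k l = combine₁ (sym (key k l))
      (solve 9 (λ a p β P w f w′ d′ u″ →
          let X = p :* P
              g = :1 :- p :* p :* P :* P
              Y = (:1 :- a :* a :* p :* p :* p :* β :* P :* P)
          in (:- (w :* f :* Y)) :- (:- (w′ :* (:1 :- X :* X) :* (:1 :- a :* a :* p :* β :* X :* X) :* d′ :* u″))
             := (:- Y) :* (w :* f :- w′ :* d′ :* u″ :* g)) refl
          a p β (p ^ k) (ω k) (factor (p ^ k)) (ω (suc k)) (δ (suc k)) (u (suc (suc k))))

    -- Once τ k is expressed by ω k, this is a polynomial identity in a, p, s, β and pᵏ.
    certificate : ∀ k → k < suc N →
      (1# - a * p ^ k * p ^ k * p ^ k) * τ k - E * ((1# - a * p * p * p ^ k * p ^ k * p ^ k) * σ k) ≈ H k - G k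
    certificate k l = combine₁ (τ-ω k l)
      (solve 7 (λ a p s β P t w →
          let δ = :1 :- a :* (P :* P) :* p :* s :+ a :* (P :* P) :* a :* (P :* P) :* p :* p :* p
              v = :1 :- a :* p :* β :* P
              v′ = :1 :- a :* p :* β :* (p :* P)
              E = :1 :- a :* p :* β :* s :+ a :* a :* p :* p :* p :* β :* β
              f = (:1 :- a :* P) :* (:1 :- s :* P :+ p :* P :* P) :* (β :- P :* P) :* a :* p :* P
              c = :1 :- a :* P :* P :* P
          in (c :* t :- E :* ((:1 :- a :* p :* p :* P :* P :* P) :* (P :* P :* (:1 :- a :* P) :* (:1 :- a :* p :* P) :* w)))
             :- ((:- (w :* f :* (:1 :- a :* a :* p :* p :* p :* β :* P :* P)))
                 :- (:- (w :* (:1 :- P :* P) :* (:1 :- a :* a :* p :* β :* P :* P) :* δ :* v′)))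
             := c :* (t :- w :* δ :* v :* v′)) refl a p s β (p ^ k) (τ k) (ω k))

    total-step : a * p ^ N ≈ 1# → total (a * p * p) (suc M) σ ≈ 0# → total a (suc N) τ ≈ 0#
    total-step aN ih = begin
      total a (suc N) τ
        ≈⟨ solve 2 (λ x y → x := (x :- y) :+ y) refl _ (E * total (a * p * p) (suc N) σ) ⟩
      (total a (suc N) τ - E * total (a * p * p) (suc N) σ) + E * total (a * p * p) (suc N) σ
        ≈⟨ +-cong diff (trans (*-congˡ tail) (zeroʳ E)) ⟩
      0# + 0# ≈⟨ +-identityˡ 0# ⟩
      0# ∎
      where
      diff : total a (suc N) τ - E * total (a * p * p) (suc N) σ ≈ 0#
      diff = begin
        total a (suc N) τ - E * total (a * p * p) (suc N) σ ≈⟨ +-congˡ (-‿cong (∑-distribˡ (suc N) E _)) ⟩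
        _ ≈⟨ ∑-minus (suc N) _ _ ⟨
        _ ≈⟨ ∑-cong (suc N) certificate ⟩
        ∑ (suc N) (λ k → H k - G k) ≈⟨ telescope N H G H-G ⟩
        -- H N contains the factor 1 - apᴺ, and G 0 contains 1 - 1.
        H N - G 0 ≈⟨ combine₁ aN (solve 11 (λ a p P w s β f Y w′ x y →
            (:- (w :* ((:1 :- a :* P) :* s :* f :* a :* p :* P) :* Y)) :- (:- (w′ :* (:1 :- :1 :* :1) :* β :* x :* y)) :- :0
            := (w :* (s :* f :* a :* p :* P) :* Y) :* (a :* P :- :1)) refl
            a p (p ^ N) (ω N) (1# - s * p ^ N + p * p ^ N * p ^ N) (1# - a * a * p * β * 1# * 1#) (β - p ^ N * p ^ N)
            (1# - a * a * p * p * p * β * p ^ N * p ^ N) (ω 0) (δ 0) (u 1)) ⟩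
        0# ∎
      -- The last two terms, k = N - 1 and k = N, both contain 1 - apᴺ.
      tail : total (a * p * p) (suc N) σ ≈ 0#
      tail = combine₂ ih aN (solve 7 (λ a p P w w′ t b →
          let X = p :* P
              Z = p :* X
          in (t :+ b :* (X :* X :* (:1 :- a :* X) :* (:1 :- a :* p :* X) :* w)
                :+ (:1 :- a :* p :* p :* Z :* Z :* Z) :* (Z :* Z :* (:1 :- a :* Z) :* (:1 :- a :* p :* Z) :* w′)) :- :0
             := :1 :* (t :- :0) :+ (:- (b :* (X :* X :* (:1 :- a :* X) :* w)
                 :+ (:1 :- a :* p :* p :* Z :* Z :* Z) :* (Z :* Z :* (:1 :- a :* p :* Z) :* w′))) :* (a :* (p :* (p :* P)) :- :1)) refl
          a p (p ^ M) (ω (suc M)) (ω N) (total (a * p * p) (suc M) σ) (1# - a * p * p * (p * p ^ M) * (p * p ^ M) * (p * p ^ M)))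

  -- Passing from a to ap² lowers N by two, hence the two base cases.
  total-zero : ∀ N a s β → a * p ^ N ≈ 1# →
    Invertible (suc N) (λ i → sq a s (p ^ i * p ^ i)) →
    Invertible (N ℕ.+ N) (λ i → 1# - a * p * β * p ^ i) →
    ∀ τ → Term a s β N τ → total a (suc N) τ ≈ 0#
  total-zero zero a s β aN hδ hu τ hτ = combine₁ aN
    (solve 2 (λ a t → (:0 :+ (:1 :- a :* :1 :* :1 :* :1) :* t) :- :0 := (:- t) :* (a :* :1 :- :1)) refl a (τ 0))
  -- Here ap = 1, so the weight 1 - ap³ of the second term is the factor 1 - p² of its denominator,
  -- and only the other two factors remain to be cancelled.
  total-zero (suc zero) a s β aN hδ hu τ hτ =
    unit-cancel (unit-* (_ , proj₂ hδ 0 z<s) (_ , proj₂ hu 0 z<s))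
     (combine₂ (hτ 0 z<s) aN
      (solve 6 (λ a p s β t t′ →
        let δ = :1 :- a :* (:1 :* :1) :* p :* s :+ a :* (:1 :* :1) :* a :* (:1 :* :1) :* p :* p :* p
            v = :1 :- a :* p :* β :* :1
            P = :1
            X = p :* :1
        in δ :* v :* (:0 :+ (:1 :- a :* P :* P :* P) :* t :+ (:1 :- a :* X :* X :* X) :* t′) :- δ :* v :* :0
           := :1 :* (t′ :* ((:1 :- p :* p :* P :* P) :* (:1 :- a :* p :* s :* P :* P :+ a :* a :* p :* p :* p :* P :* P :* P :* P) :* v)
                :- t :* ((:1 :- a :* P) :* (:1 :- s :* P :+ p :* P :* P) :* (β :- P :* P) :* a :* p :* P))
           :+ ((:1 :- a) :* t :* ((p :+ s :* β :- p :* β) :* (a :* p) :- p :* β :* (a :* p) :* (a :* p) :- :1) :- δ :* v :* p :* p :* t′)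
              :* (a :* (p :* :1) :- :1)) refl a p s β (τ 0) (τ 1)))
  total-zero (suc (suc M)) a s β aN hδ hu τ hτ =
    total-step aN (total-zero M (a * p * p) s β aN′ hδ′ hu′ σ σ-term)
    where
    open Step a s β M hδ (proj₁ hu , λ i l → proj₂ hu i (ℕ.≤-trans l (s≤s (s≤s (ℕ.≤-trans (ℕ.m≤n+m (suc (suc M)) M) ℕ.≤-refl))))) τ hτ
    aN′ : a * p * p * p ^ M ≈ 1#
    aN′ = trans (solve 3 (λ a p P → a :* p :* p :* P := a :* (p :* (p :* P))) refl a p (p ^ M)) aN
    hδ′ : Invertible (suc M) (λ i → sq (a * p * p) s (p ^ i * p ^ i))
    hδ′ = (λ i → proj₁ hδ (suc i)) , λ i l → trans (*-congʳ (solve 4 (λ a p s P →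
        let A = a :* p :* p
            X = p :* P
        in :1 :- A :* (P :* P) :* p :* s :+ A :* (P :* P) :* A :* (P :* P) :* p :* p :* p
           := :1 :- a :* (X :* X) :* p :* s :+ a :* (X :* X) :* a :* (X :* X) :* p :* p :* p) refl a p s (p ^ i)))
      (proj₂ hδ (suc i) (s<s (ℕ.m<n⇒m<1+n l)))
    hu′ : Invertible (M ℕ.+ M) (λ i → 1# - a * p * p * p * β * p ^ i)
    hu′ = (λ i → proj₁ hu (suc (suc i))) , λ i l → trans (*-congʳ (solve 4 (λ a p β P →
        :1 :- a :* p :* p :* p :* β :* P := :1 :- a :* p :* β :* (p :* (p :* P))) refl a p β (p ^ i)))
      (proj₂ hu (suc (suc i)) (s<s (s<s (ℕ.<-≤-trans l (ℕ.+-monoʳ-≤ M (ℕ.m≤n+m M 2))))))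

module Terminating {c ℓ} (R : CommutativeRing c ℓ) (p : CommutativeRing.Carrier R) where
  open CommutativeRing R
  open Units R
  open Sums R
  open ℤSolver R
  open Quadratic R p
  open import Algebra.Properties.Semiring.Exp semiring using (_^_; ^-homo-*)
  open import Relation.Binary.Reasoning.Setoid setoid

  -- The case b = p^(-2m).
  module StepB (a s : Carrier) (m : ℕ) (hp : Unit p)
    (hη : Unit ((p * p ^ m) * (p * p ^ m) - 1#))
    (τ : ℕ → Carrier) (hτ : Term a s ((p * p ^ m) * (p * p ^ m)) (suc m) τ) where

    π = proj₁ hp
    b = p ^ m
    β = b * b
    β′ = (p * b) * (p * b)
    η = β′ - 1#
    iη = proj₁ hη

    -- Here b is pᵐ, and the parameter drops from β′ = p²ᵐ⁺² to β = p²ᵐ. Since β′ = p²β, the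
    -- products of the β - p²ⁱ telescope, and the quotient of the two terms is p⁻²ᵏ(β′ - p²ᵏ) u k u
    -- (k+1)/(β′ - 1) up to the constant u 0 u 1.
    ρ σ u factor : ℕ → Carrier
    u k = 1# - a * p * β * p ^ k
    ρ k = τ k * (π ^ k * π ^ k) * iη
    σ k = ρ k * (β′ - p ^ k * p ^ k) * u k * u (suc k)
    factor k = (1# - a * p ^ k) * (1# - s * p ^ k + p * p ^ k * p ^ k) * (β′ - p ^ k * p ^ k) * a * p * p ^ k

    pπ : ∀ k → p ^ k * π ^ k ≈ 1#
    pπ zero = *-identityˡ 1#
    pπ (suc k) = combine₂ (proj₂ hp) (pπ k)
      (solve 4 (λ p P i I → p :* P :* (i :* I) :- :1 := (P :* I) :* (p :* i :- :1) :+ :1 :* (P :* I :- :1))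
        refl p (p ^ k) π (π ^ k))

    τ-ρ : ∀ k → τ k ≈ ρ k * (p ^ k * p ^ k * η)
    τ-ρ k = combine₂ (pπ k) (proj₂ hη)
      (solve 5 (λ t P I h i → t :- t :* (I :* I) :* i :* (P :* P :* h)
         := (:- (t :* i :* h :* (P :* I :+ :1))) :* (P :* I :- :1) :+ (:- t) :* (h :* i :- :1))
        refl (τ k) (p ^ k) (π ^ k) η iη)

    key : ∀ k → k < suc m →
      ρ (suc k) * p * p * (1# - p * p * p ^ k * p ^ k)
        * (1# - a * p * s * p ^ k * p ^ k + a * a * p * p * p * p ^ k * p ^ k * p ^ k * p ^ k) * u (suc (suc k))
      ≈ ρ k * factor k
    key k l = unit-cancel (unit-* (unit-* (_ , pπ k) (_ , pπ k)) hη)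
      (combine₃ (hτ k l) (τ-ρ (suc k)) (τ-ρ k)
       (solve 10 (λ a p s b P t t′ r r′ h →
          let g = :1 :- p :* p :* P :* P
              d = :1 :- a :* p :* s :* P :* P :+ a :* a :* p :* p :* p :* P :* P :* P :* P
              β′ = (p :* b) :* (p :* b)
              v = :1 :- a :* p :* β′ :* P
              v″ = :1 :- a :* p :* (b :* b) :* (p :* (p :* P))
              X = p :* P
              f = (:1 :- a :* P) :* (:1 :- s :* P :+ p :* P :* P) :* (β′ :- P :* P) :* a :* p :* P
          in P :* P :* h :* (r′ :* p :* p :* g :* d :* v″) :- P :* P :* h :* (r :* f)
             := :1 :* (t′ :* (g :* d :* v) :- t :* f)
                :+ (:- (g :* d :* v)) :* (t′ :- r′ :* (X :* X :* h)) :+ f :* (t :- r :* (P :* P :* h)))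
        refl a p s b (p ^ k) (τ k) (τ (suc k)) (ρ k) (ρ (suc k)) η))

    σ-term : Term a s β m σ
    σ-term k l = combine₁ (key k (ℕ.m<n⇒m<1+n l))
      (solve 7 (λ a p s b P r r′ →
          let g = :1 :- p :* p :* P :* P
              d = :1 :- a :* p :* s :* P :* P :+ a :* a :* p :* p :* p :* P :* P :* P :* P
              β = b :* b
              β′ = (p :* b) :* (p :* b)
              X = p :* P
              u = :1 :- a :* p :* β :* P
              u′ = :1 :- a :* p :* β :* X
              u″ = :1 :- a :* p :* β :* (p :* X)
              f′ = (:1 :- a :* P) :* (:1 :- s :* P :+ p :* P :* P)
              f = f′ :* (β′ :- P :* P) :* a :* p :* P
          in r′ :* (β′ :- X :* X) :* u′ :* u″ :* (g :* d :* u) :- r :* (β′ :- P :* P) :* u :* u′ :* (f′ :* (β :- P :* P) :* a :* p :* P)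
             := (β :- P :* P) :* u :* u′ :* (r′ :* p :* p :* g :* d :* u″ :- r :* f))
        refl a p s b (p ^ k) (ρ k) (ρ (suc k)))

    A = 1# - a * p * β * s + a * a * p * p * p * β * β

    H G : ℕ → Carrier
    H k = ρ k * β * factor k
    G k = ρ k * (1# - p ^ k * p ^ k) * (p - a * s * p ^ k * p ^ k + a * a * p ^ k * p ^ k * p ^ k * p ^ k) * β * p * u (suc k)

    H-G : ∀ k → k < suc m → H k ≈ G (suc k)
    H-G k l = combine₁ (sym (key k l))
      (solve 9 (λ a p s b P r r′ f u″ →
          let g = :1 :- p :* p :* P :* P
              d = :1 :- a :* p :* s :* P :* P :+ a :* a :* p :* p :* p :* P :* P :* P :* P
              X = p :* P
          in r :* b :* f :- r′ :* (:1 :- X :* X) :* (p :- a :* s :* X :* X :+ a :* a :* X :* X :* X :* X) :* b :* p :* u″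
             := b :* (r :* f :- r′ :* p :* p :* g :* d :* u″))
        refl a p s β (p ^ k) (ρ k) (ρ (suc k)) (factor k) (u (suc (suc k))))

    certificate : ∀ k → A * ((1# - a * p ^ k * p ^ k * p ^ k) * τ k) - (1# - a * p ^ k * p ^ k * p ^ k) * σ k ≈ H k - G k
    certificate k = combine₁ (τ-ρ k)
      (solve 7 (λ a p s b P t r →
          let β = b :* b
              β′ = (p :* b) :* (p :* b)
              X = p :* P
              c = :1 :- a :* P :* P :* P
              A = :1 :- a :* p :* β :* s :+ a :* a :* p :* p :* p :* β :* β
              u = :1 :- a :* p :* β :* P
              u′ = :1 :- a :* p :* β :* X
              f = (:1 :- a :* P) :* (:1 :- s :* P :+ p :* P :* P) :* (β′ :- P :* P) :* a :* p :* P
          in (A :* (c :* t) :- c :* (r :* (β′ :- P :* P) :* u :* u′))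
             :- (r :* β :* f :- r :* (:1 :- P :* P) :* (p :- a :* s :* P :* P :+ a :* a :* P :* P :* P :* P) :* β :* p :* u′)
             := (A :* c) :* (t :- r :* (P :* P :* (β′ :- :1))))
        refl a p s b (p ^ k) (τ k) (ρ k))

    -- The sum over σ is one term shorter because σ (m+1) contains β′ - p²ᵐ⁺² = 0.
    total-step : A * total a (suc (suc m)) τ ≈ total a (suc m) σ
    total-step = combine₁ diff
      (solve 8 (λ x t c r b p u u′ → x :- t := :1 :* ((x :- (t :+ c :* (r :* ((p :* b) :* (p :* b) :- (p :* b) :* (p :* b)) :* u :* u′))) :- :0)) refl
        (A * total a (suc (suc m)) τ) (total a (suc m) σ) (1# - a * p ^ suc m * p ^ suc m * p ^ suc m) (ρ (suc m)) b p (u (suc m)) (u (suc (suc m))))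
      where
      diff : A * total a (suc (suc m)) τ - total a (suc (suc m)) σ ≈ 0#
      diff = begin
        _ ≈⟨ +-congʳ (∑-distribˡ (suc (suc m)) A _) ⟩
        _ ≈⟨ ∑-minus (suc (suc m)) _ _ ⟨
        _ ≈⟨ ∑-cong (suc (suc m)) (λ k _ → certificate k) ⟩
        ∑ (suc (suc m)) (λ k → H k - G k) ≈⟨ telescope (suc m) H G H-G ⟩
        -- The factors β′ - p²ᵐ⁺² and 1 - 1 vanish.
        H (suc m) - G 0 ≈⟨ solve 9 (λ r β c p b d r′ f u′ →
             r :* β :* (c :* ((p :* b) :* (p :* b) :- (p :* b) :* (p :* b)) :* d :* p :* (p :* b))
               :- r′ :* (:1 :- :1 :* :1) :* f :* β :* p :* u′ := :0) refl
             (ρ (suc m)) β ((1# - a * p ^ suc m) * (1# - s * p ^ suc m + p * p ^ suc m * p ^ suc m)) p b a (ρ 0)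
             (p - a * s * 1# * 1# + a * a * 1# * 1# * 1# * 1#) (u 1) ⟩
        0# ∎

    σ₀ : σ 0 ≈ τ 0 * ((1# - a * p * β) * (1# - a * p * p * β))
    σ₀ = combine₁ (τ-ρ 0)
      (solve 5 (λ a p b t r →
          let β = b :* b
              β′ = (p :* b) :* (p :* b)
          in r :* (β′ :- :1 :* :1) :* (:1 :- a :* p :* β :* :1) :* (:1 :- a :* p :* β :* (p :* :1))
             :- t :* ((:1 :- a :* p :* β) :* (:1 :- a :* p :* p :* β))
             := (:- ((:1 :- a :* p :* β) :* (:1 :- a :* p :* p :* β))) :* (t :- r :* (:1 :* :1 :* (β′ :- :1))))
        refl a p b (τ 0) (ρ 0))

  A B : Carrier → Carrier → Carrier → Carrier
  A a s β = 1# - a * p * β * s + a * a * p * p * p * β * β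
  B a s β = (1# - a * p * β) * (1# - a * p * p * β)

  -- Each step puts one factor `A` on the left and, through the change `σ₀` of the first term, one
  -- factor `B` on the right; at m = 0 a single term is left.
  total-b : ∀ a s m → Unit p → (∀ j → j < m → Unit (p ^ suc j * p ^ suc j - 1#)) →
    ∀ τ → Term a s (p ^ m * p ^ m) m τ →
    total a (suc m) τ * ∏ m (λ j → A a s (p ^ j * p ^ j)) ≈ τ 0 * (1# - a) * ∏ m (λ j → B a s (p ^ j * p ^ j))
  total-b a s zero hp hη τ hτ = solve 2 (λ a t → (:0 :+ (:1 :- a :* :1 :* :1 :* :1) :* t) :* :1 := t :* (:1 :- a) :* :1) refl a (τ 0)
  total-b a s (suc m) hp hη τ hτ = combine₃ total-step ih σ₀
      (solve 9 (λ a A S T Π Π′ t s₀ c → T :* (Π :* A) :- t :* (:1 :- a) :* (Π′ :* c)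
         := Π :* (A :* T :- S) :+ :1 :* (S :* Π :- s₀ :* (:1 :- a) :* Π′) :+ ((:1 :- a) :* Π′) :* (s₀ :- t :* c))
        refl a (A a s (p ^ m * p ^ m)) (total a (suc m) σ) (total a (suc (suc m)) τ) _ _ (τ 0) (σ 0) (B a s (p ^ m * p ^ m)))
    where
    open StepB a s m hp (hη m ℕ.≤-refl) τ hτ hiding (A)
    ih = total-b a s m hp (λ j l → hη j (ℕ.m<n⇒m<1+n l)) σ σ-term

  -- The case c = p^(-2j), with e = 1/c.
  TermE : (a e β : Carrier) → ℕ → (ℕ → Carrier) → Set _
  TermE a e β K t = ∀ k → k < K →
    t (suc k) * ((1# - p * p * p ^ k * p ^ k) * (1# - a * p * p * e * p ^ k * p ^ k) * (e - a * p * p ^ k * p ^ k) * (1# - a * p * β * p ^ k))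
    ≈ t k * ((1# - a * p ^ k) * (e - p ^ k) * (1# - p * e * p ^ k) * (β - p ^ k * p ^ k) * a * p * p ^ k)

  -- Because es = 1 + pe², multiplication by e splits 1 - sP + pP² into (e - P)(1 - peP), and 1 -
  -- apsP² + a²p³P⁴ into (1 - ap²eP²)(e - apP²).
  Term⇒TermE : ∀ {a s e β K t} → e * s ≈ 1# + p * e * e → Term a s β K t → TermE a e β K t
  Term⇒TermE {a} {s} {e} {β} {K} {t} es h k l = combine₂ (h k l) es
    (solve 8 (λ a p s e β P t t′ →
       let g = :1 :- p :* p :* P :* P
           u = :1 :- a :* p :* β :* P
           v = (:1 :- a :* P)
           w = (β :- P :* P) :* a :* p :* P
       in t′ :* (g :* (:1 :- a :* p :* p :* e :* P :* P) :* (e :- a :* p :* P :* P) :* u)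
          :- t :* (v :* (e :- P) :* (:1 :- p :* e :* P) :* (β :- P :* P) :* a :* p :* P)
          := e :* (t′ :* (g :* (:1 :- a :* p :* s :* P :* P :+ a :* a :* p :* p :* p :* P :* P :* P :* P) :* u)
                   :- t :* (v :* (:1 :- s :* P :+ p :* P :* P) :* (β :- P :* P) :* a :* p :* P))
          :+ (t′ :* g :* u :* a :* p :* P :* P :- t :* v :* P :* w) :* (e :* s :- (:1 :+ p :* e :* e)))
     refl a p s e β (p ^ k) (t k) (t (suc k)))

  module StepC (a β : Carrier) (M : ℕ) (hp : Unit p)
    (hP : ∀ i → i < suc M ℕ.+ suc (suc (suc M)) → Unit (1# - p ^ suc i))
    (hc : ∀ k → k < suc (suc (suc M)) → Unit (p ^ suc (suc M) - a * p * p ^ k * p ^ k))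
    (τ : ℕ → Carrier) (hτ : TermE a (p ^ suc (suc M)) β (suc (suc M)) τ) where

    N = suc (suc M)
    ε e Y : Carrier
    ε = p ^ M
    e = p * (p * ε)
    Y = p - e * e

    -- With e = p²ε the quotient of the terms for ε and for e is, up to a constant, (e - pᵏ)(e -
    -- pᵏ⁺¹)(1 - aep²ᵏ) over the product of these three; `v₁` is 1 - epᵏ⁻¹ multiplied by p.
    v₁ v₂ v₃ : ℕ → Carrier
    v₁ k = p - e * p ^ k
    v₂ k = 1# - e * p ^ k
    v₃ k = e - a * p * p ^ k * p ^ k

    unit₂ : ∀ k → k < suc N → Unit (v₂ k)
    unit₂ k l = unit-resp (+-congˡ (-‿cong (^-homo-* p N k)))
      (hP (suc M ℕ.+ k) (ℕ.+-monoʳ-< (suc M) l))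

    unit₁ : ∀ k → k < suc N → Unit (v₁ k)
    unit₁ k l = unit-resp (trans (*-congˡ (+-congˡ (-‿cong (^-homo-* p (suc M) k))))
        (solve 3 (λ p E P → p :* (:1 :- p :* E :* P) := p :- p :* (p :* E) :* P) refl p ε (p ^ k)))
      (unit-* hp (hP (M ℕ.+ k) (s<s (ℕ.+-monoʳ-≤ M (ℕ.<⇒≤ l)))))

    hv : Invertible (suc N) (λ k → v₁ k * v₂ k * v₃ k)
    hv = invertible (suc N) λ k l → unit-* (unit-* (unit₁ k l) (unit₂ k l)) (hc k l)

    ω σ u : ℕ → Carrier
    ω k = τ k * proj₁ hv k
    σ k = ω k * (e - p ^ k) * (e - p * p ^ k) * (1# - a * e * p ^ k * p ^ k)
    u k = 1# - a * p * β * p ^ k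

    τ-ω : ∀ k → k < suc N → τ k ≈ ω k * (v₁ k * v₂ k * v₃ k)
    τ-ω k l = combine₁ (proj₂ hv k l)
      (solve 3 (λ t v i → t :- t :* i :* v := (:- t) :* (v :* i :- :1)) refl (τ k) (v₁ k * v₂ k * v₃ k) (proj₁ hv k))

    key : ∀ k → k < N →
      ω (suc k) * (e - a * p * p * p * p ^ k * p ^ k) * (1# - p * p * p ^ k * p ^ k) * (1# - a * p * p * e * p ^ k * p ^ k) * u k
      ≈ ω k * (1# - p * ε * p ^ k) * (1# - a * p ^ k) * (e - p ^ k) * (β - p ^ k * p ^ k) * a * p * p ^ k
    key k l = unit-cancel (unit-* hp (unit-* (unit-* (hc k (ℕ.m<n⇒m<1+n l)) (unit₂ k (ℕ.m<n⇒m<1+n l))) (unit₂ (suc k) (s<s l))))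
      (combine₃ (hτ k l) (τ-ω (suc k) (s<s l)) (τ-ω k (ℕ.m<n⇒m<1+n l))
       (solve 9 (λ a p ε β P t t′ w w′ →
          let e = p :* (p :* ε)
              X = p :* P
              g = :1 :- p :* p :* P :* P
              d = :1 :- a :* p :* p :* e :* P :* P
              u = :1 :- a :* p :* β :* P
              v₁ = p :- e :* P
              v₂ = :1 :- e :* P
              v₃ = e :- a :* p :* P :* P
              x₁ = p :- e :* X
              x₂ = :1 :- e :* X
              x₃ = e :- a :* p :* X :* X
              n = (:1 :- a :* P) :* (e :- P) :* (:1 :- p :* e :* P) :* (β :- P :* P) :* a :* p :* P
              c = p :* (v₃ :* v₂ :* x₂)
          in c :* (w′ :* (e :- a :* p :* p :* p :* P :* P) :* g :* d :* u)
             :- c :* (w :* (:1 :- p :* ε :* P) :* (:1 :- a :* P) :* (e :- P) :* (β :- P :* P) :* a :* p :* P)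
             := :1 :* (t′ :* (g :* d :* v₃ :* u) :- t :* n) :+ (:- (g :* d :* v₃ :* u)) :* (t′ :- w′ :* (x₁ :* x₂ :* x₃))
                :+ n :* (t :- w :* (v₁ :* v₂ :* v₃)))
        refl a p ε β (p ^ k) (τ k) (τ (suc k)) (ω k) (ω (suc k))))

    σ-term : TermE a ε β M σ
    σ-term k l = combine₁ (key k (ℕ.m<n⇒m<1+n (ℕ.m<n⇒m<1+n l)))
      (solve 7 (λ a p ε β P w w′ →
          let e = p :* (p :* ε)
              X = p :* P
              g = :1 :- p :* p :* P :* P
              u = :1 :- a :* p :* β :* P
              f = (:1 :- a :* P)
          in w′ :* (e :- X) :* (e :- p :* X) :* (:1 :- a :* e :* X :* X)
               :* (g :* (:1 :- a :* p :* p :* ε :* P :* P) :* (ε :- a :* p :* P :* P) :* u)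
             :- w :* (e :- P) :* (e :- p :* P) :* (:1 :- a :* e :* P :* P)
               :* (f :* (ε :- P) :* (:1 :- p :* ε :* P) :* (β :- P :* P) :* a :* p :* P)
             := ((e :- p :* P) :* (ε :- P) :* (:1 :- a :* e :* P :* P))
                :* (w′ :* (e :- a :* p :* p :* p :* P :* P) :* g :* (:1 :- a :* p :* p :* e :* P :* P) :* u
                    :- w :* (:1 :- p :* ε :* P) :* f :* (e :- P) :* (β :- P :* P) :* a :* p :* P))
       refl a p ε β (p ^ k) (ω k) (ω (suc k)))

    H G : ℕ → Carrier
    H k = ω k * ((1# - a * p ^ k) * (e - p ^ k) * (β - p ^ k * p ^ k) * a * p ^ k * (p - e * p ^ k) * Y)
    G k = ω k * ((1# - p ^ k * p ^ k) * (1# - a * e * p ^ k * p ^ k) * (1# - a * β * p ^ k) * (e - a * p * p ^ k * p ^ k) * Y)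

    H-G : ∀ k → k < N → H k ≈ G (suc k)
    H-G k l = combine₁ (sym (key k l))
      (solve 7 (λ a p ε β P w w′ →
          let e = p :* (p :* ε)
              X = p :* P
              Y = p :- e :* e
              g = :1 :- p :* p :* P :* P
              u = :1 :- a :* p :* β :* P
          in w :* ((:1 :- a :* P) :* (e :- P) :* (β :- P :* P) :* a :* P :* (p :- e :* P) :* Y)
             :- w′ :* ((:1 :- X :* X) :* (:1 :- a :* e :* X :* X) :* (:1 :- a :* β :* X) :* (e :- a :* p :* X :* X) :* Y)
             := Y :* (w :* (:1 :- p :* ε :* P) :* (:1 :- a :* P) :* (e :- P) :* (β :- P :* P) :* a :* p :* P
                 :- w′ :* (e :- a :* p :* p :* p :* P :* P) :* g :* (:1 :- a :* p :* p :* e :* P :* P) :* u))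
       refl a p ε β (p ^ k) (ω k) (ω (suc k)))

    certificate : ∀ k → k < suc N →
      (e - a * p * β) * ((1# - a * p ^ k * p ^ k * p ^ k) * σ k) - (1# - a * β * e) * ((1# - a * p ^ k * p ^ k * p ^ k) * τ k) ≈ H k - G k
    certificate k l = combine₁ (τ-ω k l)
      (solve 7 (λ a p e β P t w →
          let Y = p :- e :* e
              c = :1 :- a :* P :* P :* P
              m = :1 :- a :* β :* e
          in (e :- a :* p :* β) :* (c :* (w :* (e :- P) :* (e :- p :* P) :* (:1 :- a :* e :* P :* P))) :- m :* (c :* t)
             :- (w :* ((:1 :- a :* P) :* (e :- P) :* (β :- P :* P) :* a :* P :* (p :- e :* P) :* Y)
                 :- w :* ((:1 :- P :* P) :* (:1 :- a :* e :* P :* P) :* (:1 :- a :* β :* P) :* (e :- a :* p :* P :* P) :* Y))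
             := (:- (m :* c)) :* (t :- w :* ((p :- e :* P) :* (:1 :- e :* P) :* (e :- a :* p :* P :* P))))
       refl a p e β (p ^ k) (τ k) (ω k))

    -- The last two terms of σ vanish, one with e - p·pᴹ⁺¹ and one with e - pᴺ.
    total-step : (e - a * p * β) * total a (suc M) σ ≈ (1# - a * β * e) * total a (suc N) τ
    total-step = combine₁ diff
      (solve 12 (λ c S m T ε p w w′ x x′ y y′ →
         let e = p :* (p :* ε)
             P = p :* ε
         in c :* S :- m :* T
            := :1 :* ((c :* (S :+ x :* (w :* (e :- P) :* (e :- p :* P) :* y) :+ x′ :* (w′ :* (e :- e) :* (e :- p :* e) :* y′)) :- m :* T) :- :0)) refl
        (e - a * p * β) (total a (suc M) σ) (1# - a * β * e) (total a (suc N) τ) ε p (ω (suc M)) (ω N)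
        (1# - a * p ^ suc M * p ^ suc M * p ^ suc M) (1# - a * e * e * e) (1# - a * e * p ^ suc M * p ^ suc M) (1# - a * e * e * e))
      where
      diff : (e - a * p * β) * total a (suc N) σ - (1# - a * β * e) * total a (suc N) τ ≈ 0#
      diff = begin
        _ ≈⟨ +-cong (∑-distribˡ (suc N) _ _) (-‿cong (∑-distribˡ (suc N) _ _)) ⟩
        _ ≈⟨ ∑-minus (suc N) _ _ ⟨
        _ ≈⟨ ∑-cong (suc N) certificate ⟩
        ∑ (suc N) (λ k → H k - G k) ≈⟨ telescope N H G H-G ⟩
        -- As e = pᴺ, the factor e - pᴺ of H N is zero; G 0 contains 1 - 1.
        H N - G 0 ≈⟨ solve 11 (λ w f e c w′ a y Y d d′ d″ →
            w :* (f :* (e :- e) :* c :* a :* e :* y :* Y) :- w′ :* ((:1 :- :1 :* :1) :* d :* d′ :* d″ :* Y) := :0) refl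
            (ω N) (1# - a * p ^ N) e (β - e * e) (ω 0) a (p - e * e) Y (1# - a * e * 1# * 1#) (1# - a * β * 1#) (e - a * p * 1# * 1#) ⟩
        0# ∎

    σ₀ : σ 0 * (e - a * p) ≈ τ 0 * (1# - a * e)
    σ₀ = combine₁ (τ-ω 0 z<s)
      (solve 5 (λ a p e t w →
          w :* (e :- :1) :* (e :- p :* :1) :* (:1 :- a :* e :* :1 :* :1) :* (e :- a :* p)
          :- t :* (:1 :- a :* e)
          := (:- (:1 :- a :* e)) :* (t :- w :* ((p :- e :* :1) :* (:1 :- e :* :1) :* (e :- a :* p :* :1 :* :1))))
        refl a p e (τ 0) (ω 0))

  -- The exponent of e = p²ʲ drops by two in each step, down to e = 1. The bound L on the factors 1
  -- - pⁱ⁺¹ is separate from j so that it can stay fixed in the induction.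
  total-c : ∀ a β j L → (j ℕ.* 2) ℕ.+ (j ℕ.* 2) ≤ L → Unit p → (∀ i → i < L → Unit (1# - p ^ suc i)) →
    (∀ i k → i ≤ j → k ≤ i ℕ.* 2 → Unit (p ^ (i ℕ.* 2) - a * p * p ^ k * p ^ k)) →
    ∀ τ → TermE a (p ^ (j ℕ.* 2)) β (j ℕ.* 2) τ →
    total a (suc (j ℕ.* 2)) τ * ∏ j (λ i → (1# - a * β * p ^ (suc i ℕ.* 2)) * (p ^ (suc i ℕ.* 2) - a * p))
      ≈ τ 0 * (1# - a) * ∏ j (λ i → (p ^ (suc i ℕ.* 2) - a * p * β) * (1# - a * p ^ (suc i ℕ.* 2)))
  total-c a β zero L hL hp hP hc τ hτ = solve 2 (λ a t → (:0 :+ (:1 :- a :* :1 :* :1 :* :1) :* t) :* :1 := t :* (:1 :- a) :* :1) refl a (τ 0)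
  total-c a β (suc j) L hL hp hP hc τ hτ = combine₃ total-step ih σ₀
      (solve 11 (λ a A S T Π Π′ t s₀ e C d → T :* (Π :* (A :* C)) :- t :* (:1 :- a) :* (Π′ :* (e :* d))
         := (:- (Π :* C)) :* (e :* S :- A :* T) :+ (e :* C) :* (S :* Π :- s₀ :* (:1 :- a) :* Π′) :+ ((:1 :- a) :* Π′ :* e) :* (s₀ :* C :- t :* d))
        refl a (1# - a * β * e) (total a (suc M′) σ) (total a (suc N) τ) _ _ (τ 0) (σ 0) (e - a * p * β) (e - a * p) (1# - a * e))
    where
    M′ = j ℕ.* 2
    open StepC a β M′ hp
      (λ i l → hP i (ℕ.<-≤-trans l (ℕ.≤-trans (ℕ.≤-reflexive (≡.cong suc (ℕ.+-suc M′ (suc (suc M′))))) hL)))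
      (λ k l → hc (suc j) k ℕ.≤-refl (ℕ.≤-pred l)) τ hτ
    ih = total-c a β j L (ℕ.≤-trans (ℕ.+-mono-≤ (ℕ.m≤n+m M′ 2) (ℕ.m≤n+m M′ 2)) hL) hp hP
      (λ i k l l′ → hc i k (ℕ.m≤n⇒m≤1+n l) l′) σ σ-term

-- Quotients, the extension R[z]/(z² - ez), and ring homomorphisms

module Quotient {c ℓ} (R : CommutativeRing c ℓ) (x : CommutativeRing.Carrier R) where
  open CommutativeRing R
  open ℤSolver R
  open Units R
  open import Relation.Binary.Reasoning.Setoid setoid

  infix 4 _≋_
  -- A record, so that both sides can be inferred from a proof and the cofactor can be extracted
  -- from it.
  record _≋_ (a b : Carrier) : Set (c ⊔ ℓ) where
    constructor multiple
    field
      factor : Carrier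
      equation : a - b ≈ x * factor
  open _≋_ public

  ≈⇒≋ : ∀ {a b} → a ≈ b → a ≋ b
  ≈⇒≋ h = multiple 0# (trans (diff≈0 h) (sym (zeroʳ x)))

  ≋-combine₂ : ∀ {L M A B c A′ B′ c′} → A ≋ B → A′ ≋ B′ →
    L - M ≈ c * (A - B) + c′ * (A′ - B′) → L ≋ M
  ≋-combine₂ {c = c} {c′ = c′} (multiple d h) (multiple d′ h′) e = multiple (c * d + c′ * d′) (begin
    _ ≈⟨ e ⟩
    _ ≈⟨ +-cong (*-congˡ h) (*-congˡ h′) ⟩
    c * (x * d) + c′ * (x * d′) ≈⟨ solve 5 (λ x c d c′ d′ → c :* (x :* d) :+ c′ :* (x :* d′) := x :* (c :* d :+ c′ :* d′)) refl x c d c′ d′ ⟩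
    x * (c * d + c′ * d′) ∎)

  ≋-combine₁ : ∀ {L M A B c} → A ≋ B → L - M ≈ c * (A - B) → L ≋ M
  ≋-combine₁ {c = c} h e = ≋-combine₂ {c = c} {A′ = 0#} {0#} {0#} h (≈⇒≋ refl)
    (trans e (solve 2 (λ a o → a := a :+ :0 :* (:0 :- :0)) refl _ 0#))

  quotient : CommutativeRing c (c ⊔ ℓ)
  quotient = record
    { Carrier = Carrier ; _≈_ = _≋_ ; _+_ = _+_ ; _*_ = _*_ ; -_ = -_ ; 0# = 0# ; 1# = 1#
    ; isCommutativeRing = record
      { isRing = record
        { +-isAbelianGroup = record
          { isGroup = record
            { isMonoid = record
              { isSemigroup = record
                { isMagma = record
                  { isEquivalence = record
                    { refl = ≈⇒≋ refl
                    ; sym = λ h → ≋-combine₁ h (solve 2 (λ a b → b :- a := (:- :1) :* (a :- b)) refl _ _)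
                    ; trans = λ h h′ → ≋-combine₂ h h′
                        (solve 3 (λ a b c → a :- c := :1 :* (a :- b) :+ :1 :* (b :- c)) refl _ _ _)
                    }
                  ; ∙-cong = λ h h′ → ≋-combine₂ h h′
                      (solve 4 (λ a b c d → (a :+ c) :- (b :+ d) := :1 :* (a :- b) :+ :1 :* (c :- d)) refl _ _ _ _)
                  }
                ; assoc = λ a b c → ≈⇒≋ (+-assoc a b c)
                }
              ; identity = (λ a → ≈⇒≋ (+-identityˡ a)) , (λ a → ≈⇒≋ (+-identityʳ a))
              }
            ; inverse = (λ a → ≈⇒≋ (-‿inverseˡ a)) , (λ a → ≈⇒≋ (-‿inverseʳ a))
            ; ⁻¹-cong = λ h → ≋-combine₁ h (solve 2 (λ a b → (:- a) :- (:- b) := (:- :1) :* (a :- b)) refl _ _)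
            }
          ; comm = λ a b → ≈⇒≋ (+-comm a b)
          }
        ; *-cong = λ h h′ → ≋-combine₂ h h′
            (solve 4 (λ a b c d → a :* c :- b :* d := c :* (a :- b) :+ b :* (c :- d)) refl _ _ _ _)
        ; *-assoc = λ a b c → ≈⇒≋ (*-assoc a b c)
        ; *-identity = (λ a → ≈⇒≋ (*-identityˡ a)) , (λ a → ≈⇒≋ (*-identityʳ a))
        ; distrib = (λ a b c → ≈⇒≋ (distribˡ a b c)) , (λ a b c → ≈⇒≋ (distribʳ a b c))
        }
      ; *-comm = λ a b → ≈⇒≋ (*-comm a b)
      }
    }

-- R[z]/(z² - e z), whose elements u + w z are determined by their values at z = 0 and z = e
-- as soon as e is regular; w is the divided difference of these values.
module Extension {c ℓ} (R : CommutativeRing c ℓ) (e : CommutativeRing.Carrier R) where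
  open CommutativeRing R
  open ℤSolver R
  open Units R

  infix 4 _≋_
  _≋_ : Carrier × Carrier → Carrier × Carrier → Set _
  (u , w) ≋ (u′ , w′) = (u ≈ u′) × (w ≈ w′)

  extension : CommutativeRing c ℓ
  extension = record
    { Carrier = Carrier × Carrier ; _≈_ = _≋_
    ; _+_ = λ (u , w) (u′ , w′) → u + u′ , w + w′
    ; _*_ = λ (u , w) (u′ , w′) → u * u′ , u * w′ + w * u′ + e * w * w′
    ; -_ = λ (u , w) → - u , - w ; 0# = 0# , 0# ; 1# = 1# , 0#
    ; isCommutativeRing = record
      { isRing = record
        { +-isAbelianGroup = record
          { isGroup = record
            { isMonoid = record
              { isSemigroup = record
                { isMagma = record
                  { isEquivalence = record
                    { refl = refl , refl
                    ; sym = λ (h , k) → sym h , sym k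
                    ; trans = λ (h , k) (h′ , k′) → trans h h′ , trans k k′
                    }
                  ; ∙-cong = λ (h , k) (h′ , k′) → +-cong h h′ , +-cong k k′
                  }
                ; assoc = λ _ _ _ → +-assoc _ _ _ , +-assoc _ _ _
                }
              ; identity = (λ _ → +-identityˡ _ , +-identityˡ _) , (λ _ → +-identityʳ _ , +-identityʳ _)
              }
            ; inverse = (λ _ → -‿inverseˡ _ , -‿inverseˡ _) , (λ _ → -‿inverseʳ _ , -‿inverseʳ _)
            ; ⁻¹-cong = λ (h , k) → -‿cong h , -‿cong k
            }
          ; comm = λ _ _ → +-comm _ _ , +-comm _ _
          }
        ; *-cong = λ (h , k) (h′ , k′) → *-cong h h′ , +-cong (+-cong (*-cong h k′) (*-cong k h′)) (*-cong (*-congˡ k) k′)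
        ; *-assoc = λ (u , w) (u′ , w′) (u″ , w″) → *-assoc u u′ u″ ,
            solve 7 (λ e u w u′ w′ u″ w″ → u :* u′ :* w″ :+ (u :* w′ :+ w :* u′ :+ e :* w :* w′) :* u″ :+ e :* (u :* w′ :+ w :* u′ :+ e :* w :* w′) :* w″
              := u :* (u′ :* w″ :+ w′ :* u″ :+ e :* w′ :* w″) :+ w :* (u′ :* u″) :+ e :* w :* (u′ :* w″ :+ w′ :* u″ :+ e :* w′ :* w″)) refl e u w u′ w′ u″ w″
        ; *-identity = (λ (u , w) → *-identityˡ u , solve 3 (λ e u w → :1 :* w :+ :0 :* u :+ e :* :0 :* w := w) refl e u w)
                     , (λ (u , w) → *-identityʳ u , solve 3 (λ e u w → u :* :0 :+ w :* :1 :+ e :* w :* :0 := w) refl e u w)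
        ; distrib = (λ (u , w) (u′ , w′) (u″ , w″) → distribˡ u u′ u″ ,
              solve 7 (λ e u w u′ w′ u″ w″ → u :* (w′ :+ w″) :+ w :* (u′ :+ u″) :+ e :* w :* (w′ :+ w″)
                := (u :* w′ :+ w :* u′ :+ e :* w :* w′) :+ (u :* w″ :+ w :* u″ :+ e :* w :* w″)) refl e u w u′ w′ u″ w″)
          , (λ (u , w) (u′ , w′) (u″ , w″) → distribʳ u u′ u″ ,
              solve 7 (λ e u w u′ w′ u″ w″ → (u′ :+ u″) :* w :+ (w′ :+ w″) :* u :+ e :* (w′ :+ w″) :* w
                := (u′ :* w :+ w′ :* u :+ e :* w′ :* w) :+ (u″ :* w :+ w″ :* u :+ e :* w″ :* w)) refl e u w u′ w′ u″ w″)
        }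
      ; *-comm = λ (u , w) (u′ , w′) → *-comm u u′ , solve 5 (λ e u w u′ w′ → u :* w′ :+ w :* u′ :+ e :* w :* w′ := u′ :* w :+ w′ :* u :+ e :* w′ :* w) refl e u w u′ w′
      }
    }

  ι : Carrier → Carrier × Carrier
  ι u = u , 0#

  at0 ate : Carrier × Carrier → Carrier
  at0 (u , w) = u
  ate (u , w) = u + e * w

  ate-* : ∀ x y → ate (CommutativeRing._*_ extension x y) ≈ ate x * ate y
  ate-* (u , w) (u′ , w′) = solve 5 (λ e u w u′ w′ → u :* u′ :+ e :* (u :* w′ :+ w :* u′ :+ e :* w :* w′) := (u :+ e :* w) :* (u′ :+ e :* w′)) refl e u w u′ w′

  -- The inverse must have the values 1/u at 0 and 1/(u + ew) at e; the divided difference of these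
  -- is -w/(u(u + ew)).
  unit : ∀ {u w} → Unit u → Unit (u + e * w) → Units.Unit extension (u , w)
  unit {u} {w} (i , h) (j , k) = (i , - (i * w * j)) , h ,
    combine₂ h k (solve 5 (λ e u w i j → u :* (:- (i :* w :* j)) :+ w :* i :+ e :* w :* (:- (i :* w :* j)) :- :0
      := :0 :* (u :* i :- :1) :+ (:- (i :* w)) :* ((u :+ e :* w) :* j :- :1)) refl e u w i j)

record Hom {c ℓ c′ ℓ′} (R : CommutativeRing c ℓ) (S : CommutativeRing c′ ℓ′) : Set (c ⊔ ℓ ⊔ c′ ⊔ ℓ′) where
  private
    module R = CommutativeRing R
    module S = CommutativeRing S
  field
    ⟦_⟧ : R.Carrier → S.Carrier
    cong : ∀ {x y} → x R.≈ y → ⟦ x ⟧ S.≈ ⟦ y ⟧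
    +-hom : ∀ x y → ⟦ x R.+ y ⟧ S.≈ ⟦ x ⟧ S.+ ⟦ y ⟧
    *-hom : ∀ x y → ⟦ x R.* y ⟧ S.≈ ⟦ x ⟧ S.* ⟦ y ⟧
    neg-hom : ∀ x → ⟦ R.- x ⟧ S.≈ S.- ⟦ x ⟧
    0-hom : ⟦ R.0# ⟧ S.≈ S.0#
    1-hom : ⟦ R.1# ⟧ S.≈ S.1#

_∘ʰ_ : ∀ {c ℓ c′ ℓ′ c″ ℓ″} {R : CommutativeRing c ℓ} {S : CommutativeRing c′ ℓ′} {T : CommutativeRing c″ ℓ″} →
  Hom S T → Hom R S → Hom R T
_∘ʰ_ {T = T} g f = record
  { ⟦_⟧ = λ x → G.⟦ F.⟦ x ⟧ ⟧ ; cong = λ e → G.cong (F.cong e)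
  ; +-hom = λ x y → T.trans (G.cong (F.+-hom x y)) (G.+-hom _ _)
  ; *-hom = λ x y → T.trans (G.cong (F.*-hom x y)) (G.*-hom _ _)
  ; neg-hom = λ x → T.trans (G.cong (F.neg-hom x)) (G.neg-hom _)
  ; 0-hom = T.trans (G.cong F.0-hom) G.0-hom
  ; 1-hom = T.trans (G.cong F.1-hom) G.1-hom }
  where
  module F = Hom f
  module G = Hom g
  module T = CommutativeRing T

module HomProperties {c ℓ c′ ℓ′} {R : CommutativeRing c ℓ} {S : CommutativeRing c′ ℓ′} (f : Hom R S) where
  private
    module R = CommutativeRing R
    module S = CommutativeRing S
    module ER = Exp R.semiring
    module ES = Exp S.semiring
    module QR = Quadratic R
    module QS = Quadratic S
    module SR = Sums R
    module SS = Sums S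
  open Hom f
  open Units using (Unit)

  sub-hom : ∀ x y → ⟦ x R.- y ⟧ S.≈ ⟦ x ⟧ S.- ⟦ y ⟧
  sub-hom x y = S.trans (+-hom x _) (S.+-congˡ (neg-hom y))

  ^-hom : ∀ x k → ⟦ x ER.^ k ⟧ S.≈ ⟦ x ⟧ ES.^ k
  ^-hom x zero = 1-hom
  ^-hom x (suc k) = S.trans (*-hom x _) (S.*-congˡ (^-hom x k))

  unit-hom : ∀ {x} → Unit R x → Unit S ⟦ x ⟧
  unit-hom (i , h) = ⟦ i ⟧ , S.trans (S.sym (*-hom _ i)) (S.trans (cong h) 1-hom)

  1-sub-hom : ∀ {x x′} → ⟦ x ⟧ S.≈ x′ → ⟦ R.1# R.- x ⟧ S.≈ S.1# S.- x′
  1-sub-hom e = S.trans (sub-hom _ _) (S.+-cong 1-hom (S.-‿cong e))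

  *-hom′ : ∀ {x y x′ y′} → ⟦ x ⟧ S.≈ x′ → ⟦ y ⟧ S.≈ y′ → ⟦ x R.* y ⟧ S.≈ x′ S.* y′
  *-hom′ e e′ = S.trans (*-hom _ _) (S.*-cong e e′)

  +-hom′ : ∀ {x y x′ y′} → ⟦ x ⟧ S.≈ x′ → ⟦ y ⟧ S.≈ y′ → ⟦ x R.+ y ⟧ S.≈ x′ S.+ y′
  +-hom′ e e′ = S.trans (+-hom _ _) (S.+-cong e e′)

  module _ {p p′} (hp : ⟦ p ⟧ S.≈ p′) {a a′ s s′ β β′} (ha : ⟦ a ⟧ S.≈ a′) (hs : ⟦ s ⟧ S.≈ s′) (hβ : ⟦ β ⟧ S.≈ β′) where

    den-hom : ∀ {P P′} → ⟦ P ⟧ S.≈ P′ → ⟦ QR.den p a s β P ⟧ S.≈ QS.den p′ a′ s′ β′ P′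
    den-hom hP = *-hom′ (*-hom′ (1-sub-hom (*-hom′ (*-hom′ (*-hom′ hp hp) hP) hP))
        (+-hom′ (1-sub-hom (*-hom′ (*-hom′ (*-hom′ (*-hom′ ha hp) hs) hP) hP))
          (*-hom′ (*-hom′ (*-hom′ (*-hom′ (*-hom′ (*-hom′ (*-hom′ (*-hom′ ha ha) hp) hp) hp) hP) hP) hP) hP)))
      (1-sub-hom (*-hom′ (*-hom′ (*-hom′ ha hp) hβ) hP))

    num-hom : ∀ {P P′} → ⟦ P ⟧ S.≈ P′ → ⟦ QR.num p a s β P ⟧ S.≈ QS.num p′ a′ s′ β′ P′
    num-hom hP = *-hom′ (*-hom′ (*-hom′ (*-hom′ (*-hom′ (1-sub-hom (*-hom′ ha hP))
      (+-hom′ (1-sub-hom (*-hom′ hs hP)) (*-hom′ (*-hom′ hp hP) hP)))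
      (S.trans (sub-hom _ _) (S.+-cong hβ (S.-‿cong (*-hom′ hP hP))))) ha) hp) hP

    pow-hom : ∀ k → ⟦ p ER.^ k ⟧ S.≈ p′ ES.^ k
    pow-hom k = S.trans (^-hom p k) (^-cong k hp)
      where
      ^-cong : ∀ k {x y} → x S.≈ y → x ES.^ k S.≈ y ES.^ k
      ^-cong zero e = S.refl
      ^-cong (suc k) e = S.*-cong e (^-cong k e)

    Term-hom : ∀ {K t} → QR.Term p a s β K t → QS.Term p′ a′ s′ β′ K (λ k → ⟦ t k ⟧)
    Term-hom h k l = S.trans (S.sym (*-hom′ S.refl (den-hom (pow-hom k))))
      (S.trans (cong (h k l)) (*-hom′ S.refl (num-hom (pow-hom k))))

    total-hom : ∀ K t → ⟦ QR.total p a K t ⟧ S.≈ QS.total p′ a′ K (λ k → ⟦ t k ⟧)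
    total-hom zero t = 0-hom
    total-hom (suc K) t = +-hom′ (total-hom K t)
      (*-hom′ (1-sub-hom (*-hom′ (*-hom′ (*-hom′ ha (pow-hom K)) (pow-hom K)) (pow-hom K))) S.refl)

module ExtensionHoms {c ℓ} (R : CommutativeRing c ℓ) (e : CommutativeRing.Carrier R) where
  open CommutativeRing R
  open ℤSolver R
  open Extension R e

  ι-hom : Hom R extension
  ι-hom = record
    { ⟦_⟧ = ι ; cong = λ h → h , refl ; +-hom = λ x y → refl , sym (+-identityˡ 0#)
    ; *-hom = λ x y → refl , solve 3 (λ e x y → :0 := x :* :0 :+ :0 :* y :+ e :* :0 :* :0) refl e x y
    ; neg-hom = λ x → refl , solve 1 (λ x → :0 := :- :0) refl x
    ; 0-hom = refl , refl ; 1-hom = refl , refl }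

  at0-hom : Hom extension R
  at0-hom = record
    { ⟦_⟧ = at0 ; cong = proj₁ ; +-hom = λ _ _ → refl ; *-hom = λ _ _ → refl ; neg-hom = λ _ → refl ; 0-hom = refl ; 1-hom = refl }

  ate-hom : Hom extension R
  ate-hom = record
    { ⟦_⟧ = ate ; cong = λ (h , k) → +-cong h (*-congˡ k)
    ; +-hom = λ (u , w) (u′ , w′) → solve 5 (λ e u w u′ w′ → (u :+ u′) :+ e :* (w :+ w′) := (u :+ e :* w) :+ (u′ :+ e :* w′)) refl e u w u′ w′
    ; *-hom = ate-*
    ; neg-hom = λ (u , w) → solve 3 (λ e u w → (:- u) :+ e :* (:- w) := :- (u :+ e :* w)) refl e u w
    ; 0-hom = solve 1 (λ e → :0 :+ e :* :0 := :0) refl e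
    ; 1-hom = solve 1 (λ e → :1 :+ e :* :0 := :1) refl e }

quotient-hom : ∀ {c ℓ} (R : CommutativeRing c ℓ) x → Hom R (Quotient.quotient R x)
quotient-hom R x = record
  { ⟦_⟧ = λ a → a ; cong = ≈⇒≋ ; +-hom = λ _ _ → ≈⇒≋ refl ; *-hom = λ _ _ → ≈⇒≋ refl ; neg-hom = λ _ → ≈⇒≋ refl ; 0-hom = ≈⇒≋ refl ; 1-hom = ≈⇒≋ refl }
  where
  open CommutativeRing R
  open Quotient R x

-- Sums over roots of unity

module MoreSums {c ℓ} (R : CommutativeRing c ℓ) where
  open CommutativeRing R
  open Units R
  open ℤSolver R
  open Sums R
  open import Relation.Binary.Reasoning.Setoid setoid

  ∑-+ : ∀ n f g → ∑ n (λ i → f i + g i) ≈ ∑ n f + ∑ n g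
  ∑-+ zero f g = sym (+-identityˡ 0#)
  ∑-+ (suc n) f g = trans (+-congʳ (∑-+ n f g)) (solve 4 (λ a b c d → (a :+ b) :+ (c :+ d) := (a :+ c) :+ (b :+ d)) refl _ _ _ _)

  ∑-0 : ∀ n → ∑ n (λ _ → 0#) ≈ 0#
  ∑-0 zero = refl
  ∑-0 (suc n) = trans (+-identityʳ _) (∑-0 n)

  ∑-swap : ∀ j k (f : ℕ → ℕ → Carrier) → ∑ j (λ a → ∑ k (f a)) ≈ ∑ k (λ b → ∑ j (λ a → f a b))
  ∑-swap zero k f = sym (∑-0 k)
  ∑-swap (suc j) k f = trans (+-congʳ (∑-swap j k f)) (sym (∑-+ k _ (f j)))

  ∑-head : ∀ n (f : ℕ → Carrier) → ∑ (suc n) f ≈ f 0 + ∑ n (λ i → f (suc i))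
  ∑-head zero f = +-comm _ _
  ∑-head (suc n) f = trans (+-congʳ (∑-head n f)) (+-assoc _ _ _)

  ∑-reverse : ∀ n (f : ℕ → Carrier) → ∑ n (λ i → f (n ∸ i)) ≈ ∑ n (λ i → f (suc i))
  ∑-reverse zero f = refl
  ∑-reverse (suc n) f = trans (∑-head n _) (trans (+-comm _ _) (+-congʳ (∑-reverse n f)))

  ∏-* : ∀ n f g → ∏ n (λ i → f i * g i) ≈ ∏ n f * ∏ n g
  ∏-* zero f g = sym (*-identityˡ 1#)
  ∏-* (suc n) f g = trans (*-congʳ (∏-* n f g)) (solve 4 (λ a b c d → (a :* b) :* (c :* d) := (a :* c) :* (b :* d)) refl _ _ _ _)

  ∏-head : ∀ n (f : ℕ → Carrier) → ∏ (suc n) f ≈ f 0 * ∏ n (λ i → f (suc i))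
  ∏-head zero f = *-comm _ _
  ∏-head (suc n) f = trans (*-congʳ (∏-head n f)) (*-assoc _ _ _)

  ∏-reverse : ∀ n (f : ℕ → Carrier) → ∏ n (λ i → f (n ∸ i)) ≈ ∏ n (λ i → f (suc i))
  ∏-reverse zero f = refl
  ∏-reverse (suc n) f = trans (∏-head n _) (trans (*-comm _ _) (*-congʳ (∏-reverse n f)))

  ∏-unit : ∀ n {f} → (∀ i → i < n → Unit (f i)) → Unit (∏ n f)
  ∏-unit zero h = 1# , *-identityˡ 1#
  ∏-unit (suc n) h = unit-* (∏-unit n λ i l → h i (ℕ.m<n⇒m<1+n l)) (h n ℕ.≤-refl)

  nat : ℕ → Carrier
  nat zero = 0#
  nat (suc k) = nat k + 1#

  -- Characterises the constant (n² - 1)/24 of B(n,q) without division, with 24 as 2·2·2·3.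
  IsSquarePred/24 : ℕ → Carrier → Set ℓ
  IsSquarePred/24 n r = (1# + 1#) * (1# + 1#) * (1# + 1#) * (1# + 1# + 1#) * r ≈ nat n * nat n - 1#

-- A primitive root of unity of order n = 4m + 1, with powers pw; i j is the inverse of 1 - pw j.
record PrimitiveRoot {c ℓ} (R : CommutativeRing c ℓ) (m : ℕ) : Set (c ⊔ ℓ) where
  open CommutativeRing R
  field
    q : Carrier
    pw : ℕ → Carrier
    pw-0 : pw 0 ≈ 1#
    pw-suc : ∀ k → pw (suc k) ≈ q * pw k
    pw-n : pw (suc (m ℕ.* 4)) ≈ 1#
    i : ℕ → Carrier
    inverse : ∀ j → ¬ suc (m ℕ.* 4) ∣ j → (1# - pw j) * i j ≈ 1#

module RootOfUnity {c ℓ} (R : CommutativeRing c ℓ) (m : ℕ) (ζ : PrimitiveRoot R m) where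
  open CommutativeRing R
  open PrimitiveRoot ζ
  open Units R
  open ℤSolver R
  open Sums R
  open MoreSums R
  open import Relation.Binary.Reasoning.Setoid setoid

  n : ℕ
  n = suc (m ℕ.* 4)

  pw-+ : ∀ j k → pw (j ℕ.+ k) ≈ pw j * pw k
  pw-+ zero k = trans (sym (*-identityˡ _)) (*-congʳ (sym pw-0))
  pw-+ (suc j) k = trans (pw-suc (j ℕ.+ k)) (trans (*-congˡ (pw-+ j k)) (trans (sym (*-assoc _ _ _)) (*-congʳ (sym (pw-suc j)))))

  pw-complement : ∀ j k → j ℕ.+ k ≡ n → pw j * pw k ≈ 1#
  pw-complement j k e = trans (sym (pw-+ j k)) (trans (reflexive (≡.cong pw e)) pw-n)

  pw-multiple : ∀ k → pw (k ℕ.* n) ≈ 1#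
  pw-multiple zero = pw-0
  pw-multiple (suc k) = trans (pw-+ n (k ℕ.* n)) (trans (*-cong pw-n (pw-multiple k)) (*-identityˡ 1#))

  below-n : ∀ {j} → suc j < n → ¬ n ∣ suc j
  below-n l h = ℕ.<⇒≱ l (∣ℕ.∣⇒≤ h)

  O₁ O₃ H D : ℕ → Carrier
  O₁ j = 1# - pw (suc (j ℕ.* 4))
  O₃ j = 1# - pw (3 ℕ.+ j ℕ.* 4)
  H j = 1# - pw (2 ℕ.+ j ℕ.* 4)
  D j = 1# - pw (suc j ℕ.* 4)

  -- Pair j with k where j + k + 1 = m: the exponents 4j + 1 and 4(k + 1) add up to n, and so do 4j
  -- + 3 and 4k + 2. As 1 - 1/x = -(1 - x)/x, the signs cancel in pairs, and the powers of q
  -- multiply to the exponent m(4m + 2) = mn + m.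
  reflected : ∏ m (λ j → O₁ j * O₃ j) * pw m ≈ ∏ m (λ j → H j * D j)
  reflected = begin
    ∏ m (λ j → O₁ j * O₃ j) * pw m ≈⟨ *-congˡ powers ⟨
    ∏ m (λ j → O₁ j * O₃ j) * ∏ m (λ j → P (m ∸ j)) ≈⟨ ∏-* m _ _ ⟨
    ∏ m (λ j → O₁ j * O₃ j * P (m ∸ j)) ≈⟨ ∏-cong m (λ j l → factor j (m ∸ j) (ℕ.m<n⇒0<n∸m l) (ℕ.m+[n∸m]≡n (ℕ.<⇒≤ l))) ⟩
    ∏ m (λ j → HD (m ∸ j)) ≈⟨ ∏-reverse m HD ⟩
    ∏ m (λ j → H j * D j) ∎
    where
    P HD : ℕ → Carrier
    P zero = 1#
    P (suc j) = pw (suc j ℕ.* 4) * pw (2 ℕ.+ j ℕ.* 4)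
    HD zero = 1#
    HD (suc j) = H j * D j
    open Data.Nat.Solver.+-*-Solver using () renaming (solve to solveℕ; _:+_ to _:+ℕ_; _:*_ to _:*ℕ_; _:=_ to _:=ℕ_; con to conℕ)
    factor : ∀ j k → 0 < k → j ℕ.+ k ≡ m → O₁ j * O₃ j * P k ≈ HD k
    factor j (suc k) _ e = combine₂ (pw-complement (suc (j ℕ.* 4)) (suc k ℕ.* 4) e₁) (pw-complement (3 ℕ.+ j ℕ.* 4) (2 ℕ.+ k ℕ.* 4) e₂)
      (solve 4 (λ a b x y → (:1 :- a) :* (:1 :- b) :* (x :* y) :- (:1 :- y) :* (:1 :- x)
        := ((:- y) :* (:1 :- b)) :* (a :* x :- :1) :+ (:1 :- x) :* (b :* y :- :1)) refl
        (pw (suc (j ℕ.* 4))) (pw (3 ℕ.+ j ℕ.* 4)) (pw (suc k ℕ.* 4)) (pw (2 ℕ.+ k ℕ.* 4)))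
      where
      e₁ : suc (j ℕ.* 4) ℕ.+ suc k ℕ.* 4 ≡ n
      e₁ = ≡.trans (solveℕ 2 (λ j k → (conℕ 1 :+ℕ j :*ℕ conℕ 4) :+ℕ (conℕ 1 :+ℕ k) :*ℕ conℕ 4 :=ℕ conℕ 1 :+ℕ (j :+ℕ (conℕ 1 :+ℕ k)) :*ℕ conℕ 4) ≡.refl j k) (≡.cong (λ m → suc (m ℕ.* 4)) e)
      e₂ : 3 ℕ.+ j ℕ.* 4 ℕ.+ (2 ℕ.+ k ℕ.* 4) ≡ n
      e₂ = ≡.trans (solveℕ 2 (λ j k → (conℕ 3 :+ℕ j :*ℕ conℕ 4) :+ℕ (conℕ 2 :+ℕ k :*ℕ conℕ 4) :=ℕ conℕ 1 :+ℕ (j :+ℕ (conℕ 1 :+ℕ k)) :*ℕ conℕ 4) ≡.refl j k) (≡.cong (λ m → suc (m ℕ.* 4)) e)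
    exponent : ∀ r → ∏ r (λ j → P (suc j)) ≈ pw (r ℕ.* (r ℕ.* 4 ℕ.+ 2))
    exponent zero = sym pw-0
    exponent (suc r) = trans (*-congʳ (exponent r)) (trans (*-congˡ (sym (pw-+ (suc r ℕ.* 4) (2 ℕ.+ r ℕ.* 4))))
      (trans (sym (pw-+ (r ℕ.* (r ℕ.* 4 ℕ.+ 2)) _)) (reflexive (≡.cong pw
        (solveℕ 1 (λ r → r :*ℕ (r :*ℕ conℕ 4 :+ℕ conℕ 2) :+ℕ ((conℕ 1 :+ℕ r) :*ℕ conℕ 4 :+ℕ (conℕ 2 :+ℕ r :*ℕ conℕ 4)) :=ℕ (conℕ 1 :+ℕ r) :*ℕ ((conℕ 1 :+ℕ r) :*ℕ conℕ 4 :+ℕ conℕ 2)) ≡.refl r)))))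
    powers : ∏ m (λ j → P (m ∸ j)) ≈ pw m
    powers = trans (∏-reverse m P) (trans (exponent m) (trans (reflexive (≡.cong pw
        (solveℕ 1 (λ m → m :*ℕ (m :*ℕ conℕ 4 :+ℕ conℕ 2) :=ℕ m :*ℕ (conℕ 1 :+ℕ m :*ℕ conℕ 4) :+ℕ m) ≡.refl m)))
      (trans (pw-+ (m ℕ.* n) m) (trans (*-congʳ (pw-multiple m)) (*-identityˡ _)))))

  -- The summand qʲ/[j]² of B(n,q), divided by (1 - q)².
  F : ℕ → Carrier
  F j = pw j * (i j * i j)

  ν : Carrier
  ν = nat n

  -- Σ r(ν - r)xʳ telescopes, with difference quotient Q(r)xʳ for a polynomial Q of degree 2.
  G : ℕ → Carrier → (ℕ → Carrier) → Carrier
  G N x x^ = ∑ N λ r → nat r * (ν - nat r) * x^ r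

  G-closed : ∀ N x x^ → x^ 0 ≈ 1# → (∀ k → x^ (suc k) ≈ x * x^ k) →
    let e = 1# - x
        Q = λ r → x * (1# + x - ν * e) + (1# + 1#) * x * e * r - ν * e * e * r + e * e * r * r
    in e * e * e * G N x x^ ≈ Q (nat N) * x^ N - Q 0#
  G-closed zero x x^ h₀ hs = combine₁ h₀ (solve 3 (λ x ν y →
      let e = :1 :- x
          Q = λ r → x :* (:1 :+ x :- ν :* e) :+ (:1 :+ :1) :* x :* e :* r :- ν :* e :* e :* r :+ e :* e :* r :* r
      in e :* e :* e :* :0 :- (Q :0 :* y :- Q :0) := (:- Q :0) :* (y :- :1)) refl x ν (x^ 0))
  G-closed (suc N) x x^ h₀ hs = combine₂ (G-closed N x x^ h₀ hs) (hs N) (solve 6 (λ x ν r y y′ g →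
      let e = :1 :- x
          Q = λ r → x :* (:1 :+ x :- ν :* e) :+ (:1 :+ :1) :* x :* e :* r :- ν :* e :* e :* r :+ e :* e :* r :* r
      in e :* e :* e :* (g :+ r :* (ν :- r) :* y) :- (Q (r :+ :1) :* y′ :- Q :0)
         := :1 :* (e :* e :* e :* g :- (Q r :* y :- Q :0)) :+ (:- Q (r :+ :1)) :* (y′ :- x :* y)) refl
      x ν (nat N) (x^ N) (x^ (suc N)) (G N x x^))

  -- At xⁿ = 1 the boundary terms leave Q(ν) - Q(0) = 2νx(1 - x). So 2νF j is a combination of
  -- powers of qʲ whose coefficients do not depend on j.
  G-F : ∀ j → ¬ n ∣ j → G n (pw j) (λ r → pw (r ℕ.* j)) ≈ (1# + 1#) * ν * F j
  G-F j n∤j = unit-cancel (unit-* (unit-* u u) u)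
    (combine₃ (G-closed n (pw j) (λ r → pw (r ℕ.* j)) pw-0 (λ k → pw-+ j (k ℕ.* j))) (trans (reflexive (≡.cong pw (ℕ.*-comm n j))) (pw-multiple j)) (inverse j n∤j)
    (solve 5 (λ x ν g y i →
      let e = :1 :- x
          Q = λ r → x :* (:1 :+ x :- ν :* e) :+ (:1 :+ :1) :* x :* e :* r :- ν :* e :* e :* r :+ e :* e :* r :* r
      in e :* e :* e :* g :- e :* e :* e :* ((:1 :+ :1) :* ν :* (x :* (i :* i)))
         := :1 :* (e :* e :* e :* g :- (Q ν :* y :- Q :0)) :+ Q ν :* (y :- :1)
            :+ (:- ((:1 :+ :1) :* ν :* x :* e :* (e :* i :+ :1))) :* (e :* i :- :1)) refl
      (pw j) ν (G n (pw j) (λ r → pw (r ℕ.* j))) (pw (n ℕ.* j)) (i j)))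
    where
    u : Unit (1# - pw j)
    u = i j , inverse j n∤j

  F-symmetric : ∀ j k → ¬ n ∣ j → ¬ n ∣ k → j ℕ.+ k ≡ n → F j ≈ F k
  F-symmetric j k hj hk e = combine₃ (inverse j hj) (inverse k hk) (pw-complement j k e)
    (solve 4 (λ x y i i′ →
      let a = :1 :- x ; b = :1 :- y
      in x :* (i :* i) :- y :* (i′ :* i′)
      := (y :* i′ :* i′ :* (a :* i :+ :1)) :* (a :* i :- :1) :+ (:- (x :* i :* i :* (b :* i′ :+ :1))) :* (b :* i′ :- :1)
         :+ (i :* i :* i′ :* i′ :* (y :- x)) :* (x :* y :- :1)) refl (pw j) (pw k) (i j) (i k))

  2m : ℕ
  2m = m ℕ.* 2

  ∑-evens-odds : ∀ r (f : ℕ → Carrier) → ∑ r (λ k → f (suc (k ℕ.* 2)) + f (suc k ℕ.* 2)) ≈ ∑ (r ℕ.* 2) (λ k → f (suc k))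
  ∑-evens-odds zero f = refl
  ∑-evens-odds (suc r) f = trans (+-congʳ (∑-evens-odds r f)) (sym (+-assoc _ _ _))

  ∑-powers : ∀ r → suc r < n → ∑ (m ℕ.* 4) (λ j → pw (suc r ℕ.* suc j)) ≈ - 1#
  ∑-powers r l = unit-cancel {1# - x} (i (suc r) , inverse (suc r) (below-n l))
    (combine₁ (closed (m ℕ.* 4)) (trans (solve 4 (λ x s y z → (:1 :- x) :* s :- (:1 :- x) :* (:- :1)
      := :1 :* ((:1 :- x) :* s :- (x :- y)) :+ (:1 :- y)) refl x _ (pw (suc r ℕ.* n)) 0#)
      (trans (+-congˡ (diff≈0 (sym (pw-multiple (suc r))))) (+-identityʳ _))))
    where
    x = pw (suc r)
    closed : ∀ K → (1# - x) * ∑ K (λ j → pw (suc r ℕ.* suc j)) ≈ x - pw (suc r ℕ.* suc K)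
    closed zero = combine₁ (reflexive (≡.cong pw (ℕ.*-identityʳ (suc r)))) (solve 2 (λ x y → (:1 :- x) :* :0 :- (x :- y) := :1 :* (y :- x)) refl x (pw (suc r ℕ.* 1)))
    closed (suc K) = combine₂ (closed K) (trans (reflexive (≡.cong pw (ℕ.*-suc (suc r) (suc K)))) (pw-+ (suc r) (suc r ℕ.* suc K)))
      (solve 4 (λ x s y z → (:1 :- x) :* (s :+ y) :- (x :- z) := :1 :* ((:1 :- x) :* s :- (x :- y)) :+ :1 :* (z :- x :* y)) refl
        x (∑ K (λ j → pw (suc r ℕ.* suc j))) (pw (suc r ℕ.* suc K)) (pw (suc r ℕ.* suc (suc K))))

  module _ (nat-unit : ∀ k → Unit (nat (suc k))) (c : Carrier)
    (24c : IsSquarePred/24 n c) where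

    weight : ℕ → Carrier
    weight r = nat r * (ν - nat r)

    ∑-weight : ∀ N → (1# + 1#) * (1# + 1# + 1#) * ∑ N weight
      ≈ (1# + 1# + 1#) * ν * nat N * (nat N - 1#) - (nat N - 1#) * nat N * ((1# + 1#) * nat N - 1#)
    ∑-weight zero = solve 1 (λ ν → let two = :1 :+ :1; three = :1 :+ :1 :+ :1; r = :0 in
      two :* three :* :0 := three :* ν :* r :* (r :- :1) :- (r :- :1) :* r :* (two :* r :- :1)) refl ν
    ∑-weight (suc N) = combine₁ (∑-weight N) (solve 3 (λ ν s μ → let two = :1 :+ :1; three = :1 :+ :1 :+ :1; X = λ r → three :* ν :* r :* (r :- :1) :- (r :- :1) :* r :* (two :* r :- :1) in
      two :* three :* (s :+ μ :* (ν :- μ)) :- X (μ :+ :1) := :1 :* (two :* three :* s :- X μ)) refl ν (∑ N weight) (nat N))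

    -- The reflection j ↦ n - j exchanges even and odd residues and preserves F.
    ∑-even : (1# + 1#) * ∑ 2m (λ k → F (suc k ℕ.* 2)) ≈ ∑ (m ℕ.* 4) (λ j → F (suc j))
    ∑-even = begin
      (1# + 1#) * S ≈⟨ solve 1 (λ s → (:1 :+ :1) :* s := s :+ s) refl S ⟩
      S + S ≈⟨ +-congʳ (∑-reverse 2m (λ k → F (k ℕ.* 2))) ⟨
      ∑ 2m (λ k → F ((2m ∸ k) ℕ.* 2)) + S ≈⟨ +-congʳ (∑-cong 2m λ k l → F-symmetric ((2m ∸ k) ℕ.* 2) (suc (k ℕ.* 2)) (even k l) (odd k l) (total-n k (ℕ.<⇒≤ l))) ⟩
      ∑ 2m (λ k → F (suc (k ℕ.* 2))) + S ≈⟨ ∑-+ 2m _ _ ⟨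
      ∑ 2m (λ k → F (suc (k ℕ.* 2)) + F (suc k ℕ.* 2)) ≈⟨ ∑-evens-odds 2m F ⟩
      ∑ (2m ℕ.* 2) (λ j → F (suc j)) ≡⟨ ≡.cong (λ k → ∑ k (λ j → F (suc j))) (ℕ.*-assoc m 2 2) ⟩
      ∑ (m ℕ.* 4) (λ j → F (suc j)) ∎
      where
      S = ∑ 2m (λ k → F (suc k ℕ.* 2))
      total-n : ∀ k → k ≤ 2m → (2m ∸ k) ℕ.* 2 ℕ.+ suc (k ℕ.* 2) ≡ n
      total-n k l = ≡.trans (ℕ.+-suc _ _) (≡.cong suc (≡.trans (≡.sym (ℕ.*-distribʳ-+ 2 (2m ∸ k) k)) (≡.trans (≡.cong (ℕ._* 2) (ℕ.m∸n+n≡m l)) (ℕ.*-assoc m 2 2))))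
      odd : ∀ k → k < 2m → ¬ n ∣ suc (k ℕ.* 2)
      odd k l = below-n (s<s (ℕ.<-≤-trans (ℕ.*-monoˡ-< 2 l) (ℕ.≤-reflexive (ℕ.*-assoc m 2 2))))
      even : ∀ k → k < 2m → ¬ n ∣ (2m ∸ k) ℕ.* 2
      even k l h = odd k l (∣ℕ.∣m+n∣m⇒∣n (≡.subst (n ∣_) (≡.sym (total-n k (ℕ.<⇒≤ l))) ∣ℕ.∣-refl) h)

    -- `G-F` expands each F j in powers of qʲ. After the sums are exchanged each inner sum of powers
    -- is -1, except at r = 0, where the weight is 0.
    ∑-F : (1# + 1#) * ν * ∑ (m ℕ.* 4) (λ j → F (suc j)) ≈ - ∑ n weight
    ∑-F = begin
      (1# + 1#) * ν * ∑ (m ℕ.* 4) (λ j → F (suc j)) ≈⟨ ∑-distribˡ (m ℕ.* 4) _ _ ⟩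
      ∑ (m ℕ.* 4) (λ j → (1# + 1#) * ν * F (suc j)) ≈⟨ ∑-cong (m ℕ.* 4) (λ j l → G-F (suc j) (below-n (s<s l))) ⟨
      ∑ (m ℕ.* 4) (λ j → ∑ n (λ r → weight r * pw (r ℕ.* suc j))) ≈⟨ ∑-swap (m ℕ.* 4) n _ ⟩
      ∑ n (λ r → ∑ (m ℕ.* 4) (λ j → weight r * pw (r ℕ.* suc j))) ≈⟨ ∑-cong n (λ r l → trans (sym (∑-distribˡ (m ℕ.* 4) _ _)) (summand r l)) ⟩
      ∑ n (λ r → - 1# * weight r) ≈⟨ ∑-distribˡ n _ _ ⟨
      - 1# * ∑ n weight ≈⟨ solve 1 (λ s → (:- :1) :* s := :- s) refl _ ⟩
      - ∑ n weight ∎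
      where
      summand : ∀ r → r < n → weight r * ∑ (m ℕ.* 4) (λ j → pw (r ℕ.* suc j)) ≈ - 1# * weight r
      summand zero _ = solve 2 (λ ν s → :0 :* (ν :- :0) :* s := (:- :1) :* (:0 :* (ν :- :0))) refl ν _
      summand (suc r) l = trans (*-congˡ (∑-powers r l)) (*-comm _ _)

    -- The weights sum to ν(ν² - 1)/6, so F sums to -(ν² - 1)/12 over all nonzero residues, and the
    -- even ones contribute half of it.
    ∑-even-value : c + ∑ 2m (λ k → F (suc k ℕ.* 2)) ≈ 0#
    ∑-even-value = unit-cancel (unit-* (unit-* (unit-* (unit-* (unit-* two two) two) three) (nat-unit (m ℕ.* 4))) (1# , *-identityˡ 1#))
      (combine₄ 24c ∑-even ∑-F (∑-weight n)
        (solve 5 (λ ν c s t w → let two = :1 :+ :1; three = :1 :+ :1 :+ :1 in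
          (two :* two :* two :* three :* ν :* :1) :* (c :+ s) :- (two :* two :* two :* three :* ν :* :1) :* :0
          := ν :* (two :* two :* two :* three :* c :- (ν :* ν :- :1)) :+ (two :* two :* three :* ν) :* (two :* s :- t)
             :+ (two :* three) :* (two :* ν :* t :- :- w)
             :+ (:- :1) :* (two :* three :* w :- (three :* ν :* ν :* (ν :- :1) :- (ν :- :1) :* ν :* (two :* ν :- :1)))) refl
          ν c _ _ (∑ n weight)))
      where
      two : Unit (1# + 1#)
      two = unit-resp (+-congʳ (+-identityˡ 1#)) (nat-unit 1)
      three : Unit (1# + 1# + 1#)
      three = unit-resp (+-congʳ (+-congʳ (+-identityˡ 1#))) (nat-unit 2)

    B-value : c + (∑ m (λ j → F (2 ℕ.+ j ℕ.* 4)) + ∑ m (λ j → F (suc j ℕ.* 4))) ≈ 0#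
    B-value = trans (+-congˡ (trans (sym (∑-+ m _ _)) (trans (∑-cong m λ j _ → +-cong (F-cong (≡.cong (2 ℕ.+_) (≡.sym (ℕ.*-assoc j 2 2)))) (F-cong (≡.sym (ℕ.*-assoc (suc j) 2 2))))
      (∑-evens-odds m (λ k → F (k ℕ.* 2)))))) ∑-even-value
      where
      F-cong : ∀ {j k} → j ≡ k → F j ≈ F k
      F-cong e = reflexive (≡.cong F e)

-- The series modulo φ⁴

module Grid {c ℓ} (R : CommutativeRing c ℓ) (z₀ w₀ : CommutativeRing.Carrier R) where
  open CommutativeRing R
  open ℤSolver R
  open Units R

  private
    E = Extension.extension R z₀
    A = Extension.extension E (Extension.ι R z₀ w₀)
    module EH = ExtensionHoms R z₀
    module AH = ExtensionHoms E (Extension.ι R z₀ w₀)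

  grid : CommutativeRing c ℓ
  grid = A

  constant : Hom R A
  constant = AH.ι-hom ∘ʰ EH.ι-hom

  ev₀₀ ev₁₀ ev₀₁ ev₁₁ : Hom A R
  ev₀₀ = EH.at0-hom ∘ʰ AH.at0-hom
  ev₁₀ = EH.ate-hom ∘ʰ AH.at0-hom
  ev₀₁ = EH.at0-hom ∘ʰ AH.ate-hom
  ev₁₁ = EH.ate-hom ∘ʰ AH.ate-hom

  Z W : CommutativeRing.Carrier A
  Z = (0# , 1#) , (0# , 0#)
  W = (0# , 0#) , (1# , 0#)

  grid-unit : ∀ x → Unit (Hom.⟦_⟧ ev₀₀ x) → Unit (Hom.⟦_⟧ ev₁₀ x) → Unit (Hom.⟦_⟧ ev₀₁ x) → Unit (Hom.⟦_⟧ ev₁₁ x) → Units.Unit A x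
  grid-unit x h₀₀ h₁₀ h₀₁ h₁₁ = Extension.unit E _
    (Extension.unit R z₀ {proj₁ (proj₁ x)} {proj₂ (proj₁ x)} h₀₀ h₁₀)
    (Extension.unit R z₀ {Hom.⟦_⟧ ev₀₁ x} {proj₂ (Extension.ate E _ x)} h₀₁ h₁₁)

  constant-₀₀ : ∀ x → Hom.⟦_⟧ ev₀₀ (Hom.⟦_⟧ constant x) ≈ x
  constant-₀₀ x = refl

  constant-₁₀ : ∀ x → Hom.⟦_⟧ ev₁₀ (Hom.⟦_⟧ constant x) ≈ x
  constant-₁₀ x = solve 2 (λ z x → x :+ z :* :0 := x) refl z₀ x

  constant-₀₁ : ∀ x → Hom.⟦_⟧ ev₀₁ (Hom.⟦_⟧ constant x) ≈ x
  constant-₀₁ x = solve 2 (λ w x → x :+ w :* :0 := x) refl w₀ x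

  constant-₁₁ : ∀ x → Hom.⟦_⟧ ev₁₁ (Hom.⟦_⟧ constant x) ≈ x
  constant-₁₁ x = solve 3 (λ w z x → (x :+ w :* :0) :+ z :* (:0 :+ (w :* :0 :+ :0 :* :0 :+ z :* :0 :* :0)) := x) refl w₀ z₀ x

  Z-₁₀ : Hom.⟦_⟧ ev₁₀ Z ≈ z₀
  Z-₁₀ = solve 1 (λ z → :0 :+ z :* :1 := z) refl z₀
  Z-₀₁ : Hom.⟦_⟧ ev₀₁ Z ≈ 0#
  Z-₀₁ = solve 1 (λ w → :0 :+ w :* :0 := :0) refl w₀
  Z-₁₁ : Hom.⟦_⟧ ev₁₁ Z ≈ z₀
  Z-₁₁ = solve 2 (λ w z → (:0 :+ w :* :0) :+ z :* (:1 :+ (w :* :0 :+ :0 :* :0 :+ z :* :0 :* :0)) := z) refl w₀ z₀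
  W-₁₀ : Hom.⟦_⟧ ev₁₀ W ≈ 0#
  W-₁₀ = solve 1 (λ z → :0 :+ z :* :0 := :0) refl z₀
  W-₀₁ : Hom.⟦_⟧ ev₀₁ W ≈ w₀
  W-₀₁ = solve 1 (λ w → :0 :+ w :* :1 := w) refl w₀
  W-₁₁ : Hom.⟦_⟧ ev₁₁ W ≈ w₀
  W-₁₁ = solve 2 (λ w z → (:0 :+ w :* :1) :+ z :* (:0 :+ (w :* :0 :+ :0 :* :1 :+ z :* :0 :* :0)) := w) refl w₀ z₀

  -- The alternating sum of the four values of any element is z₀w₀ times its zw-coefficient, and
  -- this coefficient of S is φ c₃.
  second-difference : ∀ φ → φ * z₀ * w₀ ≈ 0# → ∀ S c → CommutativeRing._≈_ A S (CommutativeRing._*_ A (Hom.⟦_⟧ constant φ) c) →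
    Hom.⟦_⟧ ev₀₀ S ≈ Hom.⟦_⟧ ev₁₀ S + Hom.⟦_⟧ ev₀₁ S - Hom.⟦_⟧ ev₁₁ S
  second-difference φ h ((s , s₁) , (s₂ , s₃)) ((c , c₁) , (c₂ , c₃)) (_ , (_ , e)) = combine₂ h e
    (solve 11 (λ φ z w s s₁ s₂ s₃ c c₁ c₂ c₃ → s :- (((s :+ z :* s₁) :+ (s :+ w :* s₂))
         :- ((s :+ w :* s₂) :+ z :* (s₁ :+ (w :* s₃ :+ :0 :* s₂ :+ z :* :0 :* s₃))))
       := c₃ :* (φ :* z :* w :- :0) :+ (z :* w) :* (s₃ :-
          (φ :* c₃ :+ :0 :* c₂ :+ z :* :0 :* c₃ :+ (:0 :* c₁ :+ :0 :* c :+ z :* :0 :* c₁)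
           :+ ((w :* :0) :* c₃ :+ (w :* :0 :+ :0 :* :0 :+ z :* :0 :* :0) :* c₂
             :+ z :* (w :* :0 :+ :0 :* :0 :+ z :* :0 :* :0) :* c₃))))
      refl φ z₀ w₀ s s₁ s₂ s₃ c c₁ c₂ c₃)

-- The ring R[z,w]/(z² - z₀z, w² - w₀w), with its evaluations at z = 0, z₀ and w = 0, w₀.
record Square {c ℓ} (R : CommutativeRing c ℓ) (z₀ w₀ : CommutativeRing.Carrier R) : Set (Level.suc (c ⊔ ℓ)) where
  open CommutativeRing R
  open Units R
  open Hom
  field
    ring² : CommutativeRing c ℓ
    constant : Hom R ring²
    ev₀₀ ev₁₀ ev₀₁ ev₁₁ : Hom ring² R
    Z W : CommutativeRing.Carrier ring²
    unit² : ∀ x → Unit (⟦ ev₀₀ ⟧ x) → Unit (⟦ ev₁₀ ⟧ x) → Unit (⟦ ev₀₁ ⟧ x) → Unit (⟦ ev₁₁ ⟧ x) → Units.Unit ring² x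
    constant-₀₀ : ∀ x → ⟦ ev₀₀ ⟧ (⟦ constant ⟧ x) ≈ x
    constant-₁₀ : ∀ x → ⟦ ev₁₀ ⟧ (⟦ constant ⟧ x) ≈ x
    constant-₀₁ : ∀ x → ⟦ ev₀₁ ⟧ (⟦ constant ⟧ x) ≈ x
    constant-₁₁ : ∀ x → ⟦ ev₁₁ ⟧ (⟦ constant ⟧ x) ≈ x
    Z-₀₀ : ⟦ ev₀₀ ⟧ Z ≈ 0#
    Z-₁₀ : ⟦ ev₁₀ ⟧ Z ≈ z₀
    Z-₀₁ : ⟦ ev₀₁ ⟧ Z ≈ 0#
    Z-₁₁ : ⟦ ev₁₁ ⟧ Z ≈ z₀
    W-₀₀ : ⟦ ev₀₀ ⟧ W ≈ 0#
    W-₁₀ : ⟦ ev₁₀ ⟧ W ≈ 0#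
    W-₀₁ : ⟦ ev₀₁ ⟧ W ≈ w₀
    W-₁₁ : ⟦ ev₁₁ ⟧ W ≈ w₀
    second-difference : ∀ φ → φ * z₀ * w₀ ≈ 0# → ∀ S c →
      CommutativeRing._≈_ ring² S (CommutativeRing._*_ ring² (⟦ constant ⟧ φ) c) →
      ⟦ ev₀₀ ⟧ S ≈ ⟦ ev₁₀ ⟧ S + ⟦ ev₀₁ ⟧ S - ⟦ ev₁₁ ⟧ S

square : ∀ {c ℓ} (R : CommutativeRing c ℓ) z₀ w₀ → Square R z₀ w₀
square R z₀ w₀ = record
  { ring² = grid ; constant = constant ; ev₀₀ = ev₀₀ ; ev₁₀ = ev₁₀ ; ev₀₁ = ev₀₁ ; ev₁₁ = ev₁₁ ; Z = Z ; W = W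
  ; unit² = grid-unit
  ; constant-₀₀ = constant-₀₀ ; constant-₁₀ = constant-₁₀ ; constant-₀₁ = constant-₀₁ ; constant-₁₁ = constant-₁₁
  ; Z-₀₀ = refl ; Z-₁₀ = Z-₁₀ ; Z-₀₁ = Z-₀₁ ; Z-₁₁ = Z-₁₁ ; W-₀₀ = refl ; W-₁₀ = W-₁₀ ; W-₀₁ = W-₀₁ ; W-₁₁ = W-₁₁
  ; second-difference = second-difference }
  where
  open CommutativeRing R
  open Grid R z₀ w₀

-- With n = 4m + 1, ni = 2m(2i) + i.
odd-∣ : ∀ m {i} → suc (m ℕ.* 4) ∣ 2 ℕ.* i → suc (m ℕ.* 4) ∣ i
odd-∣ m {i} h = ∣ℕ.∣m+n∣m⇒∣n (≡.subst (suc (m ℕ.* 4) ∣_) eq (∣ℕ.m∣m*n i)) (∣ℕ.∣n⇒∣m*n (2 ℕ.* m) h)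
  where
  open Data.Nat.Solver.+-*-Solver
  eq : suc (m ℕ.* 4) ℕ.* i ≡ (2 ℕ.* m) ℕ.* (2 ℕ.* i) ℕ.+ i
  eq = solve 2 (λ m i → (con 1 :+ m :* con 4) :* i := (con 2 :* m) :* (con 2 :* i) :+ i) ≡.refl m i

-- The properties of ℚ[q]/(Φₙ⁴), n = 4m + 1, on which the argument rests: φ is Φₙ, and g is the
-- cofactor in 1 - qⁿ = φg. All denominators are reduced to the units 1 - qʲ with n not dividing j.
record Modulus {c ℓ} (R : CommutativeRing c ℓ) : Set (c ⊔ ℓ) where
  open CommutativeRing R
  open Units R using (Unit)
  open Exp semiring using (_^_)
  field
    m : ℕ
    1≤m : 1 ≤ m
  n : ℕ
  n = suc (m ℕ.* 4)
  field
    q π φ g : Carrier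
    qπ : q * π ≈ 1#
    φ⁴ : φ * φ * φ * φ ≈ 0#
    φ-eq : 1# - q ^ n ≈ φ * g
    units : ∀ j → ¬ n ∣ j → Unit (1# - q ^ j)

module Differences {c ℓ} (R : CommutativeRing c ℓ) (M : Modulus R) where
  open CommutativeRing R
  open Modulus M
  open ℤSolver R
  open Units R
  open import Algebra.Properties.Semiring.Exp semiring using (_^_; ^-homo-*)
  open import Relation.Binary.Reasoning.Setoid setoid

  N : ℕ
  N = m ℕ.* 2

  p z₀ w₀ : Carrier
  p = q * q
  w₀ = q ^ n - 1#
  z₀ = w₀ * w₀ * π ^ n

  -- The parameters of the series with s = q (x + 1/x), where z = x + 1/x - 2, and b = q / y.
  σ : Carrier → Carrier
  σ z = q * (1# + 1# + z)

  open Quadratic R p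

  p^ : ∀ k → p ^ k ≈ q ^ k * q ^ k
  p^ zero = sym (*-identityˡ 1#)
  p^ (suc k) = combine₁ (p^ k) (solve 3 (λ q P Q → q :* q :* P :- (q :* Q) :* (q :* Q) := (q :* q) :* (P :- Q :* Q)) refl q (p ^ k) (q ^ k))

  p^-double : ∀ k → p ^ k ≈ q ^ (2 ℕ.* k)
  p^-double k = trans (p^ k) (sym (trans (reflexive (≡.cong (q ^_) (≡.cong (k ℕ.+_) (ℕ.+-identityʳ k)))) (^-homo-* q k k)))

  below-n : ∀ {i} → suc i < n → ¬ n ∣ suc i
  below-n l h = ℕ.<⇒≱ l (∣ℕ.∣⇒≤ h)

  unit₂ : ∀ i → suc i < n → Unit (1# - q * q * p ^ i)
  unit₂ i l = unit-resp (+-congˡ (-‿cong (sym (p^-double (suc i))))) (units (2 ℕ.* suc i) λ h → below-n l (odd-∣ m h))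

  unit₄ : ∀ i → suc i < n → Unit (1# - p * p * p ^ i * p ^ i)
  unit₄ i l = unit-resp (+-congˡ (-‿cong eq)) (units (2 ℕ.* (2 ℕ.* suc i)) λ h → below-n l (odd-∣ m (odd-∣ m h)))
    where
    eq : q ^ (2 ℕ.* (2 ℕ.* suc i)) ≈ p * p * p ^ i * p ^ i
    eq = trans (sym (p^-double (2 ℕ.* suc i))) (trans (reflexive (≡.cong (p ^_) (≡.cong (suc i ℕ.+_) (ℕ.+-identityʳ (suc i)))))
      (trans (^-homo-* p (suc i) (suc i)) (solve 2 (λ p P → (p :* P) :* (p :* P) := p :* p :* P :* P) refl p (p ^ i))))

  z₀² : z₀ * z₀ ≈ 0#
  z₀² = combine₂ φ⁴ φ-eq (solve 4 (λ φ g X I →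
      (let w = X :- :1 in w :* w :* I :* (w :* w :* I)) :- :0
      := (g :* g :* g :* g :* I :* I) :* (φ :* φ :* φ :* φ :- :0)
         :+ (I :* I :* ((:1 :- X) :+ φ :* g) :* ((:1 :- X) :* (:1 :- X) :+ φ :* g :* φ :* g)) :* ((:1 :- X) :- φ :* g)) refl φ g (q ^ n) (π ^ n))

  φzw : φ * z₀ * w₀ ≈ 0#
  φzw = combine₂ φ⁴ φ-eq (solve 4 (λ φ g X I →
      (let w = X :- :1 in φ :* (w :* w :* I) :* w) :- :0
      := (:- (g :* g :* g :* I)) :* (φ :* φ :* φ :* φ :- :0)
         :+ (:- (φ :* I :* ((:1 :- X) :* (:1 :- X) :+ (:1 :- X) :* φ :* g :+ φ :* g :* φ :* g))) :* ((:1 :- X) :- φ :* g)) refl φ g (q ^ n) (π ^ n))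

  -- As z₀² = 0, the geometric series for the inverse stops after its second term.
  unit-z : ∀ {α β} → Unit α → Unit (α * α - β * z₀)
  unit-z {α} {β} (i , h) = i * i * (1# + β * z₀ * i * i) , combine₂ h z₀²
    (solve 4 (λ α β z i → (α :* α :- β :* z) :* (i :* i :* (:1 :+ β :* z :* i :* i)) :- :1
      := ((α :* i :+ :1) :+ β :* z :* i :* i :* (α :* i :+ :1)) :* (α :* i :- :1) :+ (:- (β :* β :* i :* i :* i :* i)) :* (z :* z :- :0)) refl α β z₀ i)

module FactorHoms {c ℓ c′ ℓ′} {R : CommutativeRing c ℓ} {S : CommutativeRing c′ ℓ′} (f : Hom R S)
  {p p′} (hp : CommutativeRing._≈_ S (Hom.⟦_⟧ f p) p′) {a a′} (ha : CommutativeRing._≈_ S (Hom.⟦_⟧ f a) a′) where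
  private
    module R = CommutativeRing R
    module S = CommutativeRing S
  open Hom f
  open HomProperties f

  sq-hom : ∀ {s s′ x x′} → ⟦ s ⟧ S.≈ s′ → ⟦ x ⟧ S.≈ x′ → ⟦ QuadraticZero.sq R p a s x ⟧ S.≈ QuadraticZero.sq S p′ a′ s′ x′
  sq-hom hs hx = +-hom′ (1-sub-hom (*-hom′ (*-hom′ (*-hom′ ha hx) hp) hs))
    (*-hom′ (*-hom′ (*-hom′ (*-hom′ (*-hom′ (*-hom′ ha hx) ha) hx) hp) hp) hp)

  linear-hom : ∀ {β β′ P P′} → ⟦ β ⟧ S.≈ β′ → ⟦ P ⟧ S.≈ P′ →
    ⟦ R.1# R.- a R.* p R.* β R.* P ⟧ S.≈ S.1# S.- a′ S.* p′ S.* β′ S.* P′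
  linear-hom hβ hP = 1-sub-hom (*-hom′ (*-hom′ (*-hom′ ha hp) hβ) hP)

module DenUnit {c ℓ} (R : CommutativeRing c ℓ) (p : CommutativeRing.Carrier R) where
  open CommutativeRing R
  open Units R
  open ℤSolver R

  den-unit : ∀ {a s β P} → Unit (1# - p * p * P * P) → Unit (QuadraticZero.sq R p a s (P * P)) →
    Unit (1# - a * p * β * P) → Unit (Quadratic.den R p a s β P)
  den-unit {a} {s} {β} {P} h₁ h₂ h₃ = unit-* (unit-* h₁ (unit-resp (solve 4 (λ a s p P → let x = P :* P in
       :1 :- a :* x :* p :* s :+ a :* x :* a :* x :* p :* p :* p
       := :1 :- a :* p :* s :* P :* P :+ a :* a :* p :* p :* p :* P :* P :* P :* P)
       refl a s p P) h₂)) h₃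

-- The perturbed series over the ring of divided differences

module Vanishing {c ℓ} (R : CommutativeRing c ℓ) (M : Modulus R) (G : Square R (Differences.z₀ R M) (Differences.w₀ R M)) where
  open CommutativeRing R
  open Modulus M
  open ℤSolver R
  open Units R
  open Exp semiring using (_^_; ^-homo-*)
  open Differences R M
  open Quadratic R p
  open QuadraticZero R p using (sq)
  open Square G

  N+N<n : N ℕ.+ N < n
  N+N<n = s≤s (ℕ.≤-reflexive (solveℕ 1 (λ m → m :*ℕ conℕ 2 :+ℕ m :*ℕ conℕ 2 :=ℕ m :*ℕ conℕ 4) ≡.refl m))
    where open Data.Nat.Solver.+-*-Solver renaming (solve to solveℕ; _:+_ to _:+ℕ_; _:*_ to _:*ℕ_; _:=_ to _:=ℕ_; con to conℕ)

  N<n : N < n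
  N<n = ℕ.≤-<-trans (ℕ.m≤m+n N N) N+N<n

  1≤N : 1 ≤ N
  1≤N = ℕ.*-mono-≤ 1≤m (z<s {1})

  suc-N<n : suc N < n
  suc-N<n = ℕ.≤-<-trans (ℕ.+-monoˡ-≤ N 1≤N) N+N<n

  -- The quadratic factor is (1 - p²P²)² - p²P²z, the square of a unit perturbed by a multiple of z.
  sq-unit : ∀ {z} i → suc i < n → (z ≈ 0#) ⊎ (z ≈ z₀) → Unit (sq q (σ z) (p ^ i * p ^ i))
  sq-unit {z} i l h = unit-resp (eq z) (by h)
    where
    P = p ^ i
    α = 1# - p * p * P * P
    eq : ∀ z → α * α - (p * p * P * P) * z ≈ sq q (σ z) (P * P)
    eq z = solve 3 (λ q P z → let p = q :* q; α = :1 :- p :* p :* P :* P; s = q :* (:1 :+ :1 :+ z); x = P :* P in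
      α :* α :- p :* p :* P :* P :* z := :1 :- q :* x :* p :* s :+ q :* x :* q :* x :* p :* p :* p) refl q P z
    by : (z ≈ 0#) ⊎ (z ≈ z₀) → Unit (α * α - (p * p * P * P) * z)
    by (inj₂ e) = unit-resp (+-congˡ (-‿cong (*-congˡ (sym e)))) (unit-z (unit₄ i l))
    by (inj₁ e) = unit-resp (trans (solve 2 (λ α γ → α :* α := α :* α :- γ :* :0) refl α (p * p * P * P)) (+-congˡ (-‿cong (*-congˡ (sym e)))))
      (unit-* (unit₄ i l) (unit₄ i l))

  -- As qπ = 1, the factor is 1 - q²P(1 + w), that is 1 - q^(2i+2) at w = 0 and 1 - q^(n+2i+2) at w
  -- = w₀. Since n is odd, it divides neither exponent.
  linear-unit : ∀ {w} i → suc i < n → (w ≈ 0#) ⊎ (w ≈ w₀) → Unit (1# - q * p * ((1# + w) * π) * p ^ i)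
  linear-unit {w} i l (inj₁ e) = unit-resp
    (combine₂ qπ e (solve 4 (λ q π w P → (:1 :- q :* q :* P) :- (:1 :- q :* (q :* q) :* ((:1 :+ w) :* π) :* P)
      := (q :* q :* P :* (:1 :+ w)) :* (q :* π :- :1) :+ (q :* q :* P) :* (w :- :0)) refl q π w (p ^ i)))
    (unit₂ i l)
  linear-unit {w} i l (inj₂ e) = unit-resp
    (combine₃ qπ e (trans (^-homo-* q n (2 ℕ.* suc i)) (*-congˡ (sym (p^-double (suc i)))))
      (solve 6 (λ q π w P X Y → (:1 :- Y) :- (:1 :- q :* (q :* q) :* ((:1 :+ w) :* π) :* P)
      := (q :* q :* P :* (:1 :+ w)) :* (q :* π :- :1) :+ (q :* q :* P) :* (w :- (X :- :1)) :+ (:- :1) :* (Y :- X :* (q :* q :* P))) refl q π w (p ^ i) (q ^ n) (q ^ (n ℕ.+ 2 ℕ.* suc i))))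
    (units (n ℕ.+ 2 ℕ.* suc i) λ h → below-n l (odd-∣ m (∣ℕ.∣m+n∣m⇒∣n h ∣ℕ.∣-refl)))

  private
    A = ring²
    module A = CommutativeRing A
    module UA = Units A
    module EA = Exp A.semiring
    module QA = Quadratic A

  ⟪_⟫ : Carrier → A.Carrier
  ⟪ x ⟫ = Hom.⟦_⟧ constant x

  qᴬ pᴬ sᴬ βᴬ : A.Carrier
  qᴬ = ⟪ q ⟫
  pᴬ = qᴬ A.* qᴬ
  sᴬ = qᴬ A.* (A.1# A.+ A.1# A.+ Z)
  βᴬ = (A.1# A.+ W) A.* ⟪ π ⟫

  -- Treats the four corners z = 0, z₀ and w = 0, w₀ alike: whether a factor is a unit in the
  -- extended ring is decided by its values there.
  record Evaluation (ev : Hom A R) : Set (c ⊔ ℓ) where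
    open Hom ev
    field
      z w : Carrier
      z-value : (z ≈ 0#) ⊎ (z ≈ z₀)
      w-value : (w ≈ 0#) ⊎ (w ≈ w₀)
      ev-constant : ∀ x → ⟦ ⟪ x ⟫ ⟧ ≈ x
      ev-Z : ⟦ Z ⟧ ≈ z
      ev-W : ⟦ W ⟧ ≈ w
    open HomProperties ev
    open FactorHoms ev {pᴬ} {p} (*-hom′ (ev-constant q) (ev-constant q)) {qᴬ} (ev-constant q)

    ev-p : ⟦ pᴬ ⟧ ≈ p
    ev-p = *-hom′ (ev-constant q) (ev-constant q)
    ev-s : ⟦ sᴬ ⟧ ≈ σ z
    ev-s = *-hom′ (ev-constant q) (+-hom′ (+-hom′ 1-hom 1-hom) ev-Z)
    ev-β : ⟦ βᴬ ⟧ ≈ (1# + w) * π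
    ev-β = *-hom′ (+-hom′ 1-hom ev-W) (ev-constant π)
    ev-P : ∀ k → ⟦ pᴬ EA.^ k ⟧ ≈ p ^ k
    ev-P k = pow-hom ev-p (ev-constant q) ev-s ev-β k

    ev-sq : ∀ i → suc i < n → Unit ⟦ QuadraticZero.sq A pᴬ qᴬ sᴬ (pᴬ EA.^ i A.* pᴬ EA.^ i) ⟧
    ev-sq i l = unit-resp (sym (sq-hom ev-s (*-hom′ (ev-P i) (ev-P i)))) (sq-unit i l z-value)

    ev-linear : ∀ i → suc i < n → Unit ⟦ A.1# A.- qᴬ A.* pᴬ A.* βᴬ A.* pᴬ EA.^ i ⟧
    ev-linear i l = unit-resp (sym (linear-hom ev-β (ev-P i))) (linear-unit i l w-value)

    ev-square : ∀ i → suc i < n → Unit ⟦ A.1# A.- pᴬ A.* pᴬ A.* pᴬ EA.^ i A.* pᴬ EA.^ i ⟧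
    ev-square i l = unit-resp (sym (1-sub-hom (*-hom′ (*-hom′ (*-hom′ ev-p ev-p) (ev-P i)) (ev-P i)))) (unit₄ i l)

    ev-Term : ∀ {K t} → QA.Term pᴬ qᴬ sᴬ βᴬ K t → Term q (σ z) ((1# + w) * π) K (λ k → ⟦ t k ⟧)
    ev-Term = Term-hom ev-p (ev-constant q) ev-s ev-β

    ev-total : ∀ K t → ⟦ QA.total pᴬ qᴬ K t ⟧ ≈ total q K (λ k → ⟦ t k ⟧)
    ev-total = total-hom ev-p (ev-constant q) ev-s ev-β

  evaluation₀₀ : Evaluation ev₀₀
  evaluation₀₀ = record { z = 0# ; w = 0# ; z-value = inj₁ refl ; w-value = inj₁ refl ; ev-constant = constant-₀₀ ; ev-Z = Z-₀₀ ; ev-W = W-₀₀ }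
  evaluation₁₀ : Evaluation ev₁₀
  evaluation₁₀ = record { z = z₀ ; w = 0# ; z-value = inj₂ refl ; w-value = inj₁ refl ; ev-constant = constant-₁₀ ; ev-Z = Z-₁₀ ; ev-W = W-₁₀ }
  evaluation₀₁ : Evaluation ev₀₁
  evaluation₀₁ = record { z = 0# ; w = w₀ ; z-value = inj₁ refl ; w-value = inj₂ refl ; ev-constant = constant-₀₁ ; ev-Z = Z-₀₁ ; ev-W = W-₀₁ }
  evaluation₁₁ : Evaluation ev₁₁
  evaluation₁₁ = record { z = z₀ ; w = w₀ ; z-value = inj₂ refl ; w-value = inj₂ refl ; ev-constant = constant-₁₁ ; ev-Z = Z-₁₁ ; ev-W = W-₁₁ }

  open Evaluation

  sqᴬ-unit : ∀ i → suc i < n → UA.Unit (QuadraticZero.sq A pᴬ qᴬ sᴬ (pᴬ EA.^ i A.* pᴬ EA.^ i))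
  sqᴬ-unit i l = unit² _ (ev-sq evaluation₀₀ i l) (ev-sq evaluation₁₀ i l) (ev-sq evaluation₀₁ i l) (ev-sq evaluation₁₁ i l)

  linearᴬ-unit : ∀ i → suc i < n → UA.Unit (A.1# A.- qᴬ A.* pᴬ A.* βᴬ A.* pᴬ EA.^ i)
  linearᴬ-unit i l = unit² _ (ev-linear evaluation₀₀ i l) (ev-linear evaluation₁₀ i l) (ev-linear evaluation₀₁ i l) (ev-linear evaluation₁₁ i l)

  squareᴬ-unit : ∀ i → suc i < n → UA.Unit (A.1# A.- pᴬ A.* pᴬ A.* pᴬ EA.^ i A.* pᴬ EA.^ i)
  squareᴬ-unit i l = unit² _ (ev-square evaluation₀₀ i l) (ev-square evaluation₁₀ i l) (ev-square evaluation₀₁ i l) (ev-square evaluation₁₁ i l)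

  denᴬ-unit : ∀ i → suc i < n → UA.Unit (QA.den pᴬ qᴬ sᴬ βᴬ (pᴬ EA.^ i))
  denᴬ-unit i l = DenUnit.den-unit A pᴬ (squareᴬ-unit i l) (sqᴬ-unit i l) (linearᴬ-unit i l)

  private
    invᴬ : UA.Invertible N (λ k → QA.den pᴬ qᴬ sᴬ βᴬ (pᴬ EA.^ k))
    invᴬ = UA.invertible N λ k l → denᴬ-unit k (ℕ.≤-<-trans l N<n)

  termᴬ : ℕ → A.Carrier
  termᴬ zero = A.1#
  termᴬ (suc k) = termᴬ k A.* QA.num pᴬ qᴬ sᴬ βᴬ (pᴬ EA.^ k) A.* proj₁ invᴬ k

  termᴬ-Term : QA.Term pᴬ qᴬ sᴬ βᴬ N termᴬ
  termᴬ-Term k l = UA.combine₁ (proj₂ invᴬ k l) (SA.solve 4 (λ t ν i d → t SA.:* ν SA.:* i SA.:* d SA.:- t SA.:* ν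
      SA.:= (t SA.:* ν) SA.:* (d SA.:* i SA.:- SA.:1)) A.refl _ _ _ _)
    where module SA = ℤSolver A

  private
    φᴬ = ⟪ φ ⟫
    X = Quotient.quotient A φᴬ
    module X = CommutativeRing X
    module EX = Exp X.semiring
    κ : Hom A X
    κ = quotient-hom A φᴬ
    module KP = HomProperties {R = A} {S = X} κ
    module KF = FactorHoms {R = A} {S = X} κ {pᴬ} {pᴬ} X.refl {qᴬ} {qᴬ} X.refl

    κ-P : ∀ k → pᴬ EA.^ k X.≈ pᴬ EX.^ k
    κ-P k = KP.pow-hom X.refl {qᴬ} {qᴬ} {sᴬ} {sᴬ} {βᴬ} {βᴬ} X.refl X.refl X.refl k

    q-pᴺ : q * p ^ N ≈ q ^ n
    q-pᴺ = *-congˡ (trans (p^-double N) (reflexive (≡.cong (q ^_) (eq m))))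
      where
      open Data.Nat.Solver.+-*-Solver renaming (solve to solveℕ; _:*_ to _:*ℕ_; _:=_ to _:=ℕ_; con to conℕ)
      eq : ∀ m → 2 ℕ.* (m ℕ.* 2) ≡ m ℕ.* 4
      eq = solveℕ 1 (λ m → conℕ 2 :*ℕ (m :*ℕ conℕ 2) :=ℕ m :*ℕ conℕ 4) ≡.refl

    module C = HomProperties constant

    -- q pᴺ = q^(4m+1) = qⁿ is 1 modulo φ; this is how a = q counts as q^(1-n).
    aN : qᴬ X.* pᴬ EX.^ N X.≈ X.1#
    aN = X.trans (X.*-congˡ (X.sym (κ-P N))) (X.trans (Quotient.≈⇒≋ A φᴬ q-pᴺ-A) (X.sym qⁿ≋1))
      where
      q-pᴺ-A : qᴬ A.* pᴬ EA.^ N A.≈ ⟪ q ^ n ⟫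
      q-pᴺ-A = A.trans (A.sym (C.*-hom′ A.refl (C.pow-hom (Hom.*-hom constant q q) {q} {qᴬ} {q} {qᴬ} {q} {qᴬ} A.refl A.refl A.refl N)))
        (Hom.cong constant q-pᴺ)
      qⁿ≋1 : X.1# X.≈ ⟪ q ^ n ⟫
      qⁿ≋1 = Quotient.multiple ⟪ g ⟫ (A.trans (A.sym (C.1-sub-hom A.refl)) (A.trans (Hom.cong constant φ-eq) (Hom.*-hom constant φ g)))

  private
    sq-unitˣ : ∀ i → i < suc N → Units.Unit X (QuadraticZero.sq X pᴬ qᴬ sᴬ (pᴬ EX.^ i X.* pᴬ EX.^ i))
    sq-unitˣ i l = Units.unit-resp X {QuadraticZero.sq A pᴬ qᴬ sᴬ (pᴬ EA.^ i A.* pᴬ EA.^ i)} (KF.sq-hom {sᴬ} {sᴬ} X.refl (X.*-cong (κ-P i) (κ-P i)))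
      (KP.unit-hom (sqᴬ-unit i (ℕ.≤-<-trans l suc-N<n)))

    linear-unitˣ : ∀ i → i < N ℕ.+ N → Units.Unit X (X.1# X.- qᴬ X.* pᴬ X.* βᴬ X.* pᴬ EX.^ i)
    linear-unitˣ i l = Units.unit-resp X {A.1# A.- qᴬ A.* pᴬ A.* βᴬ A.* pᴬ EA.^ i} (KF.linear-hom {βᴬ} {βᴬ} X.refl (κ-P i))
      (KP.unit-hom (linearᴬ-unit i (ℕ.≤-<-trans l N+N<n)))

    termˣ-Term : Quadratic.Term X pᴬ qᴬ sᴬ βᴬ N termᴬ
    termˣ-Term = KP.Term-hom X.refl {qᴬ} {qᴬ} {sᴬ} {sᴬ} {βᴬ} {βᴬ} X.refl X.refl X.refl termᴬ-Term

    vanishingˣ : Quadratic.total X pᴬ qᴬ (suc N) termᴬ X.≈ X.0#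
    vanishingˣ = QuadraticZero.total-zero X pᴬ N qᴬ sᴬ βᴬ aN
      (Units.invertible X (suc N) sq-unitˣ) (Units.invertible X (N ℕ.+ N) linear-unitˣ) termᴬ termˣ-Term

    totalᴬ totalˣ : A.Carrier
    totalᴬ = QA.total pᴬ qᴬ (suc N) termᴬ
    totalˣ = Quadratic.total X pᴬ qᴬ (suc N) termᴬ

    κ-total : ∀ K t → QA.total pᴬ qᴬ K t X.≈ Quadratic.total X pᴬ qᴬ K t
    κ-total = KP.total-hom {pᴬ} {pᴬ} X.refl {qᴬ} {qᴬ} {sᴬ} {sᴬ} {βᴬ} {βᴬ} X.refl X.refl X.refl

    vanishing : totalᴬ X.≈ X.0#
    vanishing = X.trans {totalᴬ} {totalˣ} {X.0#} (κ-total (suc N) termᴬ) vanishingˣ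

  t₀₀ t₁₀ t₀₁ t₁₁ : ℕ → Carrier
  t₀₀ k = Hom.⟦_⟧ ev₀₀ (termᴬ k)
  t₁₀ k = Hom.⟦_⟧ ev₁₀ (termᴬ k)
  t₀₁ k = Hom.⟦_⟧ ev₀₁ (termᴬ k)
  t₁₁ k = Hom.⟦_⟧ ev₁₁ (termᴬ k)

  -- The factor φ supplied by `vanishing` meets z₀w₀, and φz₀w₀ is a multiple of φ⁴.
  difference : total q (suc N) t₀₀ ≈ total q (suc N) t₁₀ + total q (suc N) t₀₁ - total q (suc N) t₁₁
  difference = trans (sym (ev-total evaluation₀₀ (suc N) termᴬ))
    (trans (second-difference φ φzw (QA.total pᴬ qᴬ (suc N) termᴬ) (Quotient.factor vanishing)
      (A.trans (SA.solve 1 (λ x → x SA.:= x SA.:- SA.:0) A.refl (QA.total pᴬ qᴬ (suc N) termᴬ)) (Quotient.equation vanishing)))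
    (+-cong (+-cong (ev-total evaluation₁₀ (suc N) termᴬ) (ev-total evaluation₀₁ (suc N) termᴬ)) (-‿cong (ev-total evaluation₁₁ (suc N) termᴬ))))
    where module SA = ℤSolver A

id-hom : ∀ {c ℓ} (R : CommutativeRing c ℓ) → Hom R R
id-hom R = record { ⟦_⟧ = λ x → x ; cong = λ e → e ; +-hom = λ _ _ → refl ; *-hom = λ _ _ → refl ; neg-hom = λ _ → refl ; 0-hom = refl ; 1-hom = refl }
  where open CommutativeRing R

module SumHoms {c ℓ c′ ℓ′} {R : CommutativeRing c ℓ} {S : CommutativeRing c′ ℓ′} (f : Hom R S) where
  private
    module R = CommutativeRing R
    module S = CommutativeSemiring (CommutativeRing.commutativeSemiring S)
  open Hom f

  ∑-hom : ∀ n g → ⟦ Sums.∑ R n g ⟧ S.≈ Sums.∑ S n (λ i → ⟦ g i ⟧)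
  ∑-hom zero g = 0-hom
  ∑-hom (suc n) g = S.trans (+-hom _ _) (S.+-congʳ (∑-hom n g))

  ∏-hom : ∀ n g → ⟦ Sums.∏ R n g ⟧ S.≈ Sums.∏ S n (λ i → ⟦ g i ⟧)
  ∏-hom zero g = 1-hom
  ∏-hom (suc n) g = S.trans (*-hom _ _) (S.*-congʳ (∏-hom n g))

  nat-hom : ∀ n → ⟦ MoreSums.nat R n ⟧ S.≈ MoreSums.nat S n
  nat-hom zero = 0-hom
  nat-hom (suc n) = S.trans (+-hom _ _) (S.+-cong (nat-hom n) 1-hom)

-- The closed forms at three corners and their combination

module Closed {c ℓ} (R : CommutativeRing c ℓ) (M : Modulus R) where
  open CommutativeRing R
  open Modulus M
  open ℤSolver R
  open Units R
  open Sums R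
  open MoreSums R
  open Exp semiring using (_^_; ^-homo-*)
  open Differences R M
  open Quadratic R p
  open QuadraticZero R p using (sq)
  open Terminating R p
  open import Relation.Binary.Reasoning.Setoid setoid

  O₁ O₃ O₅ H D : ℕ → Carrier
  O₁ j = 1# - q ^ suc (j ℕ.* 4)
  O₃ j = 1# - q ^ (3 ℕ.+ j ℕ.* 4)
  O₅ j = 1# - q ^ (5 ℕ.+ j ℕ.* 4)
  H j = 1# - q ^ (2 ℕ.+ j ℕ.* 4)
  D j = 1# - q ^ (suc j ℕ.* 4)

  q-unit : Unit q
  q-unit = π , qπ

  p-unit : Unit p
  p-unit = unit-* q-unit q-unit

  ^-unit : ∀ {x} k → Unit x → Unit (x ^ k)
  ^-unit zero h = 1# , *-identityˡ 1#
  ^-unit (suc k) h = unit-* h (^-unit k h)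

  pp : ∀ j → p ^ j * p ^ j ≈ q ^ (j ℕ.* 4)
  pp zero = *-identityˡ 1#
  pp (suc j) = combine₁ (pp j) (solve 3 (λ q P X → (q :* q :* P) :* (q :* q :* P) :- q :* (q :* (q :* (q :* X))) := (q :* q :* q :* q) :* (P :* P :- X)) refl q (p ^ j) (q ^ (j ℕ.* 4)))

  p^2 : ∀ j → p ^ (j ℕ.* 2) ≈ q ^ (j ℕ.* 4)
  p^2 zero = refl
  p^2 (suc j) = combine₁ (p^2 j) (solve 3 (λ q P X → (q :* q) :* ((q :* q) :* P) :- q :* (q :* (q :* (q :* X))) := (q :* q :* q :* q) :* (P :- X)) refl q (p ^ (j ℕ.* 2)) (q ^ (j ℕ.* 4)))

  -- 1 - q is the factor 1 - q^(4i+5) for i = -1.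
  1-q-O₅ : ∀ j → (1# - q) * ∏ j O₅ ≈ ∏ j O₁ * (1# - q ^ suc (j ℕ.* 4))
  1-q-O₅ zero = solve 1 (λ q → (:1 :- q) :* :1 := :1 :* (:1 :- q :* :1)) refl q
  1-q-O₅ (suc j) = combine₁ (1-q-O₅ j) (solve 5 (λ q X a b y → (:1 :- q) :* (a :* y) :- (b :* (:1 :- X)) :* y
    := y :* ((:1 :- q) :* a :- b :* (:1 :- X))) refl q (q ^ suc (j ℕ.* 4)) (∏ j O₅) (∏ j O₁) (O₅ j))

  n∤-odd : ∀ {k} → suc k < n ℕ.+ n → suc k ≡.≢ n → ¬ n ∣ suc k
  n∤-odd l k≢n (divides (suc zero) e) = k≢n (≡.trans e (ℕ.+-identityʳ n))
  n∤-odd l k≢n (divides (suc (suc r)) e) = ℕ.<⇒≱ l (≡.subst (n ℕ.+ n ≤_) (≡.sym e) (ℕ.+-monoʳ-≤ n (ℕ.m≤m+n n (r ℕ.* n))))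

  D-unit : ∀ j → j < m → Unit (D j)
  D-unit j l = units (suc j ℕ.* 4) (below-n (s<s (ℕ.*-monoˡ-≤ 4 l)))

  O₁-unit : ∀ j → j < m → Unit (O₁ j)
  O₁-unit j l = units (suc (j ℕ.* 4)) (below-n (s<s (ℕ.*-monoˡ-< 4 l)))

  neg-unit : ∀ {x} → Unit x → Unit (- x)
  neg-unit {x} (i , h) = - i , trans (solve 2 (λ x i → (:- x) :* (:- i) := x :* i) refl x i) h

  qπ-^ : ∀ k → q ^ k * π ^ k ≈ 1#
  qπ-^ zero = *-identityˡ 1#
  qπ-^ (suc k) = combine₂ qπ (qπ-^ k) (solve 4 (λ p P i I → p :* P :* (i :* I) :- :1 := (P :* I) :* (p :* i :- :1) :+ :1 :* (P :* I :- :1)) refl q (q ^ k) π (π ^ k))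

  N+N≡ : N ℕ.+ N ≡ m ℕ.* 4
  N+N≡ = ≡.trans (≡.sym (ℕ.*-distribˡ-+ m 2 2)) ≡.refl

  m∸1+n<m : ∀ i k → k < i → i ∸ suc k < i
  m∸1+n<m (suc i) k _ = s≤s (ℕ.m∸n≤m i k)

  -- Up to sign and a power of q this is 1 - q^(4d+3) with d ≤ m, or 1 - q^(4d+1) with d < m. The
  -- first exponent may exceed n, but it is less than 2n and differs from n modulo 4.
  difference-unit : ∀ i k → i ≤ m → k ≤ i ℕ.* 2 → Unit (p ^ (i ℕ.* 2) - q * p * p ^ k * p ^ k)
  difference-unit i k i≤m k≤2i = unit-resp (+-cong (sym (p^2 i)) (-‿cong (combine₁ (pp k) (solve 3 (λ q P X → q :* (q :* (q :* X)) :- q :* (q :* q) :* P :* P := (:- (q :* q :* q)) :* (P :* P :- X)) refl q (p ^ k) (q ^ (k ℕ.* 4))))))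
    (by (ℕ.≤-<-connex i k))
    where
    ^-split : ∀ {a b c} → a ≡ b ℕ.+ c → q ^ a ≈ q ^ b * q ^ c
    ^-split {a} {b} {c} e = trans (reflexive (≡.cong (q ^_) e)) (^-homo-* q b c)
    by : i ≤ k ⊎ k < i → Unit (q ^ (i ℕ.* 4) - q ^ (3 ℕ.+ k ℕ.* 4))
    by (inj₁ i≤k) = unit-resp (combine₁ (^-split {3 ℕ.+ k ℕ.* 4} {i ℕ.* 4} {3 ℕ.+ d ℕ.* 4} eq)
          (solve 3 (λ a b c → a :* (:1 :- c) :- (a :- b) := :1 :* (b :- a :* c)) refl (q ^ (i ℕ.* 4)) (q ^ (3 ℕ.+ k ℕ.* 4)) (q ^ (3 ℕ.+ d ℕ.* 4))))
        (unit-* (^-unit (i ℕ.* 4) q-unit) (units (3 ℕ.+ d ℕ.* 4) (n∤-odd bound λ e → 4∤ (ℕ.suc-injective e))))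
      where
      d = k ∸ i
      open Data.Nat.Solver.+-*-Solver using () renaming (solve to solveℕ; _:+_ to _:+ℕ_; _:*_ to _:*ℕ_; _:=_ to _:=ℕ_; con to conℕ)
      eq : 3 ℕ.+ k ℕ.* 4 ≡ i ℕ.* 4 ℕ.+ (3 ℕ.+ d ℕ.* 4)
      eq = ≡.trans (≡.cong (λ k → 3 ℕ.+ k ℕ.* 4) (≡.sym (ℕ.m+[n∸m]≡n i≤k)))
        (solveℕ 2 (λ i d → conℕ 3 :+ℕ (i :+ℕ d) :*ℕ conℕ 4 :=ℕ i :*ℕ conℕ 4 :+ℕ (conℕ 3 :+ℕ d :*ℕ conℕ 4)) ≡.refl i d)
      d≤m : d ≤ m
      d≤m = ℕ.≤-trans (ℕ.∸-monoˡ-≤ i k≤2i) (ℕ.≤-trans (ℕ.≤-reflexive (≡.trans (≡.cong (_∸ i) (solveℕ 1 (λ i → i :*ℕ conℕ 2 :=ℕ i :+ℕ i) ≡.refl i)) (ℕ.m+n∸n≡m i i))) i≤m)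
      bound : 3 ℕ.+ d ℕ.* 4 < n ℕ.+ n
      bound = ℕ.≤-trans (ℕ.+-monoʳ-≤ 4 (ℕ.*-monoˡ-≤ 4 d≤m)) (ℕ.≤-trans (ℕ.+-monoˡ-≤ (m ℕ.* 4) (ℕ.*-monoˡ-≤ 4 1≤m))
        (ℕ.≤-trans (ℕ.n≤1+n _) (ℕ.≤-trans (ℕ.n≤1+n _) (ℕ.≤-reflexive (≡.cong suc (≡.sym (ℕ.+-suc (m ℕ.* 4) (m ℕ.* 4))))))))
      4∤ : 2 ℕ.+ d ℕ.* 4 ≡.≢ m ℕ.* 4
      4∤ e with ∣ℕ.∣m+n∣m⇒∣n {4} {d ℕ.* 4} {2} (≡.subst (4 ∣_) (≡.trans (≡.sym e) (ℕ.+-comm 2 (d ℕ.* 4))) (∣ℕ.n∣m*n m)) (∣ℕ.n∣m*n d)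
      ... | h = contradiction (∣ℕ.∣⇒≤ h) λ { (s≤s (s≤s ())) }
    by (inj₂ k<i) = unit-resp (combine₁ (^-split {i ℕ.* 4} {3 ℕ.+ k ℕ.* 4} {suc (d ℕ.* 4)} eq)
          (solve 3 (λ a b c → (:- b) :* (:1 :- c) :- (a :- b) := (:- :1) :* (a :- b :* c)) refl (q ^ (i ℕ.* 4)) (q ^ (3 ℕ.+ k ℕ.* 4)) (q ^ suc (d ℕ.* 4))))
        (unit-* (neg-unit (^-unit (3 ℕ.+ k ℕ.* 4) q-unit)) (O₁-unit d (ℕ.<-≤-trans (m∸1+n<m i k k<i) i≤m)))
      where
      d = i ∸ suc k
      open Data.Nat.Solver.+-*-Solver using () renaming (solve to solveℕ; _:+_ to _:+ℕ_; _:*_ to _:*ℕ_; _:=_ to _:=ℕ_; con to conℕ)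
      eq : i ℕ.* 4 ≡ 3 ℕ.+ k ℕ.* 4 ℕ.+ suc (d ℕ.* 4)
      eq = ≡.trans (≡.cong (ℕ._* 4) (≡.sym (ℕ.m+[n∸m]≡n k<i)))
        (solveℕ 2 (λ k d → (conℕ 1 :+ℕ k :+ℕ d) :*ℕ conℕ 4 :=ℕ conℕ 3 :+ℕ k :*ℕ conℕ 4 :+ℕ (conℕ 1 :+ℕ d :*ℕ conℕ 4)) ≡.refl k d)

  -- The case x = qⁿ, y = 1 (c = p⁻ᴺ).
  closed-c : ∀ β → q * β ≈ 1# → ∀ τ → Term q (σ z₀) β N τ →
    total q (suc N) τ * ∏ m (λ j → q) * ∏ m D ≈ τ 0 * (∏ m H * (1# - q ^ n))
  closed-c β qβ τ hτ = unit-cancel (unit-* (∏-unit m λ _ _ → neg-unit p-unit) (∏-unit m O₁-unit))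
    (combine₂ main (1-q-O₅ m)
      (solve 10 (λ q S t a b c d e f l → a :* b :* (S :* c :* d) :- a :* b :* (t :* (e :* f))
         := :1 :* (S :* (a :* (c :* (d :* b))) :- t :* (:1 :- q) :* (a :* (e :* l)))
            :+ (t :* a :* e) :* ((:1 :- q) :* l :- b :* f)) refl
        q (total q (suc N) τ) (τ 0) (∏ m (λ _ → - p)) (∏ m O₁) (∏ m (λ _ → q)) (∏ m D) (∏ m H) (1# - q ^ n) (∏ m O₅)))
    where
    -- At x = qⁿ one has s = q(qⁿ + q⁻ⁿ) and e = pᴺ = qⁿ⁻¹, so both sides are 1 + q²ⁿ.
    e-s : p ^ N * σ z₀ ≈ 1# + p * p ^ N * p ^ N
    e-s = combine₂ (p^2 m) (qπ-^ n) (solve 4 (λ q P X I →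
      let w = q :* X :- :1
          z = w :* w :* I
      in P :* (q :* (:1 :+ :1 :+ z)) :- (:1 :+ q :* q :* P :* P)
       := (q :* (:1 :+ :1 :+ z) :- q :* q :* (P :+ X)) :* (P :- X) :+ (w :* w) :* (q :* X :* I :- :1)) refl q (p ^ N) (q ^ (m ℕ.* 4)) (π ^ n))

    main : total q (suc N) τ * (∏ m (λ _ → - p) * (∏ m (λ _ → q) * (∏ m D * ∏ m O₁))) ≈ τ 0 * (1# - q) * (∏ m (λ _ → - p) * (∏ m H * ∏ m O₅))
    main = trans (*-congˡ (sym left)) (trans
      (total-c q β m (N ℕ.+ N) ℕ.≤-refl p-unit (λ i l → unit₂ i (s≤s (ℕ.≤-trans l (ℕ.≤-reflexive N+N≡)))) difference-unit τ (Term⇒TermE e-s hτ))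
      (*-congˡ right))
      where
      -- The factor -q³ of q^(4i+4) - q³ is split into -p and q, because -p also occurs on the
      -- right-hand side and is cancelled.
      left : ∏ m (λ i → (1# - q * β * p ^ (suc i ℕ.* 2)) * (p ^ (suc i ℕ.* 2) - q * p)) ≈ ∏ m (λ _ → - p) * (∏ m (λ _ → q) * (∏ m D * ∏ m O₁))
      left = trans (∏-cong m λ i _ → combine₂ qβ (p^2 i) (solve 4 (λ q β P X →
          let Y = (q :* q) :* ((q :* q) :* P); Y′ = q :* (q :* (q :* (q :* X)))
          in (:1 :- q :* β :* Y) :* (Y :- q :* (q :* q)) :- (:- (q :* q)) :* (q :* ((:1 :- Y′) :* (:1 :- q :* X)))
          := (:- (Y :* (Y :- q :* (q :* q)))) :* (q :* β :- :1)
             :+ ((q :* q :* q :* q) :* ((:1 :- Y′) :- (Y :- q :* (q :* q)))) :* (P :- X)) refl q β (p ^ (i ℕ.* 2)) (q ^ (i ℕ.* 4))))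
        (trans (∏-* m _ _) (*-congˡ (trans (∏-* m _ _) (*-congˡ (∏-* m _ _)))))
      right : ∏ m (λ i → (p ^ (suc i ℕ.* 2) - q * p * β) * (1# - q * p ^ (suc i ℕ.* 2))) ≈ ∏ m (λ _ → - p) * (∏ m H * ∏ m O₅)
      right = trans (∏-cong m λ i _ → combine₂ qβ (p^2 i) (solve 4 (λ q β P X →
          let Y = (q :* q) :* ((q :* q) :* P); Y′ = q :* (q :* (q :* (q :* X)))
          in (Y :- q :* (q :* q) :* β) :* (:1 :- q :* Y) :- (:- (q :* q)) :* ((:1 :- q :* (q :* X)) :* (:1 :- q :* Y′))
          := (:- (q :* q :* (:1 :- q :* Y))) :* (q :* β :- :1)
             :+ ((q :* q :* q :* q) :* ((:1 :- q :* Y) :- q :* (Y′ :- q :* q))) :* (P :- X)) refl q β (p ^ (i ℕ.* 2)) (q ^ (i ℕ.* 4))))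
        (trans (∏-* m _ _) (*-congˡ (∏-* m _ _)))

  module _ (G : Square R z₀ w₀) where
    open Vanishing R M G using (sq-unit; linear-unit; N<n)

    -- The case y = qⁿ (b = p⁻ᵐ), where the series breaks off after k = m.
    closed-b : ∀ z w → (z ≈ 0#) ⊎ (z ≈ z₀) → w ≈ w₀ → ∀ τ → Term q (σ z) ((1# + w) * π) N τ →
      total q (suc N) τ * ∏ m (λ j → D j * D j - q ^ (suc j ℕ.* 4) * z) ≈ τ 0 * (∏ m O₃ * (∏ m O₁ * (1# - q ^ n)))
    closed-b z w hz hw τ hτ = begin
      total q (suc N) τ * ∏ m (λ j → D j * D j - q ^ (suc j ℕ.* 4) * z) ≈⟨ *-cong truncate (∏-cong m λ j _ → left j) ⟩
      total q (suc m) τ * ∏ m (λ j → A q (σ z) (p ^ j * p ^ j))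
        ≈⟨ total-b q (σ z) m p-unit (λ j l → unit-resp (combine₁ (pp (suc j)) (solve 2 (λ x y → (:- (:1 :- y)) :- (x :- :1) := (:- :1) :* (x :- y)) refl _ _))
             (neg-unit (D-unit j l))) τ (λ k l → Term-resp k (ℕ.<-≤-trans l m≤N)) ⟩
      τ 0 * (1# - q) * ∏ m (λ j → B q (σ z) (p ^ j * p ^ j)) ≈⟨ *-congˡ (trans (∏-cong m λ j _ → right j) (∏-* m O₃ O₅)) ⟩
      τ 0 * (1# - q) * (∏ m O₃ * ∏ m O₅) ≈⟨ combine₁ (1-q-O₅ m) (solve 6 (λ q t a b c d → t :* (:1 :- q) :* (a :* b) :- t :* (a :* (c :* d))
          := (t :* a) :* ((:1 :- q) :* b :- c :* d)) refl q (τ 0) (∏ m O₃) (∏ m O₅) (∏ m O₁) (1# - q ^ n)) ⟩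
      τ 0 * (∏ m O₃ * (∏ m O₁ * (1# - q ^ n))) ∎
      where
      m≤N : m ≤ N
      m≤N = ℕ.m≤m*n m 2
      β-eq : (1# + w) * π ≈ p ^ m * p ^ m
      β-eq = combine₃ hw qπ (pp m) (solve 5 (λ q π w P X → (:1 :+ w) :* π :- P :* P
        := π :* (w :- (q :* X :- :1)) :+ X :* (q :* π :- :1) :+ (:- :1) :* (P :* P :- X)) refl q π w (p ^ m) (q ^ (m ℕ.* 4)))
      Term-resp : Term q (σ z) (p ^ m * p ^ m) N τ
      Term-resp = HomProperties.Term-hom {R = R} {S = R} (id-hom R) {p} {p} refl {q} {q} {σ z} {σ z} {(1# + w) * π} {p ^ m * p ^ m} refl refl β-eq hτ
      -- The numerator of the ratio contains β - p²ᵐ = 0 at k = m, and the recurrence propagates the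
      -- zero.
      vanish : ∀ r → suc (r ℕ.+ m) ≤ N → τ (suc (r ℕ.+ m)) ≈ 0#
      vanish r l = unit-cancel (DenUnit.den-unit R p (unit₄ (r ℕ.+ m) l′) (sq-unit (r ℕ.+ m) l′ hz) (linear-unit (r ℕ.+ m) l′ (inj₂ hw)))
        (trans (*-comm _ _) (trans (hτ (r ℕ.+ m) l) (trans (numerator r l) (sym (zeroʳ _)))))
        where
        l′ : suc (r ℕ.+ m) < n
        l′ = ℕ.≤-<-trans l N<n
        numerator : ∀ r → suc (r ℕ.+ m) ≤ N → τ (r ℕ.+ m) * num q (σ z) ((1# + w) * π) (p ^ (r ℕ.+ m)) ≈ 0#
        numerator zero l = combine₁ β-eq (solve 7 (λ t x y β P q p → t :* (x :* y :* (β :- P :* P) :* q :* p :* P) :- :0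
          := (t :* (x :* y :* q :* p :* P)) :* (β :- P :* P)) refl (τ m) _ _ ((1# + w) * π) (p ^ m) q p)
        numerator (suc r) l = trans (*-congʳ (vanish r (ℕ.<⇒≤ l))) (zeroˡ _)
      truncate-at : ∀ r → r ℕ.+ m ≤ N → total q (suc (r ℕ.+ m)) τ ≈ total q (suc m) τ
      truncate-at zero _ = refl
      truncate-at (suc r) l = trans (+-cong (truncate-at r (ℕ.<⇒≤ l)) (trans (*-congˡ (vanish r l)) (zeroʳ _))) (+-identityʳ _)
      truncate : total q (suc N) τ ≈ total q (suc m) τ
      truncate = trans (reflexive (≡.cong (λ k → total q (suc k) τ) N≡)) (truncate-at m (ℕ.≤-reflexive (≡.sym N≡)))
        where
        N≡ : N ≡ m ℕ.+ m
        N≡ = ≡.trans (ℕ.*-comm m 2) (≡.cong (m ℕ.+_) (ℕ.+-identityʳ m))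
      left : ∀ j → D j * D j - q ^ (suc j ℕ.* 4) * z ≈ A q (σ z) (p ^ j * p ^ j)
      left j = combine₁ (pp j) (solve 4 (λ q z P X → let Y = q :* (q :* (q :* (q :* X))); p = q :* q; β = P :* P; s = q :* (:1 :+ :1 :+ z) in
         ((:1 :- Y) :* (:1 :- Y) :- Y :* z) :- (:1 :- q :* p :* β :* s :+ q :* q :* p :* p :* p :* β :* β)
         := (q :* p :* s :- q :* q :* p :* p :* p :* (β :+ X)) :* (β :- X)) refl q z (p ^ j) (q ^ (j ℕ.* 4)))
      right : ∀ j → B q (σ z) (p ^ j * p ^ j) ≈ O₃ j * O₅ j
      right j = combine₁ (pp j) (solve 3 (λ q P X → let Y = q :* (q :* (q :* X)); p = q :* q; β = P :* P in
         ((:1 :- q :* p :* β) :* (:1 :- q :* p :* p :* β)) :- (:1 :- Y) :* (:1 :- q :* (q :* Y))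
         := ((:- (q :* p)) :* (:1 :- q :* p :* p :* β) :+ (:- (q :* p :* p)) :* (:1 :- Y)) :* (β :- X)) refl q (p ^ j) (q ^ (j ℕ.* 4)))

module Congruence {c ℓ} (R : CommutativeRing c ℓ) (M : Modulus R)
  (G : Square R (Differences.z₀ R M) (Differences.w₀ R M))
  (nat-unit : ∀ k → Units.Unit R (MoreSums.nat R (suc k))) (c : CommutativeRing.Carrier R)
  (24c : MoreSums.IsSquarePred/24 R (Modulus.n M) c) where
  open CommutativeRing R
  open Units R
  open MoreSums R
  open Modulus M
  open ℤSolver R
  open Sums R
  open Exp semiring using (_^_; ^-homo-*)
  open Differences R M
  open Quadratic R p
  open Closed R M
  open Vanishing R M G

  inv : ∀ j → Dec (n ∣ j) → Carrier
  -- A default at the multiples of n, where 1 - qʲ is nilpotent.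
  inv j (yes _) = 0#
  inv j (no ¬h) = proj₁ (units j ¬h)

  i : ℕ → Carrier
  i j = inv j (n ∣? j)

  inverse : ∀ j → ¬ n ∣ j → (1# - q ^ j) * i j ≈ 1#
  inverse j h = go (n ∣? j)
    where
    go : ∀ d → (1# - q ^ j) * inv j d ≈ 1#
    go (yes h′) = contradiction h′ h
    go (no h′) = proj₂ (units j h′)

  F : ℕ → Carrier
  F j = q ^ j * (i j * i j)

  private
    S = Quotient.quotient R φ
    module S = CommutativeRing S
    κ : Hom R S
    κ = quotient-hom R φ
    module KP = HomProperties {R = R} {S = S} κ
    module KS = SumHoms {R = R} {S = S} κ
    qⁿ≋1 : q ^ n S.≈ S.1#
    qⁿ≋1 = S.sym (Quotient.multiple g φ-eq)
    ζ : PrimitiveRoot S m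
    ζ = record { q = q ; pw = q ^_ ; pw-0 = S.refl ; pw-suc = λ _ → S.refl ; pw-n = qⁿ≋1 ; i = i ; inverse = λ j h → Quotient.≈⇒≋ R φ (inverse j h) }
    module Z = RootOfUnity S m ζ

  reflected : ∏ m O₁ * ∏ m O₃ * q ^ m S.≈ ∏ m H * ∏ m D
  reflected = S.trans (S.*-congʳ {q ^ m} (S.trans (Quotient.≈⇒≋ R φ (sym (∏-* m O₁ O₃))) (KS.∏-hom m (λ j → O₁ j * O₃ j))))
    (S.trans Z.reflected (S.trans (S.sym (KS.∏-hom m (λ j → H j * D j))) (Quotient.≈⇒≋ R φ (∏-* m H D))))

  -- `B′` is B(n,q)/(1 - q)². `Γ` is the sum over the remaining even residues, which enters through
  -- the logarithmic derivative; modulo φ the two cancel.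
  Γ B′ : Carrier
  Γ = ∑ m (λ j → F (suc j ℕ.* 4))
  B′ = c + ∑ m (λ j → F (2 ℕ.+ j ℕ.* 4))

  private
    natˢ-unit : ∀ k → Units.Unit S (MoreSums.nat S (suc k))
    natˢ-unit k = Units.unit-resp S {nat (suc k)} (KS.nat-hom (suc k)) (KP.unit-hom (nat-unit k))

    24cˢ : (1# + 1#) * (1# + 1#) * (1# + 1#) * (1# + 1# + 1#) * c S.≈ Z.ν * Z.ν - 1#
    24cˢ = S.trans {_} {nat n * nat n - 1#} (Quotient.≈⇒≋ R φ 24c) (S.+-congʳ { - 1#} (S.*-cong (KS.nat-hom n) (KS.nat-hom n)))

  B-value : B′ + Γ S.≈ 0#
  B-value = S.trans (Quotient.≈⇒≋ R φ (+-assoc c _ _))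
    (S.trans (S.+-congˡ {c} (S.+-cong (KS.∑-hom m _) (KS.∑-hom m _))) (Z.B-value natˢ-unit c 24cˢ))

  -- The expansion to first order in z₀, which is exact because z₀² = 0.
  D-product : ∀ r → r ≤ m → ∏ r (λ j → D j * D j - q ^ (suc j ℕ.* 4) * z₀) ≈ ∏ r (λ j → D j * D j) * (1# - z₀ * ∑ r (λ j → F (suc j ℕ.* 4)))
  D-product zero _ = solve 1 (λ z → :1 := :1 :* (:1 :- z :* :0)) refl z₀
  D-product (suc r) l = combine₃ (D-product r (ℕ.<⇒≤ l)) (inverse (suc r ℕ.* 4) (below-n (s<s (ℕ.*-monoˡ-≤ 4 l)))) z₀²
    (solve 6 (λ P E s z x i → let d = :1 :- x; f = x :* (i :* i) in
       P :* (d :* d :- x :* z) :- (E :* (d :* d)) :* (:1 :- z :* (s :+ f))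
       := (d :* d :- x :* z) :* (P :- E :* (:1 :- z :* s))
          :+ (E :* z :* x :* (d :* i :+ :1)) :* (d :* i :- :1)
          :+ (E :* x :* s) :* (z :* z :- :0)) refl
      (∏ r (λ j → D j * D j - q ^ (suc j ℕ.* 4) * z₀)) (∏ r (λ j → D j * D j)) (∑ r (λ j → F (suc j ℕ.* 4))) z₀ (q ^ (suc r ℕ.* 4)) (i (suc r ℕ.* 4)))

  ∏-q : ∀ r → ∏ r (λ _ → q) ≈ q ^ r
  ∏-q zero = refl
  ∏-q (suc r) = trans (*-congʳ (∏-q r)) (*-comm _ _)

  e : Carrier
  e = 1# - q ^ n

  -- With K = S(0,qⁿ)∏D² the second difference says S(0,1) = S(z₀,1) - K z₀Γ/∏D². The first term
  -- gives the main part ∏H·e. In the second, K contains e = 1 - qⁿ and z₀ contains e².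
  total-value : total q (suc N) t₀₀ * (q ^ m * ∏ m D) ≈ ∏ m H * (e + e * e * e * B′)
  total-value = unit-cancel (∏-unit m D-unit) (combine₃ difference₀ (S₁₀-value) cubic
    (solve 10 (λ S₀₀ S₁₀ d D q H e B z₀Γ K → D :* (S₀₀ :* (q :* D)) :- D :* (H :* (e :+ e :* e :* e :* B))
      := q :* (D :* D :* S₀₀ :- (D :* D :* S₁₀ :- K :* z₀Γ)) :+ D :* (S₁₀ :* (q :* D) :- H :* e)
         :+ (:- :1) :* ((q :* K :* z₀Γ :+ D :* H :* (e :* e :* e :* B)) :- :0)) refl
      (total q (suc N) t₀₀) (total q (suc N) t₁₀) 0# (∏ m D) (q ^ m) (∏ m H) e B′ (z₀ * Γ) K))
    where
    K : Carrier
    K = ∏ m O₃ * (∏ m O₁ * e)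
    DD : Carrier
    DD = ∏ m (λ j → D j * D j)
    DD≈ : DD ≈ ∏ m D * ∏ m D
    DD≈ = ∏-* m D D
    start : ∀ {ev} → (E : Evaluation ev) → Hom.⟦_⟧ ev (termᴬ 0) ≈ 1#
    start {ev} E = Hom.1-hom ev
    open Evaluation
    S₁₀-value : total q (suc N) t₁₀ * (q ^ m * ∏ m D) ≈ ∏ m H * e
    S₁₀-value = combine₃ (closed-c ((1# + 0#) * π) (combine₁ qπ (solve 2 (λ q π → q :* ((:1 :+ :0) :* π) :- :1 := :1 :* (q :* π :- :1)) refl q π)) t₁₀ (ev-Term evaluation₁₀ termᴬ-Term))
      (start evaluation₁₀) (∏-q m)
      (solve 6 (λ S Q q D t He → S :* (q :* D) :- He := :1 :* (S :* Q :* D :- t :* He) :+ He :* (t :- :1) :+ (:- (S :* D)) :* (Q :- q)) refl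
        (total q (suc N) t₁₀) (∏ m (λ _ → q)) (q ^ m) (∏ m D) (t₁₀ 0) (∏ m H * e))
    S₀₁-value : total q (suc N) t₀₁ * DD ≈ K
    S₀₁-value = combine₂ (closed-b G 0# w₀ (inj₁ refl) refl t₀₁ (ev-Term evaluation₀₁ termᴬ-Term)) (start evaluation₀₁)
      (trans (+-congʳ (*-congˡ (∏-cong m λ j _ → solve 2 (λ d x → d :* d := d :* d :- x :* :0) refl (D j) (q ^ (suc j ℕ.* 4)))))
        (solve 3 (λ S t K → S :- K := :1 :* (S :- t :* K) :+ K :* (t :- :1)) refl _ (t₀₁ 0) K))
    S₁₁-value : total q (suc N) t₁₁ * DD ≈ K * (1# + z₀ * Γ)
    S₁₁-value = combine₄ (closed-b G z₀ w₀ (inj₂ refl) refl t₁₁ (ev-Term evaluation₁₁ termᴬ-Term)) (start evaluation₁₁) (D-product m ℕ.≤-refl) z₀²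
      (solve 7 (λ S t K P E z Γ → let u = :1 :+ z :* Γ in
        S :* E :- K :* u := u :* (S :* P :- t :* K) :+ (u :* K) :* (t :- :1) :+ (:- (u :* S)) :* (P :- E :* (:1 :- z :* Γ))
          :+ (S :* E :* Γ :* Γ) :* (z :* z :- :0)) refl
        (total q (suc N) t₁₁) (t₁₁ 0) K _ DD z₀ Γ)
    difference₀ : ∏ m D * ∏ m D * total q (suc N) t₀₀ ≈ ∏ m D * ∏ m D * total q (suc N) t₁₀ - K * (z₀ * Γ)
    difference₀ = combine₄ difference S₀₁-value S₁₁-value DD≈
      (solve 8 (λ D E a b c d K z → D :* D :* a :- (D :* D :* b :- K :* z)
        := (D :* D) :* (a :- (b :+ c :- d)) :+ :1 :* (c :* E :- K) :+ (:- :1) :* (d :* E :- K :* (:1 :+ z)) :+ (d :- c) :* (E :- D :* D)) refl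
        (∏ m D) DD (total q (suc N) t₀₀) (total q (suc N) t₁₀) (total q (suc N) t₀₁) (total q (suc N) t₁₁) K (z₀ * Γ))
    y₁ = Quotient.factor reflected
    y₂ = Quotient.factor B-value
    -- The remaining terms have the factor (1 - qⁿ)³, so only their cofactor modulo φ matters.
    cubic : q ^ m * K * (z₀ * Γ) + ∏ m D * ∏ m H * (e * e * e * B′) ≈ 0#
    cubic = combine₄ (Quotient.equation reflected) (Quotient.equation B-value) (combine₂ (qπ-^ n) φ-eq
          (solve 4 (λ E I φ g → I :- (:1 :+ φ :* g :* I) := :1 :* (E :* I :- :1) :+ I :* ((:1 :- E) :- φ :* g)) refl (q ^ n) (π ^ n) φ g))
        cube
      (solve 14 (λ q O₃ O₁ E I Γ D H B φ g y₁ y₂ c →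
        let e = :1 :- E
            w = E :- :1
            y = y₁ :* (:1 :+ φ :* g :* I) :* Γ :+ H :* D :* y₂ :+ H :* D :* g :* I :* Γ
        in (q :* (O₃ :* (O₁ :* e)) :* (w :* w :* I :* Γ) :+ D :* H :* (e :* e :* e :* B)) :- :0
        := (e :* e :* e :* (:1 :+ φ :* g :* I) :* Γ) :* (O₁ :* O₃ :* q :- H :* D :- φ :* y₁)
           :+ (e :* e :* e :* H :* D) :* (B :+ Γ :- :0 :- φ :* y₂)
           :+ (e :* e :* e :* O₁ :* O₃ :* q :* Γ) :* (I :- (:1 :+ φ :* g :* I))
           :+ y :* (e :* e :* e :* φ :- :0)) refl
        (q ^ m) (∏ m O₃) (∏ m O₁) (q ^ n) (π ^ n) Γ (∏ m D) (∏ m H) B′ φ g y₁ y₂ 0#)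
      where
      cube : e * e * e * φ ≈ 0#
      cube = combine₂ φ⁴ φ-eq (solve 3 (λ E φ g → let e = :1 :- E in e :* e :* e :* φ :- :0
        := (g :* g :* g) :* (φ :* φ :* φ :* φ :- :0) :+ (φ :* (e :* e :+ e :* φ :* g :+ φ :* g :* φ :* g)) :* (e :- φ :* g)) refl (q ^ n) φ g)

-- The series and its value in terms of q-shifted factorials

module SeriesTerms {c ℓ} (R : CommutativeRing c ℓ) (q : CommutativeRing.Carrier R) (q-unit : Units.Unit R q) where
  open CommutativeRing R
  open ℤSolver R
  open Units R
  open Sums R
  open Exp semiring using (_^_; ^-homo-*)

  π : Carrier
  π = proj₁ q-unit

  qπ : q * π ≈ 1#
  qπ = proj₂ q-unit

  -- The case z = w = 0; the zeros are kept so that s and β agree by computation with the parameters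
  -- of the perturbed series.
  p s β : Carrier
  p = q * q
  s = q * (1# + 1# + 0#)
  β = (1# + 0#) * π

  open Quadratic R p

  q^2 : ∀ k → q ^ (k ℕ.* 2) ≈ p ^ k
  q^2 zero = refl
  q^2 (suc k) = trans (*-congˡ (*-congˡ (q^2 k))) (sym (*-assoc q q (p ^ k)))

  q^4 : ∀ k → q ^ (k ℕ.* 4) ≈ p ^ k * p ^ k
  q^4 zero = sym (*-identityˡ 1#)
  q^4 (suc k) = combine₁ (q^4 k) (solve 3 (λ q P X → q :* (q :* (q :* (q :* X))) :- (q :* q :* P) :* (q :* q :* P) := (q :* q :* q :* q) :* (X :- P :* P)) refl q (p ^ k) (q ^ (k ℕ.* 4)))

  q^6 : ∀ k → q ^ (k ℕ.* 6) ≈ p ^ k * p ^ k * p ^ k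
  q^6 zero = solve 0 (:1 := :1 :* :1 :* :1) refl
  q^6 (suc k) = combine₁ (q^6 k) (solve 3 (λ q P X → q :* (q :* (q :* (q :* (q :* (q :* X))))) :- (q :* q :* P) :* (q :* q :* P) :* (q :* q :* P)
    := (q :* q :* q :* q :* q :* q) :* (X :- P :* P :* P)) refl q (p ^ k) (q ^ (k ℕ.* 6)))

  -- The sequences a, b, c, d, w play the roles of (q;q⁴)ₖ, (q;q²)ₖ, (q²;q²)ₖ, (q⁴;q⁴)ₖ, q^(k²+k).
  record Products (K : ℕ) (a b c d w : ℕ → Carrier) : Set ℓ where
    field
      a-suc : ∀ k → k < K → a (suc k) ≈ a k * (1# - q ^ suc (k ℕ.* 4))
      b-suc : ∀ k → k < K → b (suc k) ≈ b k * (1# - q ^ suc (k ℕ.* 2))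
      c-suc : ∀ k → k < K → c (suc k) ≈ c k * (1# - q ^ (suc k ℕ.* 2))
      d-suc : ∀ k → k < K → d (suc k) ≈ d k * (1# - q ^ (suc k ℕ.* 4))
      w-suc : ∀ k → k < K → w (suc k) ≈ w k * q ^ (suc k ℕ.* 2)

  cube : Carrier → Carrier
  cube x = x * (x * (x * 1#))

  module _ {K a b c d w} (Π : Products K a b c d w) (τ : ℕ → Carrier)
    (unit-c : ∀ k → k ≤ K → Unit (c k)) (unit-d : ∀ k → k ≤ K → Unit (d k))
    (τ-eq : ∀ k → k ≤ K → τ k * (c k * cube (d k)) ≈ a k * cube (b k) * w k) where
    open Products Π

    -- For these parameters the quadratic factors are the squares (1 - q⁴P²)² and (1 - qP)², and the
    -- linear factor is 1 - q²P; this produces the cubes in the summand.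
    products-Term : Term q s β K τ
    products-Term k l = unit-cancel (unit-* (unit-c k (ℕ.<⇒≤ l)) (unit-* (unit-d k (ℕ.<⇒≤ l)) (unit-* (unit-d k (ℕ.<⇒≤ l)) (unit-* (unit-d k (ℕ.<⇒≤ l)) (1# , *-identityˡ 1#)))))
      (combine₁ step (combine-lemma (τ k) (τ (suc k)) (c k) (d k) (p ^ k)))
      where
      P = p ^ k
      C : Carrier
      C = (1# - p * P) * cube (1# - p * p * (P * P))
      V : Carrier
      V = (1# - q * (P * P)) * cube (1# - q * P) * (p * P)
      den-eq : den q s β P ≈ C
      den-eq = combine₁ qπ (solve 3 (λ q π P → let p = q :* q; s = q :* (:1 :+ :1 :+ :0); β = (:1 :+ :0) :* π; x = :1 :- p :* p :* (P :* P); E = :1 :- q :* p :* s :* P :* P :+ q :* q :* p :* p :* p :* P :* P :* P :* P in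
        (:1 :- p :* p :* P :* P) :* E :* (:1 :- q :* p :* β :* P)
        :- (:1 :- p :* P) :* (x :* (x :* (x :* :1))) := (:- ((:1 :- p :* p :* P :* P) :* E :* p :* P)) :* (q :* π :- :1)) refl q π P)
      num-eq : num q s β P ≈ V
      num-eq = combine₁ qπ (solve 3 (λ q π P → let p = q :* q; s = q :* (:1 :+ :1 :+ :0); β = (:1 :+ :0) :* π; x = :1 :- q :* P; E = :1 :- s :* P :+ p :* P :* P in
        (:1 :- q :* P) :* E :* (β :- P :* P) :* q :* p :* P
        :- (:1 :- q :* (P :* P)) :* (x :* (x :* (x :* :1))) :* (p :* P) := ((:1 :- q :* P) :* E :* p :* P) :* (q :* π :- :1)) refl q π P)
      a′ : a (suc k) ≈ a k * (1# - q * (P * P))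
      a′ = trans (a-suc k l) (*-congˡ (+-congˡ (-‿cong (*-congˡ (q^4 k)))))
      b′ : b (suc k) ≈ b k * (1# - q * P)
      b′ = trans (b-suc k l) (*-congˡ (+-congˡ (-‿cong (*-congˡ (q^2 k)))))
      c′ : c (suc k) ≈ c k * (1# - p * P)
      c′ = trans (c-suc k l) (*-congˡ (+-congˡ (-‿cong (q^2 (suc k)))))
      d′ : d (suc k) ≈ d k * (1# - p * p * (P * P))
      d′ = trans (d-suc k l) (*-congˡ (+-congˡ (-‿cong (trans (q^4 (suc k)) (solve 2 (λ p P → (p :* P) :* (p :* P) := p :* p :* (P :* P)) refl p P)))))
      w′ : w (suc k) ≈ w k * (p * P)
      w′ = trans (w-suc k l) (*-congˡ (q^2 (suc k)))
      cube-cong : ∀ {x y} → x ≈ y → cube x ≈ cube y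
      cube-cong e = *-cong e (*-cong e (*-cong e refl))
      next : τ (suc k) * (c k * (1# - p * P) * cube (d k * (1# - p * p * (P * P)))) ≈ a k * (1# - q * (P * P)) * cube (b k * (1# - q * P)) * (w k * (p * P))
      next = trans (*-congˡ (*-cong (sym c′) (cube-cong (sym d′)))) (trans (τ-eq (suc k) l) (*-cong (*-cong a′ (cube-cong b′)) w′))
      step : τ (suc k) * (c k * cube (d k)) * C ≈ τ k * (c k * cube (d k)) * V
      step = combine₂ next (τ-eq k (ℕ.<⇒≤ l)) (solve 12 (λ a b c d w t t′ q p P x y →
        let cb = λ x → x :* (x :* (x :* :1)); X = :1 :- p :* P; Y = :1 :- p :* p :* (P :* P); Z = :1 :- q :* (P :* P); U = :1 :- q :* P in
        t′ :* (c :* cb d) :* (X :* cb Y) :- t :* (c :* cb d) :* (Z :* cb U :* (p :* P))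
        := :1 :* (t′ :* (c :* X :* cb (d :* Y)) :- a :* Z :* cb (b :* U) :* (w :* (p :* P)))
           :+ (:- (Z :* cb U :* (p :* P))) :* (t :* (c :* cb d) :- a :* cb b :* w)) refl (a k) (b k) (c k) (d k) (w k) (τ k) (τ (suc k)) q p P 0# 0#)
      combine-lemma : ∀ t t′ c d P → let u = c * (d * (d * (d * 1#))) in
        u * (t′ * den q s β (p ^ k)) - u * (t * num q s β (p ^ k)) ≈ 1# * (t′ * u * C - t * u * V)
      combine-lemma t t′ c d _ = trans (+-cong (*-congˡ (*-congˡ den-eq)) (-‿cong (*-congˡ (*-congˡ num-eq))))
        (solve 5 (λ u t t′ C V → u :* (t′ :* C) :- u :* (t :* V) := :1 :* (t′ :* u :* C :- t :* u :* V)) refl (c * cube d) t t′ C V)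

  -- The form used at a proper divisor of n. Such a divisor need not be 1 modulo 4, so the order of
  -- q is an arbitrary odd number 2N + 1.
  zero-sum : ∀ N → q ^ suc (N ℕ.* 2) ≈ 1# → (∀ i → suc i ≤ N ℕ.* 2 → Unit (1# - q ^ (suc i ℕ.* 2))) → (∀ i → i ≤ N → Unit (1# - q ^ (suc i ℕ.* 4))) →
    ∀ τ → Term q s β N τ → total q (suc N) τ ≈ 0#
  zero-sum N qⁿ u₂ u₄ τ hτ = QuadraticZero.total-zero R p N q s β
    (trans (*-congˡ (sym (q^2 N))) qⁿ)
    (invertible (suc N) λ i l → unit-resp (combine₁ (q^4 i) (solve 3 (λ q P X → let p = q :* q; x = P :* P; s = q :* (:1 :+ :1 :+ :0); Y = :1 :- q :* (q :* (q :* (q :* X))) in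
         Y :* Y :- (:1 :- q :* x :* p :* s :+ q :* x :* q :* x :* p :* p :* p) := ((q :* q :* q :* q) :* ((:- :1) :- :1 :+ q :* q :* q :* q :* (X :+ x))) :* (X :- x)) refl q (p ^ i) (q ^ (i ℕ.* 4))))
       (unit-* (u₄ i (ℕ.≤-pred l)) (u₄ i (ℕ.≤-pred l))))
    (invertible (N ℕ.+ N) λ i l → unit-resp (combine₂ qπ (q^2 i) (solve 4 (λ q π P X → (:1 :- q :* (q :* X)) :- (:1 :- q :* (q :* q) :* ((:1 :+ :0) :* π) :* P)
         := (q :* q :* P) :* (q :* π :- :1) :+ (:- (q :* q)) :* (X :- P)) refl q π (p ^ i) (q ^ (i ℕ.* 2))))
       (u₂ i (ℕ.≤-trans l (ℕ.≤-reflexive (≡.sym (≡.trans (ℕ.*-comm N 2) (≡.cong (N ℕ.+_) (ℕ.+-identityʳ N))))))))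
    τ hτ

module SeriesValue {c ℓ} (R : CommutativeRing c ℓ) (M : Modulus R)
  (nat-unit : ∀ k → Units.Unit R (MoreSums.nat R (suc k))) (r : CommutativeRing.Carrier R)
  (24r : MoreSums.IsSquarePred/24 R (Modulus.n M) r) where
  open CommutativeRing R
  open Units R
  open MoreSums R
  open Modulus M
  open ℤSolver R
  open Sums R
  open Exp semiring using (_^_; ^-homo-*)
  open Differences R M hiding (p)
  open SeriesTerms R q (π , qπ) hiding (π; qπ)
  open Quadratic R p
  open Closed R M using (H; D; q-unit; N+N≡; D-unit)
  open Vanishing R M (square R z₀ w₀)
  open Congruence R M (square R z₀ w₀) nat-unit r 24r using (total-value; B′; F; i; inverse; e)

  unit-1-q : Unit (1# - q)
  unit-1-q = unit-resp (+-congˡ (-‿cong (*-identityʳ q))) (units 1 (below-n (s<s (ℕ.≤-trans (s≤s z≤n) (ℕ.*-monoˡ-≤ 4 1≤m)))))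

  module _ {a b c d w} (Π : Products N a b c d w)
    (a₀ : a 0 ≈ 1#) (b₀ : b 0 ≈ 1#) (c₀ : c 0 ≈ 1#) (d₀ : d 0 ≈ 1#) (w₀≈1 : w 0 ≈ 1#)
    (qi : ℕ → Carrier) (qi-eq : ∀ k → (1# - q) * qi k ≈ 1# - q ^ k) where
    open Products Π

    unit-c : ∀ k → k ≤ N → Unit (c k)
    unit-c zero _ = unit-resp (sym c₀) (1# , *-identityˡ 1#)
    unit-c (suc k) l = unit-resp (sym (c-suc k l)) (unit-* (unit-c k (ℕ.<⇒≤ l)) (units (suc k ℕ.* 2) (below-n (s<s (ℕ.≤-trans (ℕ.*-monoˡ-≤ 2 l) (ℕ.≤-reflexive (ℕ.*-assoc m 2 2)))))))

    unit-d : ∀ k → k ≤ N → Unit (d k)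
    unit-d zero _ = unit-resp (sym d₀) (1# , *-identityˡ 1#)
    unit-d (suc k) l = unit-resp (sym (d-suc k l)) (unit-* (unit-d k (ℕ.<⇒≤ l))
      (unit-resp (+-congˡ (-‿cong (trans (solve 2 (λ p P → p :* p :* P :* P := (p :* P) :* (p :* P)) refl p (p ^ k)) (sym (q^4 (suc k)))))) (unit₄ k (ℕ.≤-<-trans l N<n))))

    unit-cd : ∀ k → k ≤ N → Unit (c k * cube (d k))
    unit-cd k l = unit-* (unit-c k l) (unit-* (unit-d k l) (unit-* (unit-d k l) (unit-* (unit-d k l) (1# , *-identityˡ 1#))))

    private
      inv-cd : Invertible (suc N) (λ k → c k * cube (d k))
      inv-cd = invertible (suc N) λ k l → unit-cd k (ℕ.≤-pred l)

      τ : ℕ → Carrier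
      τ k = a k * cube (b k) * w k * proj₁ inv-cd k

      τ-eq : ∀ k → k ≤ N → τ k * (c k * cube (d k)) ≈ a k * cube (b k) * w k
      τ-eq k l = combine₁ (proj₂ inv-cd k (s≤s l)) (solve 3 (λ x i u → x :* i :* u :- x := x :* (u :* i :- :1)) refl _ _ (c k * cube (d k)))

      τ-Term : Term q s β N τ
      τ-Term = products-Term Π τ unit-c unit-d τ-eq

      -- Both sequences start at 1 and obey the same recurrence with unit denominators.
      τ≈t₀₀ : ∀ k → k ≤ N → τ k ≈ t₀₀ k
      τ≈t₀₀ zero _ = unit-cancel (unit-cd 0 z≤n) (trans (*-comm _ _) (trans (τ-eq 0 z≤n) (trans (*-cong (*-cong a₀ (*-cong b₀ (*-cong b₀ (*-congʳ b₀)))) w₀≈1)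
        (trans (solve 1 (λ o → :1 :* (:1 :* (:1 :* (:1 :* :1))) :* :1 := :1 :* (:1 :* (:1 :* (:1 :* :1))) :* :1) refl 0#)
         (*-cong (*-cong (sym c₀) (*-cong (sym d₀) (*-cong (sym d₀) (*-congʳ (sym d₀))))) (sym (Hom.1-hom (Square.ev₀₀ (square R z₀ w₀)))))))))
      τ≈t₀₀ (suc k) l = unit-cancel (DenUnit.den-unit R p (unit₄ k (ℕ.≤-<-trans l N<n)) (sq-unit k (ℕ.≤-<-trans l N<n) (inj₁ refl)) (linear-unit k (ℕ.≤-<-trans l N<n) (inj₁ refl)))
        (trans (*-comm _ _) (trans (τ-Term k l) (trans (*-congʳ (τ≈t₀₀ k (ℕ.<⇒≤ l))) (trans (sym (Evaluation.ev-Term evaluation₀₀ termᴬ-Term k l)) (*-comm _ _)))))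

    module _ (x : ℕ → Carrier) (x-eq : ∀ k → k ≤ N → x k * (c k * cube (d k)) ≈ qi (suc (k ℕ.* 6)) * a k * cube (b k) * w k)
      (β′ : ℕ → Carrier) (β-eq : ∀ j → j < m → β′ j * (qi (2 ℕ.+ j ℕ.* 4) * qi (2 ℕ.+ j ℕ.* 4)) ≈ q ^ (2 ℕ.+ j ℕ.* 4)) where

      x-τ : ∀ k → k ≤ N → (1# - q) * x k ≈ (1# - q * p ^ k * p ^ k * p ^ k) * τ k
      x-τ k l = unit-cancel (unit-cd k l) (combine₄ (x-eq k l) (τ-eq k l) (qi-eq (suc (k ℕ.* 6))) (q^6 k)
        (solve 10 (λ q x u f a b w t P X → u :* ((:1 :- q) :* x) :- u :* ((:1 :- q :* P :* P :* P) :* t)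
          := (:1 :- q) :* (x :* u :- f :* a :* b :* w) :+ (:- (:1 :- q :* P :* P :* P)) :* (t :* u :- a :* b :* w)
            :+ (a :* b :* w) :* ((:1 :- q) :* f :- (:1 :- q :* X)) :+ (:- (a :* b :* w :* q)) :* (X :- P :* P :* P)) refl
          q (x k) (c k * cube (d k)) (qi (suc (k ℕ.* 6))) (a k) (cube (b k)) (w k) (τ k) (p ^ k) (q ^ (k ℕ.* 6))))

      B : Carrier
      B = r * ((1# - q) * (1# - q)) + ∑ m β′

      B-eq : (1# - q) * (1# - q) * B′ ≈ B
      B-eq = trans (solve 3 (λ u r s → u :* u :* (r :+ s) := r :* (u :* u) :+ u :* u :* s) refl (1# - q) r (∑ m (λ j → F (2 ℕ.+ j ℕ.* 4))))
        (+-congˡ (trans (∑-distribˡ m _ _) (∑-cong m β-F)))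
        where
        β-F : ∀ j → j < m → (1# - q) * (1# - q) * F (2 ℕ.+ j ℕ.* 4) ≈ β′ j
        β-F j l = unit-cancel (unit-* unit-qi unit-qi) (combine₃ (β-eq j l) (qi-eq J) (inverse J n∤J)
          (solve 6 (λ u f b X i X′ → f :* f :* (u :* u :* (X :* (i :* i))) :- f :* f :* b
            := (:- :1) :* (b :* (f :* f) :- X) :+ (X :* i :* i :* (u :* f :+ X′)) :* (u :* f :- X′) :+ (X :* (X′ :* i :+ :1)) :* (X′ :* i :- :1))
            refl (1# - q) (qi J) (β′ j) (q ^ J) (i J) (1# - q ^ J)))
          where
          J = 2 ℕ.+ j ℕ.* 4
          n∤J : ¬ n ∣ J
          n∤J = below-n (s<s (ℕ.≤-trans (ℕ.+-monoˡ-≤ (j ℕ.* 4) (s≤s (s≤s (z≤n {2})))) (ℕ.*-monoˡ-≤ 4 l)))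
          unit-qi : Unit (qi J)
          unit-qi = (1# - q) * i J , trans (solve 3 (λ u f i → f :* (u :* i) := u :* f :* i) refl (1# - q) (qi J) (i J)) (trans (*-congʳ (qi-eq J)) (inverse J n∤J))

      -- Since (1 - q)[n] = e and B = (1 - q)²B′, the right-hand side multiplied by 1 - q is ∏H (e +
      -- e³B′), the expression in `total-value`.
      value : ∑ (suc N) x * (∏ m D * q ^ m) ≈ ∏ m H * qi n * (1# + qi n * qi n * B)
      value = unit-cancel unit-1-q (combine₄ total-value X-eq (qi-eq n) B-eq
        (solve 10 (λ u X D Q H f e B B′ T → u :* (X :* (D :* Q)) :- u :* (H :* f :* (:1 :+ f :* f :* B))
          := :1 :* (T :* (Q :* D) :- H :* (e :+ e :* e :* e :* B′)) :+ (D :* Q) :* (u :* X :- T)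
             :+ (:- (H :* (:1 :+ (e :* e :+ e :* u :* f :+ u :* f :* u :* f) :* B′))) :* (u :* f :- e)
             :+ (H :* u :* f :* f :* f) :* (u :* u :* B′ :- B)) refl (1# - q) (∑ (suc N) x) (∏ m D) (q ^ m) (∏ m H) (qi n) e B B′ (total q (suc N) t₀₀)))
        where
        X-eq : (1# - q) * ∑ (suc N) x ≈ total q (suc N) t₀₀
        X-eq = trans (∑-distribˡ (suc N) _ _) (∑-cong (suc N) λ k l → trans (x-τ k (ℕ.≤-pred l)) (*-congˡ (τ≈t₀₀ k (ℕ.≤-pred l))))

-- Coprimality and cyclotomic factors

module Comaximality {c ℓ} (R : CommutativeRing c ℓ) where
  open CommutativeRing R
  open ℤSolver R
  open Units R

  Comaximal : Carrier → Carrier → Set _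
  Comaximal a b = Σ Carrier λ s → Σ Carrier λ t → s * a + t * b ≈ 1#

  infix 4 _∣ᴿ_
  _∣ᴿ_ : Carrier → Carrier → Set _
  a ∣ᴿ x = Σ Carrier λ w → x ≈ a * w

  ∣ᴿ-trans : ∀ {a b x} → a ∣ᴿ b → b ∣ᴿ x → a ∣ᴿ x
  ∣ᴿ-trans (w , h) (v , k) = w * v , trans k (trans (*-congʳ h) (*-assoc _ _ _))

  comaximal-sym : ∀ {a b} → Comaximal a b → Comaximal b a
  comaximal-sym (s , t , h) = t , s , trans (+-comm _ _) h

  comaximal-resp : ∀ {a a′ b b′} → a ≈ a′ → b ≈ b′ → Comaximal a b → Comaximal a′ b′
  comaximal-resp e e′ (s , t , h) = s , t , trans (+-cong (*-congˡ (sym e)) (*-congˡ (sym e′))) h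

  comaximal-1 : ∀ {a} → Comaximal a 1#
  comaximal-1 {a} = 0# , 1# , solve 1 (λ a → :0 :* a :+ :1 :* :1 := :1) refl a

  comaximal-* : ∀ {a b c} → Comaximal a b → Comaximal a c → Comaximal a (b * c)
  comaximal-* {a} {b} {c} (s , t , h) (s′ , t′ , h′) = s * (s′ * a + t′ * c) + t * b * s′ , t * t′ ,
    combine₂ h h′ (solve 7 (λ a b c s t s′ t′ → ((s :* (s′ :* a :+ t′ :* c) :+ t :* b :* s′) :* a :+ t :* t′ :* (b :* c)) :- :1
      := (s′ :* a :+ t′ :* c) :* (s :* a :+ t :* b :- :1) :+ :1 :* (s′ :* a :+ t′ :* c :- :1)) refl a b c s t s′ t′)

  comaximal-∣ : ∀ {a b c} → Comaximal a b → c ∣ᴿ b → Comaximal a c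
  comaximal-∣ (s , t , h) (w , k) = s , t * w , combine₂ h k
    (solve 6 (λ a b c s t w → (s :* a :+ t :* w :* c) :- :1 := :1 :* (s :* a :+ t :* b :- :1) :+ (:- t) :* (b :- c :* w)) refl _ _ _ s t w)

  comaximal-product : ∀ {a b x} → Comaximal a b → a ∣ᴿ x → b ∣ᴿ x → a * b ∣ᴿ x
  comaximal-product {a} {b} {x} (s , t , h) (u , k) (v , k′) = s * v + t * u , combine₃ h k k′
    (solve 7 (λ a b x s t u v → x :- a :* b :* (s :* v :+ t :* u)
      := (:- x) :* (s :* a :+ t :* b :- :1) :+ (t :* b) :* (x :- a :* u) :+ (s :* a) :* (x :- b :* v)) refl a b x s t u v)

  product : List Carrier → Carrier
  product = foldr _*_ 1#

  comaximal-foldr : ∀ {A : Set} (f : A → Carrier) {a} ds → All (λ d → Comaximal a (f d)) ds → Comaximal a (product (map f ds))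
  comaximal-foldr f [] [] = comaximal-1
  comaximal-foldr f (d ∷ ds) (h ∷ hs) = comaximal-* h (comaximal-foldr f ds hs)

  product-∣ : ∀ {A : Set} (f : A → Carrier) {x} ds → AllPairs (λ d e → Comaximal (f d) (f e)) ds → All (λ d → f d ∣ᴿ x) ds →
    product (map f ds) ∣ᴿ x
  product-∣ f {x} [] [] [] = x , sym (*-identityˡ x)
  product-∣ f (d ∷ ds) (p ∷ ps) (h ∷ hs) = comaximal-product (comaximal-foldr f ds p) h (product-∣ f ds ps hs)

  ∈-product-∣ : ∀ {A : Set} (f : A → Carrier) {d} ds → d ∈ ds → f d ∣ᴿ product (map f ds)
  ∈-product-∣ f (d ∷ ds) (here ≡.refl) = _ , refl
  ∈-product-∣ f (d ∷ ds) (there l) = let w , h = ∈-product-∣ f ds l in f d * w ,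
    trans (*-congˡ h) (solve 3 (λ a b w → a :* (b :* w) := b :* (a :* w)) refl _ _ w)

record IsPower {c ℓ} (R : CommutativeRing c ℓ) (pw : ℕ → CommutativeRing.Carrier R) : Set ℓ where
  open CommutativeRing R
  field
    pw-0 : pw 0 ≈ 1#
    pw-+ : ∀ j k → pw (j ℕ.+ k) ≈ pw j * pw k

module Powers {c ℓ} (R : CommutativeRing c ℓ) (pw : ℕ → CommutativeRing.Carrier R) (isPower : IsPower R pw) where
  open CommutativeRing R
  open IsPower isPower
  open ℤSolver R
  open Units R
  open Comaximality R
  open MoreSums R using (nat)

  Q : ℕ → Carrier
  Q k = pw k - 1#

  Regular : Carrier → Set _
  Regular a = ∀ {x y} → a * x ≈ a * y → x ≈ y

  -- q^(kd) - 1 = (q^d - 1) C with C ≡ k modulo q^d - 1.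
  cofactor : ℕ → ℕ → Carrier
  cofactor d zero = 0#
  cofactor d (suc k) = 1# + pw d * cofactor d k

  Q-cofactor : ∀ d k → Q (k ℕ.* d) ≈ Q d * cofactor d k
  Q-cofactor d zero = combine₁ pw-0 (solve 2 (λ x y → (x :- :1) :- y :* :0 := :1 :* (x :- :1)) refl (pw 0) (Q d))
  Q-cofactor d (suc k) = combine₂ (pw-+ d (k ℕ.* d)) (Q-cofactor d k)
    (solve 4 (λ D K S C → (S :- :1) :- (D :- :1) :* (:1 :+ D :* C)
      := :1 :* (S :- D :* K) :+ D :* ((K :- :1) :- (D :- :1) :* C)) refl (pw d) (pw (k ℕ.* d)) _ (cofactor d k))

  Q-∣ : ∀ {d n} → d ∣ n → Q d ∣ᴿ Q n
  Q-∣ {d} (divides k ≡.refl) = cofactor d k , Q-cofactor d k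

  cofactor-nat : ∀ d k → Σ Carrier λ y → cofactor d k ≈ nat k + Q d * y
  cofactor-nat d zero = 0# , solve 1 (λ D → :0 := :0 :+ D :* :0) refl (Q d)
  cofactor-nat d (suc k) = let y , h = cofactor-nat d k in cofactor d k + y , combine₁ h
    (solve 4 (λ D C n y → (:1 :+ D :* C) :- ((n :+ :1) :+ (D :- :1) :* (C :+ y)) := :1 :* (C :- (n :+ (D :- :1) :* y))) refl (pw d) (cofactor d k) (nat k) y)

  -- If g + yn = xm, then q^g - 1 = (q^(xm) - 1) - q^g (q^(yn) - 1).
  Q-gcd : ∀ m n → Σ Carrier λ a → Σ Carrier λ b → Q (gcd m n) ≈ a * Q m + b * Q n
  Q-gcd m n = from (Bézout.identity (gcd-GCD m n))
    where
    g = gcd m n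
    core : ∀ {m n} x y → g ℕ.+ y ℕ.* n ≡ x ℕ.* m → Σ Carrier λ a → Σ Carrier λ b → Q g ≈ a * Q m + b * Q n
    core {m} {n} x y e = cofactor m x , - (cofactor n y * pw g) ,
      combine₃ (trans (sym (pw-+ g (y ℕ.* n))) (reflexive (≡.cong pw e))) (Q-cofactor m x) (Q-cofactor n y)
      (solve 7 (λ G Y X M N c d → (G :- :1) :- (c :* (M :- :1) :+ (:- (d :* G)) :* (N :- :1))
        := :1 :* (G :* Y :- X) :+ :1 :* ((X :- :1) :- (M :- :1) :* c)
           :+ (:- G) :* ((Y :- :1) :- (N :- :1) :* d)) refl (pw g) (pw (y ℕ.* n)) (pw (x ℕ.* m)) (pw m) (pw n) (cofactor m x) (cofactor n y))
    from : Bézout.Identity.Identity g m n → _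
    from (Bézout.Identity.+- x y e) = core x y e
    from (Bézout.Identity.-+ x y e) = let a , b , h = core {n} {m} y x e in b , a , trans h (+-comm _ _)

properDivisors : ℕ → List ℕ
properDivisors n = filter (_∣? n) (map suc (upTo (n ℕ.∸ 1)))

∈-properDivisors : ∀ {n d} → d ∈ properDivisors n → 1 ≤ d × d < n × d ∣ n
∈-properDivisors {n} l with ∈.∈-filter⁻ (_∣? n) {xs = map suc (upTo (n ℕ.∸ 1))} l
... | l′ , d∣n with ∈.∈-map⁻ suc l′
...   | k , k∈ , ≡.refl = z<s , ℕ.≤-trans (s≤s (∈.∈-upTo⁻ k∈)) (suc-∸ (∈.∈-upTo⁻ k∈)) , d∣n
  where
  suc-∸ : ∀ {n k} → k < n ℕ.∸ 1 → suc (n ℕ.∸ 1) ≤ n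
  suc-∸ {suc n} _ = ℕ.≤-refl

properDivisors-∈ : ∀ {n d} → 1 ≤ d → d < n → d ∣ n → d ∈ properDivisors n
properDivisors-∈ {suc n} {suc k} _ (s≤s l) d∣n = ∈.∈-filter⁺ (_∣? suc n) (∈.∈-map⁺ suc (∈.∈-upTo⁺ l)) d∣n

properDivisors-unique : ∀ n → AllPairs _≢_ (properDivisors n)
properDivisors-unique n = Unique.filter⁺ (_∣? n) (Unique.map⁺ ℕ.suc-injective (Unique.upTo⁺ (n ℕ.∸ 1)))

module Cyclotomic {c ℓ} (R : CommutativeRing c ℓ) (pw : ℕ → CommutativeRing.Carrier R) (isPower : IsPower R pw)
  (nat-unit : ∀ k → Units.Unit R (MoreSums.nat R (suc k)))
  (Q-regular : ∀ k → Powers.Regular R pw isPower (Powers.Q R pw isPower (suc k)))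
  (Ψ : ℕ → CommutativeRing.Carrier R) where
  open CommutativeRing R
  open Powers R pw isPower
  open Units R
  open MoreSums R using (nat)
  open ℤSolver R
  open Comaximality R

  rest : ℕ → Carrier
  rest n = product (map Ψ (properDivisors n))

  -- The two properties go through one induction: coprimality at smaller indices is what makes
  -- `rest n` divide qⁿ - 1.
  Good : ℕ → Set _
  Good n = 1 ≤ n → (Q n ≈ Ψ n * rest n) × (∀ j → ¬ n ∣ j → Comaximal (Ψ n) (Q j))

  Ψ-∣ : ∀ {n} → Good n → 1 ≤ n → Ψ n ∣ᴿ Q n
  Ψ-∣ g l = _ , proj₁ (g l)

  pair : ∀ {d e} → Good d → Good e → 1 ≤ d → 1 ≤ e → d ≢ e → Comaximal (Ψ d) (Ψ e)
  pair {d} {e} gd ge ld le d≢e with ℕ.<-cmp d e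
  ... | tri< d<e _ _ = comaximal-sym (comaximal-∣ (proj₂ (ge le) d (λ e∣d → ℕ.<⇒≱ d<e (∣ℕ.∣⇒≤ {{ℕ.>-nonZero ld}} e∣d))) (Ψ-∣ gd ld))
  ... | tri≈ _ eq _ = contradiction eq d≢e
  ... | tri> _ _ e<d = comaximal-∣ (proj₂ (gd ld) e (λ d∣e → ℕ.<⇒≱ e<d (∣ℕ.∣⇒≤ {{ℕ.>-nonZero le}} d∣e))) (Ψ-∣ ge le)

  pairs : ∀ ds → All (λ d → 1 ≤ d × Good d) ds → AllPairs _≢_ ds → AllPairs (λ d e → Comaximal (Ψ d) (Ψ e)) ds
  pairs [] _ _ = []
  pairs (d ∷ ds) ((l , g) ∷ gs) (u ∷ us) =
    All.zipWith (λ ((l′ , g′) , n) → pair g g′ l l′ n) (gs , u) ∷ pairs ds gs us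

  module _ (n : ℕ) (1≤n : 1 ≤ n) (ih : ∀ d → d < n → Good d) where

    rest-∣-Q : rest n ∣ᴿ Q n
    rest-∣-Q = product-∣ Ψ (properDivisors n)
      (pairs (properDivisors n) (All.tabulate λ d∈ → let l , d<n , _ = ∈-properDivisors {n} d∈ in l , ih _ d<n) (properDivisors-unique n))
      (All.tabulate λ d∈ → let l , d<n , d∣n = ∈-properDivisors {n} d∈ in ∣ᴿ-trans (Ψ-∣ (ih _ d<n) l) (Q-∣ d∣n))

    -- q^g - 1 is the product of Ψ d over all divisors d of g, including g itself. These are proper
    -- divisors of n and their Ψ d are pairwise comaximal, so the product divides whatever each of
    -- them divides.
    Q-∣-rest : ∀ g → 1 ≤ g → g < n → g ∣ n → Q g ∣ᴿ rest n
    Q-∣-rest g 1≤g g<n g∣n = let w , h = divides-rest in w , trans h (*-congʳ (sym (proj₁ (ih g g<n 1≤g))))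
      where
      divides-rest : Ψ g * rest g ∣ᴿ rest n
      divides-rest = product-∣ Ψ (g ∷ properDivisors g)
        (pairs (g ∷ properDivisors g)
          ((1≤g , ih g g<n) ∷ All.tabulate λ d∈ → let l , d<g , _ = ∈-properDivisors {g} d∈ in l , ih _ (ℕ.<-trans d<g g<n))
          (All.tabulate (λ d∈ e → ℕ.<-irrefl (≡.sym e) (proj₁ (proj₂ (∈-properDivisors {g} d∈)))) ∷ properDivisors-unique g))
        (∈-product-∣ Ψ (properDivisors n) (properDivisors-∈ 1≤g g<n g∣n)
          ∷ All.tabulate λ d∈ → let l , d<g , d∣g = ∈-properDivisors {g} d∈ in
              ∈-product-∣ Ψ (properDivisors n) (properDivisors-∈ l (ℕ.<-trans d<g g<n) (∣ℕ.∣-trans d∣g g∣n)))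

    -- Write qⁿ - 1 = (q^g - 1)C. As q^g - 1 divides `rest n`, cancelling it shows that Ψ n divides
    -- C. Modulo q^g - 1 the cofactor C is the number n/g, a unit.
    comaximal-Q-divisor : Q n ≈ Ψ n * rest n → ∀ g → 1 ≤ g → g < n → g ∣ n → Comaximal (Ψ n) (Q g)
    comaximal-Q-divisor eq (suc g) l g<n d@(divides (suc k) n≡) =
      let C = cofactor (suc g) (suc k)
          w , hw = Q-∣-rest (suc g) l g<n d
          y , hy = cofactor-nat (suc g) (suc k)
          i , hi = nat-unit k
          C-eq : C ≈ Ψ n * w
          C-eq = Q-regular g (trans (sym (Q-cofactor (suc g) (suc k))) (trans (reflexive (≡.cong Q (≡.sym n≡)))
            (combine₂ eq hw (solve 5 (λ q p r s w → q :- s :* (p :* w) := :1 :* (q :- p :* r) :+ p :* (r :- s :* w)) refl (Q n) (Ψ n) (rest n) (Q (suc g)) w))))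
      in i * w , - (i * y) , combine₃ C-eq hy hi
           (solve 7 (λ p w s C N i y → (i :* w :* p :+ (:- (i :* y)) :* s) :- :1
             := (:- i) :* (C :- p :* w) :+ i :* (C :- (N :+ s :* y)) :+ :1 :* (N :* i :- :1)) refl (Ψ n) w (Q (suc g)) C (nat (suc k)) i y)
    comaximal-Q-divisor eq (suc g) l g<n (divides zero n≡0) = contradiction (≡.subst (1 ≤_) n≡0 1≤n) λ ()

    -- For g = gcd(n, j), q^g - 1 is a combination of qⁿ - 1, a multiple of Ψ n, and of qʲ - 1. As n
    -- does not divide j, g is a proper divisor of n.
    comaximal-Q : Q n ≈ Ψ n * rest n → ∀ j → ¬ n ∣ j → Comaximal (Ψ n) (Q j)
    comaximal-Q eq j n∤j =
      let s , t , h = comaximal-Q-divisor eq g 1≤g g<n (gcd[m,n]∣m n j)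
          a , b , h′ = Q-gcd n j
      in s + t * a * rest n , t * b , combine₃ h h′ eq
           (solve 9 (λ p r q J G s t a b → ((s :+ t :* a :* r) :* p :+ t :* b :* J) :- :1
             := :1 :* (s :* p :+ t :* G :- :1) :+ (:- t) :* (G :- (a :* q :+ b :* J)) :+ (:- (t :* a)) :* (q :- p :* r))
             refl (Ψ n) (rest n) (Q n) (Q j) (Q g) s t a b)
      where
      g = gcd n j
      instance
        n≢0 : NonZero n
        n≢0 = ℕ.>-nonZero 1≤n
      g<n : g < n
      g<n = ℕ.≤∧≢⇒< (∣ℕ.∣⇒≤ (gcd[m,n]∣m n j)) λ g≡n → n∤j (≡.subst (_∣ j) g≡n (gcd[m,n]∣n n j))
      1≤g : 1 ≤ g
      1≤g with g in eq′
      ... | suc _ = z<s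
      ... | zero = contradiction (∣ℕ.0∣⇒≡0 (≡.subst (_∣ n) eq′ (gcd[m,n]∣m n j))) (ℕ.≢-nonZero⁻¹ n)

open import Defs

-- Polynomials over ℚ

module ℚS = ℤSolver ℚ.+-*-commutativeRing

infixl 8 _at_
_at_ : Poly → ℕ → ℚ
[] at i = 0ℚ
(x ∷ p) at zero = x
(x ∷ p) at suc i = p at i

infix 4 _≐_
_≐_ : Poly → Poly → Set
p ≐ r = ∀ i → p at i ≡ r at i

at-+ : ∀ p r i → (p +P r) at i ≡ p at i ℚ.+ r at i
at-+ [] r i = ≡.sym (ℚ.+-identityˡ _)
at-+ (x ∷ p) [] i = ≡.sym (ℚ.+-identityʳ _)
at-+ (x ∷ p) (y ∷ r) zero = ≡.refl
at-+ (x ∷ p) (y ∷ r) (suc i) = at-+ p r i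

at-neg : ∀ p i → negP p at i ≡ ℚ.- (p at i)
at-neg [] i = ≡.refl
at-neg (x ∷ p) zero = ≡.refl
at-neg (x ∷ p) (suc i) = at-neg p i

at-scale : ∀ c p i → scaleP c p at i ≡ c ℚ.* p at i
at-scale c [] i = ≡.sym (ℚ.*-zeroʳ c)
at-scale c (x ∷ p) zero = ≡.refl
at-scale c (x ∷ p) (suc i) = at-scale c p i

at-0∷ : ∀ p r → p ≐ r → (0ℚ ∷ p) ≐ (0ℚ ∷ r)
at-0∷ p r h zero = ≡.refl
at-0∷ p r h (suc i) = h i

at-zero : ∀ p → (∀ i → p at i ≡ 0ℚ) → IsZeroP p
at-zero [] h = []
at-zero (x ∷ p) h = h 0 ∷ at-zero p (λ i → h (suc i))

≐⇒≈ : ∀ {p r} → p ≐ r → p ≈P r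
≐⇒≈ {p} {r} h = at-zero (p -P r) λ i → ≡.trans (at-+ p (negP r) i)
  (≡.trans (≡.cong₂ ℚ._+_ (h i) (at-neg r i)) (ℚ.+-inverseʳ (r at i)))

*-at-zero : ∀ x p r → ((x ∷ p) *P r) at 0 ≡ x ℚ.* r at 0
*-at-zero x p r = ≡.trans (at-+ (scaleP x r) _ 0) (≡.trans (ℚ.+-identityʳ _) (at-scale x r 0))

*-at-suc : ∀ x p r i → ((x ∷ p) *P r) at suc i ≡ x ℚ.* r at suc i ℚ.+ (p *P r) at i
*-at-suc x p r i = ≡.trans (at-+ (scaleP x r) _ (suc i)) (≡.cong (ℚ._+ (p *P r) at i) (at-scale x r (suc i)))

*-congˡ-at : ∀ p {r s} → r ≐ s → (p *P r) ≐ (p *P s)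
*-congˡ-at [] h i = ≡.refl
*-congˡ-at (x ∷ p) {r} {s} h zero = ≡.trans (*-at-zero x p r) (≡.trans (≡.cong (x ℚ.*_) (h 0)) (≡.sym (*-at-zero x p s)))
*-congˡ-at (x ∷ p) {r} {s} h (suc i) = ≡.trans (*-at-suc x p r i)
  (≡.trans (≡.cong₂ ℚ._+_ (≡.cong (x ℚ.*_) (h (suc i))) (*-congˡ-at p h i)) (≡.sym (*-at-suc x p s i)))

*-∷-at : ∀ p x r → (p *P (x ∷ r)) ≐ (scaleP x p +P (0ℚ ∷ (p *P r)))
*-∷-at [] x r zero = ≡.refl
*-∷-at [] x r (suc i) = ≡.refl
*-∷-at (y ∷ p) x r zero = ≡.trans (*-at-zero y p (x ∷ r)) (≡.trans (ℚ.*-comm y x) (≡.sym (ℚ.+-identityʳ _)))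
*-∷-at (y ∷ p) x r (suc i) = ≡.trans (*-at-suc y p (x ∷ r) i)
  (≡.trans (≡.cong (y ℚ.* r at i ℚ.+_) (≡.trans (*-∷-at p x r i) (≡.trans (at-+ (scaleP x p) _ i) (≡.cong (ℚ._+ (0ℚ ∷ p *P r) at i) (at-scale x p i)))))
  (≡.trans (ℚS.solve 3 (λ a b c → a ℚS.:+ (b ℚS.:+ c) ℚS.:= b ℚS.:+ (a ℚS.:+ c)) ≡.refl (y ℚ.* r at i) (x ℚ.* p at i) ((0ℚ ∷ (p *P r)) at i))
  (≡.sym (≡.trans (at-+ (scaleP x p) _ i) (≡.cong₂ ℚ._+_ (at-scale x p i) (lemma i))))))
  where
  lemma : ∀ i → ((y ∷ p) *P r) at i ≡ y ℚ.* r at i ℚ.+ (0ℚ ∷ (p *P r)) at i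
  lemma i = ≡.trans (at-+ (scaleP y r) _ i) (≡.cong (ℚ._+ (0ℚ ∷ (p *P r)) at i) (at-scale y r i))

*-[]-at : ∀ p → (p *P []) ≐ []
*-[]-at [] i = ≡.refl
*-[]-at (x ∷ p) zero = ≡.refl
*-[]-at (x ∷ p) (suc i) = *-[]-at p i

*-comm-at : ∀ p r → (p *P r) ≐ (r *P p)
*-comm-at [] r i = ≡.sym (*-[]-at r i)
*-comm-at (x ∷ p) r i = ≡.trans (at-+ (scaleP x r) _ i)
  (≡.trans (≡.cong (scaleP x r at i ℚ.+_) (at-0∷ _ _ (*-comm-at p r) i))
  (≡.sym (≡.trans (*-∷-at r x p i) (at-+ (scaleP x r) _ i))))

*-distribˡ-at : ∀ p r s → (p *P (r +P s)) ≐ (p *P r +P p *P s)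
*-distribˡ-at [] r s i = ≡.refl
*-distribˡ-at (x ∷ p) r s zero = ≡.trans (*-at-zero x p (r +P s)) (≡.trans (≡.cong (x ℚ.*_) (at-+ r s 0))
  (≡.trans (ℚ.*-distribˡ-+ x _ _) (≡.sym (≡.trans (at-+ ((x ∷ p) *P r) _ 0) (≡.cong₂ ℚ._+_ (*-at-zero x p r) (*-at-zero x p s))))))
*-distribˡ-at (x ∷ p) r s (suc i) = ≡.trans (*-at-suc x p (r +P s) i)
  (≡.trans (≡.cong₂ ℚ._+_ (≡.cong (x ℚ.*_) (at-+ r s (suc i))) (≡.trans (*-distribˡ-at p r s i) (at-+ (p *P r) _ i)))
  (≡.trans (ℚS.solve 5 (λ x a b c d → x ℚS.:* (a ℚS.:+ b) ℚS.:+ (c ℚS.:+ d) ℚS.:= (x ℚS.:* a ℚS.:+ c) ℚS.:+ (x ℚS.:* b ℚS.:+ d)) ≡.refl x _ _ _ _)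
  (≡.sym (≡.trans (at-+ ((x ∷ p) *P r) _ (suc i)) (≡.cong₂ ℚ._+_ (*-at-suc x p r i) (*-at-suc x p s i))))))

*-distribʳ-at : ∀ p r s → ((r +P s) *P p) ≐ (r *P p +P s *P p)
*-distribʳ-at p r s i = ≡.trans (*-comm-at (r +P s) p i) (≡.trans (*-distribˡ-at p r s i)
  (≡.trans (at-+ (p *P r) _ i) (≡.trans (≡.cong₂ ℚ._+_ (*-comm-at p r i) (*-comm-at p s i)) (≡.sym (at-+ (r *P p) _ i)))))

scale-*-at : ∀ x p r → (scaleP x p *P r) ≐ scaleP x (p *P r)
scale-*-at x [] r i = ≡.refl
scale-*-at x (y ∷ p) r zero = ≡.trans (*-at-zero (x ℚ.* y) (scaleP x p) r) (≡.trans (ℚ.*-assoc x y _)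
  (≡.sym (≡.trans (at-scale x ((y ∷ p) *P r) 0) (≡.cong (x ℚ.*_) (*-at-zero y p r)))))
scale-*-at x (y ∷ p) r (suc i) = ≡.trans (*-at-suc (x ℚ.* y) (scaleP x p) r i)
  (≡.trans (≡.cong₂ ℚ._+_ (ℚ.*-assoc x y _) (≡.trans (scale-*-at x p r i) (at-scale x (p *P r) i)))
  (≡.trans (≡.sym (ℚ.*-distribˡ-+ x _ _))
  (≡.sym (≡.trans (at-scale x ((y ∷ p) *P r) (suc i)) (≡.cong (x ℚ.*_) (*-at-suc y p r i))))))

0∷-*-at : ∀ p r → ((0ℚ ∷ p) *P r) ≐ (0ℚ ∷ (p *P r))
0∷-*-at p r i = ≡.trans (at-+ (scaleP 0ℚ r) _ i) (≡.trans (≡.cong (ℚ._+ (0ℚ ∷ (p *P r)) at i) (≡.trans (at-scale 0ℚ r i) (ℚ.*-zeroˡ (r at i)))) (ℚ.+-identityˡ _))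

*-assoc-at : ∀ p r s → ((p *P r) *P s) ≐ (p *P (r *P s))
*-assoc-at [] r s i = ≡.refl
*-assoc-at (x ∷ p) r s i = ≡.trans (*-distribʳ-at s (scaleP x r) (0ℚ ∷ (p *P r)) i)
  (≡.trans (at-+ (scaleP x r *P s) _ i)
  (≡.trans (≡.cong₂ ℚ._+_ (scale-*-at x r s i) (≡.trans (0∷-*-at (p *P r) s i) (at-0∷ _ _ (*-assoc-at p r s) i)))
  (≡.sym (at-+ (scaleP x (r *P s)) _ i))))

*-identityˡ-at : ∀ p → (oneP *P p) ≐ p
*-identityˡ-at p i = ≡.trans (at-+ (scaleP 1ℚ p) (0ℚ ∷ []) i)
  (≡.trans (≡.cong₂ ℚ._+_ (≡.trans (at-scale 1ℚ p i) (ℚ.*-identityˡ (p at i))) (zero0 i)) (ℚ.+-identityʳ (p at i)))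
  where
  zero0 : ∀ i → (0ℚ ∷ []) at i ≡ 0ℚ
  zero0 zero = ≡.refl
  zero0 (suc i) = ≡.refl

-- Coefficientwise equality, packaged as a record so that both sides can be inferred from a proof.
infix 4 _≃_
record _≃_ (p r : Poly) : Set where
  constructor ≐⇒≃
  field at≡ : p ≐ r
open _≃_ public

≃⇒≈P : ∀ {p r} → p ≃ r → p ≈P r
≃⇒≈P {p} h = ≐⇒≈ {p} (at≡ h)

polyRing : CommutativeRing 0ℓ 0ℓ
polyRing = record
  { Carrier = Poly ; _≈_ = _≃_ ; _+_ = _+P_ ; _*_ = _*P_ ; -_ = negP ; 0# = [] ; 1# = oneP
  ; isCommutativeRing = record
    { isRing = record
      { +-isAbelianGroup = record
        { isGroup = record
          { isMonoid = record
            { isSemigroup = record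
              { isMagma = record
                { isEquivalence = record
                  { refl = λ {p} → ≐⇒≃ λ i → ≡.refl
                  ; sym = λ {p} {r} h → ≐⇒≃ λ i → ≡.sym (at≡ h i)
                  ; trans = λ {p} {r} {s} h h′ → ≐⇒≃ λ i → ≡.trans (at≡ h i) (at≡ h′ i)
                  }
                ; ∙-cong = λ {p} {p′} {r} {r′} h h′ → ≐⇒≃ λ i →
                    ≡.trans (at-+ p r i) (≡.trans (≡.cong₂ ℚ._+_ (at≡ h i) (at≡ h′ i)) (≡.sym (at-+ p′ r′ i)))
                }
              ; assoc = λ p r s → ≐⇒≃ λ i → ≡.trans (at-+ (p +P r) s i) (≡.trans (≡.cong (ℚ._+ s at i) (at-+ p r i))
                  (≡.trans (ℚ.+-assoc (p at i) (r at i) (s at i)) (≡.sym (≡.trans (at-+ p (r +P s) i) (≡.cong (p at i ℚ.+_) (at-+ r s i))))))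
              }
            ; identity = (λ p → ≐⇒≃ λ i → ≡.refl) , (λ p → ≐⇒≃ λ i → ≡.trans (at-+ p [] i) (ℚ.+-identityʳ (p at i)))
            }
          ; inverse = (λ p → ≐⇒≃ λ i → ≡.trans (at-+ (negP p) p i) (≡.trans (≡.cong (ℚ._+ p at i) (at-neg p i)) (ℚ.+-inverseˡ (p at i))))
                    , (λ p → ≐⇒≃ λ i → ≡.trans (at-+ p (negP p) i) (≡.trans (≡.cong (p at i ℚ.+_) (at-neg p i)) (ℚ.+-inverseʳ (p at i))))
          ; ⁻¹-cong = λ {p} {r} h → ≐⇒≃ λ i → ≡.trans (at-neg p i) (≡.trans (≡.cong ℚ.-_ (at≡ h i)) (≡.sym (at-neg r i)))
          }
        ; comm = λ p r → ≐⇒≃ λ i → ≡.trans (at-+ p r i) (≡.trans (ℚ.+-comm (p at i) (r at i)) (≡.sym (at-+ r p i)))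
        }
      ; *-cong = λ {p} {p′} {r} {r′} h h′ → ≐⇒≃ λ i → ≡.trans (*-congˡ-at p (at≡ h′) i)
          (≡.trans (*-comm-at p r′ i) (≡.trans (*-congˡ-at r′ (at≡ h) i) (*-comm-at r′ p′ i)))
      ; *-assoc = λ p r s → ≐⇒≃ (*-assoc-at p r s)
      ; *-identity = (λ p → ≐⇒≃ (*-identityˡ-at p)) , (λ p → ≐⇒≃ λ i → ≡.trans (*-comm-at p oneP i) (*-identityˡ-at p i))
      ; distrib = (λ p r s → ≐⇒≃ (*-distribˡ-at p r s)) , (λ p r s → ≐⇒≃ (*-distribʳ-at p r s))
      }
    ; *-comm = λ p r → ≐⇒≃ (*-comm-at p r)
    }
  }

-- The functions divHL, subPrefix and cyc behind divMonic and Φ are private. They are recovered here as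
-- solutions of unification problems: with all arguments abstracted to variables, a goal that mentions
-- divHL f ps ms forces the metavariable in the definition of divide to be divHL. The type Captured
-- is inhabited trivially and serves only to state such goals.
data Captured (p : Poly) : Set where
  captured : Captured p

mutual
  divide : ℕ → List ℚ → List ℚ → List ℚ
  divide = _

  subtract : List ℚ → List ℚ → List ℚ
  subtract = _

  capture-divide : ∀ p m → Captured (divMonic p m)
  capture-divide p m with reverse m
  ... | [] = captured
  ... | y ∷ ys with y ℚ.≟ 0ℚ
  ...   | yes _ = captured
  ...   | no _ with reverse (reverse (y ∷ ys))
  ...     | [] = captured
  ...     | c ∷ ms with reverse p
  ...       | [] = captured
  ...       | x ∷ xs with x ℚ.≟ 0ℚ
  ...         | yes _ = captured
  ...         | no _ with reverse (reverse (x ∷ xs)) | length p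
  -- With `reverse` itself replaced by a variable, unification has to compare the arguments under a
  -- rigid head.
  ...           | ps | f with reverse {A = ℚ}
  ...             | r = divide-captured r f ps ms

  divide-captured : ∀ (r : List ℚ → List ℚ) f ps ms → Captured (r (divide f ps ms))
  divide-captured _ _ _ _ = captured

  capture-subtract : ∀ f c ps ms → Captured (divide (suc f) (c ∷ ps) ms)
  capture-subtract f c ps ms with length ms ≤? length ps
  ... | no _ = captured
  ... | yes _ with map (c ℚ.*_) ms
  ...   | ns = subtract-captured f c ps ns ms

  subtract-captured : ∀ f c ps ns ms → Captured (c ∷ divide f (subtract ps ns) ms)
  subtract-captured _ _ _ _ _ = captured

mutual
  cyclo : ℕ → ℕ → Poly
  cyclo = _

  capture-cyclo : ∀ n → Φ (suc n) ≡ divMonic (qpow (suc n) -P oneP) (foldr _*P_ oneP (map (cyclo n) (filter (_∣? suc n) (map suc (upTo n)))))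
  capture-cyclo n = ≡.refl

open CommutativeRing polyRing hiding (_≈_) renaming (refl to ≃-refl; sym to ≃-sym; trans to ≃-trans; reflexive to ≃-reflexive)
open Units polyRing
open Comaximality polyRing
open MoreSums polyRing using (nat)
module P = ℤSolver polyRing
open P using (solve; _:=_; _:+_; _:*_; _:-_; :-_; :1; :0)
open Data.Nat.Solver.+-*-Solver using () renaming (solve to solveℕ; _:+_ to _:+ℕ_; _:*_ to _:*ℕ_; _:=_ to _:=ℕ_; con to conℕ)
open import Relation.Binary.Reasoning.Setoid setoid

0∷-cong : ∀ {p r} → p ≃ r → (0ℚ ∷ p) ≃ (0ℚ ∷ r)
0∷-cong h = ≐⇒≃ (at-0∷ _ _ (at≡ h))

0∷-* : ∀ p r → (0ℚ ∷ p) *P r ≃ (0ℚ ∷ (p *P r))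
0∷-* p r = ≐⇒≃ (0∷-*-at p r)

const-* : ∀ c p → constP c *P p ≃ scaleP c p
const-* c p = ≐⇒≃ λ i → ≡.trans (at-+ (scaleP c p) (0ℚ ∷ []) i) (≡.trans (≡.cong (scaleP c p at i ℚ.+_) (zero0 i)) (ℚ.+-identityʳ _))
  where
  zero0 : ∀ i → (0ℚ ∷ []) at i ≡ 0ℚ
  zero0 zero = ≡.refl
  zero0 (suc i) = ≡.refl

qpow-+ : ∀ j k → qpow j *P qpow k ≃ qpow (j ℕ.+ k)
qpow-+ zero k = *-identityˡ (qpow k)
qpow-+ (suc j) k = ≃-trans (0∷-* (qpow j) (qpow k)) (0∷-cong (qpow-+ j k))

at-beyond : ∀ p {i} → length p ≤ i → p at i ≡ 0ℚ
at-beyond [] _ = ≡.refl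
at-beyond (x ∷ p) (s≤s l) = at-beyond p l

∷ʳ-+ : ∀ p c → (p ∷ʳ c) ≃ p +P constP c *P qpow (length p)
∷ʳ-+ p c = ≃-trans (≐⇒≃ (lemma p)) (+-congˡ {p} (≃-sym (const-* c (qpow (length p)))))
  where
  lemma : ∀ p → (p ∷ʳ c) ≐ (p +P scaleP c (qpow (length p)))
  lemma [] zero = ≡.sym (ℚ.*-identityʳ c)
  lemma [] (suc i) = ≡.refl
  lemma (x ∷ p) zero = ≡.sym (≡.trans (≡.cong (x ℚ.+_) (ℚ.*-zeroʳ c)) (ℚ.+-identityʳ x))
  lemma (x ∷ p) (suc i) = lemma p i

reverse-∷ : ∀ c p → reverse (c ∷ p) ≃ reverse p +P constP c *P qpow (length p)
reverse-∷ c p = ≃-trans (≃-reflexive (List.unfold-reverse c p))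
  (≃-trans (∷ʳ-+ (reverse p) c) (≃-reflexive (≡.cong (λ k → reverse p +P constP c *P qpow k) (List.length-reverse p))))

-- Long division by a monic polynomial

subtract-[] : ∀ ps → subtract ps [] ≡ ps
subtract-[] [] = ≡.refl
subtract-[] (x ∷ ps) = ≡.refl

length-subtract : ∀ ps ns → length (subtract ps ns) ≡ length ps
length-subtract [] ns = ≡.refl
length-subtract (x ∷ ps) [] = ≡.refl
length-subtract (x ∷ ps) (c ∷ ns) = ≡.cong suc (length-subtract ps ns)

reverse-subtract : ∀ ps ns → length ns ≤ length ps →
  reverse (subtract ps ns) ≃ reverse ps -P qpow (length ps ∸ length ns) *P reverse ns
reverse-subtract ps [] _ = ≃-trans (≃-reflexive (≡.cong reverse (subtract-[] ps)))
  (solve 2 (λ a b → a := a :- b :* :0) ≃-refl (reverse ps) (qpow (length ps)))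
reverse-subtract (x ∷ ps) (c ∷ ns) (s≤s l) = begin
  reverse ((x ℚ.- c) ∷ subtract ps ns) ≈⟨ reverse-∷ (x ℚ.- c) (subtract ps ns) ⟩
  reverse (subtract ps ns) +P constP (x ℚ.- c) *P qpow (length (subtract ps ns))
    ≈⟨ +-cong (reverse-subtract ps ns l) (≃-reflexive (≡.cong (λ k → constP (x ℚ.- c) *P qpow k) (length-subtract ps ns))) ⟩
  (reverse ps -P Q *P reverse ns) +P constP (x ℚ.- c) *P qpow (length ps)
    ≈⟨ combine₁ {c = constP c} Q-eq (solve 7 (λ ps ns Q X C R S → ((ps :- Q :* ns) :+ (X :- C) :* R) :- ((ps :+ X :* R) :- Q :* (ns :+ C :* S))
         := C :* (Q :* S :- R)) ≃-refl (reverse ps) (reverse ns) Q (constP x) (constP c) (qpow (length ps)) (qpow (length ns))) ⟩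
  (reverse ps +P constP x *P qpow (length ps)) -P Q *P (reverse ns +P constP c *P qpow (length ns))
    ≈⟨ +-cong (reverse-∷ x ps) (-‿cong (*-congˡ {Q} (reverse-∷ c ns))) ⟨
  reverse (x ∷ ps) -P Q *P reverse (c ∷ ns) ∎
  where
  Q = qpow (length ps ∸ length ns)
  Q-eq : Q *P qpow (length ns) ≃ qpow (length ps)
  Q-eq = ≃-trans (qpow-+ (length ps ∸ length ns) (length ns)) (≃-reflexive (≡.cong qpow (ℕ.m∸n+n≡m l)))

reverse-scale : ∀ c ms → reverse (map (c ℚ.*_) ms) ≃ constP c *P reverse ms
reverse-scale c ms = ≃-trans (≃-reflexive (≡.sym (List.reverse-map (c ℚ.*_) ms))) (≃-sym (const-* c (reverse ms)))

divide-∷ : ∀ f c ps ms → length ms ≤ length ps →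
  divide (suc f) (c ∷ ps) ms ≡ c ∷ divide f (subtract ps (map (c ℚ.*_) ms)) ms
divide-∷ f c ps ms l with length ms ≤? length ps
... | yes _ = ≡.refl
... | no ¬l = contradiction l ¬l

divide-short : ∀ f c ps ms → length ps < length ms → divide (suc f) (c ∷ ps) ms ≡ []
divide-short f c ps ms l with length ms ≤? length ps
... | yes l′ = contradiction l′ (ℕ.<⇒≱ l)
... | no _ = ≡.refl

Below : ℕ → Poly → Set
Below d p = ∀ i → d ≤ i → p at i ≡ 0ℚ

-- Lists have the highest coefficient first, and the leading 1 of the divisor is left out of ms, so
-- that `length ms` is its degree. One step subtracts c qᵏ times the divisor with k = length ps -
-- length ms.
division : ∀ ms f ps → length ps ≤ f → length (divide f ps ms) ≡ length ps ∸ length ms ×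
  Σ Poly λ r → Below (length ms) r × reverse ps ≃ reverse (divide f ps ms) *P reverse (1ℚ ∷ ms) +P r
division ms zero [] _ = ≡.sym (ℕ.0∸n≡0 (length ms)) , [] , (λ _ _ → ≡.refl) , ≃-refl
division ms (suc f) [] _ = ≡.sym (ℕ.0∸n≡0 (length ms)) , [] , (λ _ _ → ≡.refl) , ≃-refl
division ms (suc f) (c ∷ ps) (s≤s l) with ℕ.≤-<-connex (length ms) (length ps)
... | inj₂ short rewrite divide-short f c ps ms short =
      ≡.sym (ℕ.m≤n⇒m∸n≡0 short) , reverse (c ∷ ps)
      , (λ i h → at-beyond (reverse (c ∷ ps)) (≡.subst (_≤ i) (≡.sym (List.length-reverse (c ∷ ps))) (ℕ.≤-trans short h)))
      , ≃-refl
... | inj₁ long rewrite divide-∷ f c ps ms long =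
      ≡.trans (≡.cong suc len) (≡.sym (ℕ.+-∸-assoc 1 long)) , r , below , (begin
        reverse (c ∷ ps) ≈⟨ reverse-∷ c ps ⟩
        reverse ps +P C *P qpow (length ps)
          ≈⟨ combine₃ {c = oneP} {c′ = negP C} {c″ = negP (C *P Q)} ih′ Q-eq (reverse-∷ 1ℚ ms) (solve 9 (λ p C R Q m D r S M → (p :+ C :* R) :- ((D :+ C :* Q) :* M :+ r)
                := :1 :* ((p :- Q :* (C :* m)) :- (D :* M :+ r)) :+ (:- C) :* (Q :* S :- R) :+ (:- (C :* Q)) :* (M :- (m :+ :1 :* S)))
              ≃-refl (reverse ps) C (qpow (length ps)) Q (reverse ms) (reverse D) r (qpow (length ms)) (reverse (1ℚ ∷ ms))) ⟩
        (reverse D +P C *P Q) *P reverse (1ℚ ∷ ms) +P r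
          ≈⟨ +-congʳ (*-congʳ {reverse (1ℚ ∷ ms)} (≃-trans (reverse-∷ c D) (≃-reflexive (≡.cong (λ k → reverse D +P C *P qpow k) len)))) ⟨
        reverse (c ∷ D) *P reverse (1ℚ ∷ ms) +P r ∎)
  where
  C = constP c
  ps′ = subtract ps (map (c ℚ.*_) ms)
  D = divide f ps′ ms
  Q = qpow (length ps ∸ length ms)
  ih = division ms f ps′ (ℕ.≤-trans (ℕ.≤-reflexive (length-subtract ps _)) l)
  len : length D ≡ length ps ∸ length ms
  len = ≡.trans (proj₁ ih) (≡.cong (_∸ length ms) (length-subtract ps _))
  r = proj₁ (proj₂ ih)
  below = proj₁ (proj₂ (proj₂ ih))
  Q-eq : Q *P qpow (length ms) ≃ qpow (length ps)
  Q-eq = ≃-trans (qpow-+ (length ps ∸ length ms) (length ms)) (≃-reflexive (≡.cong qpow (ℕ.m∸n+n≡m long)))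
  ih′ : reverse ps -P Q *P (C *P reverse ms) ≃ reverse D *P reverse (1ℚ ∷ ms) +P r
  ih′ = ≃-trans (≃-sym (≃-trans (reverse-subtract ps (map (c ℚ.*_) ms) (ℕ.≤-trans (ℕ.≤-reflexive (List.length-map _ ms)) long))
      (+-congˡ {reverse ps} (-‿cong (*-cong (≃-reflexive (≡.cong (λ k → qpow (length ps ∸ k)) (List.length-map _ ms))) (reverse-scale c ms))))))
    (proj₂ (proj₂ (proj₂ ih)))

-- The length is prescribed because coefficient lists may end in zeros; in the absence of these the
-- normalisation inside `divMonic` changes nothing.
Monic : ℕ → Poly → Set
Monic k p = length p ≡ suc k × p at k ≡ 1ℚ

at-top : ∀ {k} p → Monic k p → ∀ w j → Below (suc j) w → (p *P w) at (k ℕ.+ j) ≡ w at j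
at-top (x ∷ []) (≡.refl , ≡.refl) w j h = at≡ (*-identityˡ w) j
at-top (x ∷ y ∷ p) (≡.refl , h₁) w j h = ≡.trans (*-at-suc x (y ∷ p) w _)
  (≡.trans (≡.cong₂ ℚ._+_ (≡.trans (≡.cong (x ℚ.*_) (h _ (s≤s (ℕ.m≤n+m j (length p))))) (ℚ.*-zeroʳ x)) (at-top (y ∷ p) (≡.refl , h₁) w j h)) (ℚ.+-identityˡ _))

length-+ : ∀ p r → length p ≤ length r → length (p +P r) ≡ length r
length-+ [] r _ = ≡.refl
length-+ (x ∷ p) (y ∷ r) (s≤s l) = ≡.cong suc (length-+ p r l)

Monic-* : ∀ {j k} p r → Monic j p → Monic k r → Monic (j ℕ.+ k) (p *P r)
Monic-* {j} {k} p r (l , t) (l′ , t′) = length-* p l , ≡.trans (at-top p (l , t) r k λ i h → at-beyond r (≡.subst (_≤ i) (≡.sym l′) h)) t′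
  where
  length-* : ∀ {j} p → length p ≡ suc j → length (p *P r) ≡ suc (j ℕ.+ k)
  length-* (x ∷ []) ≡.refl = ≡.trans (+-short (map (x ℚ.*_) r) (≡.trans (List.length-map _ r) l′)) (≡.trans (List.length-map _ r) l′)
    where
    +-short : ∀ s → length s ≡ suc k → length (s +P (0ℚ ∷ [])) ≡ length s
    +-short (x ∷ []) _ = ≡.refl
    +-short (x ∷ y ∷ s) _ = ≡.refl
  length-* (x ∷ y ∷ p) ≡.refl = ≡.trans (length-+ (scaleP x r) _ (ℕ.≤-trans (ℕ.≤-reflexive (≡.trans (List.length-map _ r) l′))
      (ℕ.≤-trans (s≤s (ℕ.m≤n+m k (suc (length p)))) (ℕ.≤-reflexive (≡.cong suc (≡.sym (length-* (y ∷ p) ≡.refl)))))))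
      (≡.cong suc (length-* (y ∷ p) ≡.refl))

-- By `at-top` the top coefficient of w reappears in pw at a degree of at least k, where pw
-- vanishes; hence any bound on the degree of w can be lowered.
Monic-regular : ∀ {k} p → Monic k p → ∀ w → Below k (p *P w) → w ≃ []
Monic-regular {k} p m w h = ≐⇒≃ λ i → go (length w) (λ i → at-beyond w) i z≤n
  where
  go : ∀ l → Below l w → Below 0 w
  go zero b = b
  go (suc l) b = go l λ i l≤i → case i l≤i
    where
    case : ∀ i → l ≤ i → w at i ≡ 0ℚ
    case i l≤i with ℕ.m≤n⇒m<n∨m≡n l≤i
    ... | inj₁ l<i = b i l<i
    ... | inj₂ ≡.refl = ≡.trans (≡.sym (at-top p m w l b)) (h (k ℕ.+ l) (ℕ.m≤m+n k l))

∷ʳ-at : ∀ s x → (s ∷ʳ x) at length s ≡ x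
∷ʳ-at [] x = ≡.refl
∷ʳ-at (_ ∷ s) x = ∷ʳ-at s x

Monic-reverse : ∀ {k} p → Monic k p → Σ (List ℚ) λ ms → reverse p ≡ 1ℚ ∷ ms × length ms ≡ k
Monic-reverse {k} p (l , t) with reverse p in e
... | [] with ≡.trans (≡.sym (List.length-reverse p)) (≡.cong length e)
...   | l′ with ≡.trans (≡.sym l) l′
...     | ()
Monic-reverse {k} p (l , t) | x ∷ ms = ms , ≡.cong (_∷ ms) x≡1 , length-ms
  where
  p≡ : p ≡ reverse ms ∷ʳ x
  p≡ = ≡.trans (≡.sym (List.reverse-involutive p)) (≡.trans (≡.cong reverse e) (List.unfold-reverse x ms))
  length-ms : length ms ≡ k
  length-ms = ℕ.suc-injective (≡.trans (≡.trans (≡.cong length (≡.sym e)) (List.length-reverse p)) l)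
  x≡1 : x ≡ 1ℚ
  x≡1 = ≡.trans (≡.sym (∷ʳ-at (reverse ms) x)) (≡.trans (≡.cong₂ _at_ (≡.sym p≡) (≡.trans (List.length-reverse ms) length-ms)) t)

divMonic-divide : ∀ p m {ps ms} → reverse p ≡ 1ℚ ∷ ps → reverse m ≡ 1ℚ ∷ ms → divMonic p m ≡ reverse (divide (length p) (1ℚ ∷ ps) ms)
divMonic-divide p m {ps} {ms} e e′ with reverse m | e′
... | _ | ≡.refl with reverse (reverse (1ℚ ∷ ms)) | List.reverse-involutive (1ℚ ∷ ms)
...   | _ | ≡.refl with reverse p | e
...     | _ | ≡.refl with reverse (reverse (1ℚ ∷ ps)) | List.reverse-involutive (1ℚ ∷ ps)
...       | _ | ≡.refl = ≡.refl

-- If p = mw, the remainder m(w - quotient) has degree below that of m, so w - quotient = 0. The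
-- quotient is shown to be monic since the recursion for Φ divides by products of earlier quotients.
divMonic-exact : ∀ {j k} p m → Monic j p → Monic k m → (∃ λ w → p ≃ m *P w) →
  (p ≃ divMonic p m *P m) × Monic (j ∸ k) (divMonic p m)
divMonic-exact {j} {k} p m hp hm (w , h) with Monic-reverse p hp | Monic-reverse m hm
... | ps , e , lp | ms , e′ , lm = quot-m , monic
  where
  D = divide (length p) (1ℚ ∷ ps) ms
  rev-rev : ∀ {p ps} → reverse p ≡ 1ℚ ∷ ps → reverse (1ℚ ∷ ps) ≡ p
  rev-rev {p} e = ≡.trans (≡.cong reverse (≡.sym e)) (List.reverse-involutive p)
  lps : length (1ℚ ∷ ps) ≡ length p
  lps = ≡.trans (≡.cong length (≡.sym e)) (List.length-reverse p)
  dv = division ms (length p) (1ℚ ∷ ps) (ℕ.≤-reflexive lps)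
  r = proj₁ (proj₂ dv)
  eq : p ≃ divMonic p m *P m +P r
  eq = ≃-trans (≃-reflexive (≡.sym (rev-rev e))) (≃-trans (proj₂ (proj₂ (proj₂ dv)))
    (≃-reflexive (≡.cong₂ (λ a b → a *P b +P r) (≡.sym (divMonic-divide p m e e′)) (rev-rev e′))))
  r-eq : r ≃ m *P (w -P divMonic p m)
  r-eq = combine₂ {c = oneP} {c′ = oneP} (≃-sym eq) h (solve 5 (λ p m w d r → r :- m :* (w :- d) := :1 :* ((d :* m :+ r) :- p) :+ :1 :* (p :- m :* w)) ≃-refl p m w (divMonic p m) r)
  quot-0 : w -P divMonic p m ≃ []
  quot-0 = Monic-regular m hm _ λ i k≤i → ≡.trans (≡.sym (at≡ r-eq i)) (proj₁ (proj₂ (proj₂ dv)) i (≡.subst (_≤ i) (≡.sym lm) k≤i))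
  quot-m : p ≃ divMonic p m *P m
  quot-m = combine₃ {c = oneP} {c′ = oneP} {c″ = m} eq r-eq quot-0 (solve 5 (λ p m w d r → p :- d :* m := :1 :* (p :- (d :* m :+ r)) :+ :1 :* (r :- m :* (w :- d)) :+ m :* ((w :- d) :- :0)) ≃-refl p m w (divMonic p m) r)
  monic : Monic (j ∸ k) (divMonic p m)
  monic with ℕ.≤-<-connex (length ms) (length ps)
  ... | inj₁ l = ≡.subst (Monic (j ∸ k)) (≡.sym (divMonic-divide p m e e′))
        (≡.trans (List.length-reverse D) (≡.trans (proj₁ dv) (≡.trans (≡.cong₂ (λ a b → suc a ∸ b) lp lm) (ℕ.+-∸-assoc 1 (≡.subst₂ _≤_ lm lp l)))) , top)
    where
    D≡ : D ≡ 1ℚ ∷ divide (length ps) (subtract ps (map (1ℚ ℚ.*_) ms)) ms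
    D≡ = ≡.trans (≡.cong (λ f → divide f (1ℚ ∷ ps) ms) (≡.sym lps)) (divide-∷ (length ps) 1ℚ ps ms l)
    D′ = divide (length ps) (subtract ps (map (1ℚ ℚ.*_) ms)) ms
    len-D′ : j ∸ k ≡ length D′
    len-D′ = ≡.sym (ℕ.suc-injective (≡.trans (≡.cong length (≡.sym D≡))
      (≡.trans (proj₁ dv) (≡.trans (≡.cong₂ (λ a b → suc a ∸ b) lp lm) (ℕ.+-∸-assoc 1 (≡.subst₂ _≤_ lm lp l))))))
    top : reverse D at (j ∸ k) ≡ 1ℚ
    top = ≡.trans (≡.cong₂ (λ d i → reverse d at i) D≡ len-D′)
      (≡.trans (≡.cong (_at length D′) (List.unfold-reverse 1ℚ D′))
      (≡.trans (≡.cong ((reverse D′ ∷ʳ 1ℚ) at_) (≡.sym (List.length-reverse D′))) (∷ʳ-at (reverse D′) 1ℚ)))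
  -- A dividend of smaller degree would give the quotient 0 and hence p = 0, against the leading
  -- coefficient 1.
  ... | inj₂ l = contradiction one≡0 λ ()
    where
    D≡[] : divMonic p m ≡ []
    D≡[] = ≡.trans (divMonic-divide p m e e′) (≡.cong reverse (≡.trans (≡.cong (λ f → divide f (1ℚ ∷ ps) ms) (≡.sym lps)) (divide-short (length ps) 1ℚ ps ms l)))
    one≡0 : 1ℚ ≡ 0ℚ
    one≡0 = ≡.trans (≡.sym (proj₂ hp)) (at≡ (≃-trans quot-m (≃-reflexive (≡.cong (_*P m) D≡[]))) j)

-- Cyclotomic polynomials over ℚ

qpow-isPower : IsPower polyRing qpow
qpow-isPower = record { pw-0 = ≃-refl ; pw-+ = λ j k → ≃-sym (qpow-+ j k) }

open Powers polyRing qpow qpow-isPower public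

fromℕ : ℕ → ℚ
fromℕ zero = 0ℚ
fromℕ (suc k) = fromℕ k ℚ.+ 1ℚ

nat-const : ∀ k → nat k ≃ constP (fromℕ k)
nat-const zero = ≐⇒≃ λ { zero → ≡.refl ; (suc i) → ≡.refl }
nat-const (suc k) = +-congʳ {oneP} (nat-const k)

0≤fromℕ : ∀ k → 0ℚ ℚ.≤ fromℕ k
0≤fromℕ zero = ℚ.≤-refl
0≤fromℕ (suc k) = ℚ.≤-trans (0≤fromℕ k) (ℚ.≤-trans (ℚ.≤-reflexive (≡.sym (ℚ.+-identityʳ _))) (ℚ.+-monoʳ-≤ (fromℕ k) (ℚ.<⇒≤ (ℚ.positive⁻¹ 1ℚ))))

0<fromℕ : ∀ k → 0ℚ ℚ.< fromℕ (suc k)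
0<fromℕ k = ℚ.<-≤-trans (ℚ.positive⁻¹ 1ℚ) (ℚ.≤-trans (ℚ.≤-reflexive (≡.sym (ℚ.+-identityˡ 1ℚ))) (ℚ.+-monoˡ-≤ 1ℚ (0≤fromℕ k)))

const-unit : ∀ r → r ≢ 0ℚ → Unit (constP r)
const-unit r r≢0 = constP (ℚ.1/ r) , ≐⇒≃ λ { zero → ≡.trans (ℚ.+-identityʳ _) (ℚ.*-inverseʳ r) ; (suc i) → ≡.refl }
  where instance
  nz : ℚ.NonZero r
  nz = ℚ.≢-nonZero r≢0

nat-unit : ∀ k → Unit (nat (suc k))
nat-unit k = unit-resp (≃-sym (nat-const (suc k))) (const-unit _ λ e → ℚ.<-irrefl (≡.sym e) (0<fromℕ k))

Monic-qpow : ∀ k → Monic k (qpow k)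
Monic-qpow zero = ≡.refl , ≡.refl
Monic-qpow (suc k) = ≡.cong suc (proj₁ (Monic-qpow k)) , proj₂ (Monic-qpow k)

+-[] : ∀ p → p +P [] ≡ p
+-[] [] = ≡.refl
+-[] (x ∷ p) = ≡.refl

Monic-Q : ∀ k → Monic (suc k) (Q (suc k))
Monic-Q k = ≡.subst (λ p → Monic (suc k) ((0ℚ ℚ.+ ℚ.- 1ℚ) ∷ p)) (≡.sym (+-[] (qpow k))) (Monic-qpow (suc k))

Q-regular : ∀ k → Regular (Q (suc k))
Q-regular k {x} {y} e = combine₁ {c = oneP} (Monic-regular (Q (suc k)) (Monic-Q k) (x -P y) λ i _ → at≡ zero-product i)
  (P.solve 2 (λ x y → x P.:- y P.:= P.:1 P.:* ((x P.:- y) P.:- P.:0)) ≃-refl x y)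
  where
  zero-product : Q (suc k) *P (x -P y) ≃ []
  zero-product = combine₁ {c = oneP} e (P.solve 3 (λ q x y → q P.:* (x P.:- y) P.:- P.:0 P.:= P.:1 P.:* (q P.:* x P.:- q P.:* y)) ≃-refl (Q (suc k)) x y)

open Cyclotomic polyRing qpow qpow-isPower nat-unit Q-regular Φ public

-- The recursion descends to proper divisors e < d, and the fuel, lowered by one, is still at least
-- e.
cyclo-stable : ∀ d → 1 ≤ d → ∀ f → d ≤ f → cyclo f d ≡ Φ d
cyclo-stable = <-rec _ λ where
  (suc d) ih _ (suc f) (s≤s d≤f) → ≡.cong (λ ps → divMonic (qpow (suc d) -P oneP) (foldr _*P_ oneP ps))
    (List.map-cong-local (All.tabulate λ {e} e∈ → let 1≤e , e<d , _ = ∈-properDivisors {suc d} e∈; e≤d = ℕ.≤-pred e<d in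
      ≡.trans (ih e<d 1≤e f (ℕ.≤-trans e≤d d≤f)) (≡.sym (ih e<d 1≤e d e≤d))))

Φ-divMonic : ∀ n → 1 ≤ n → Φ n ≡ divMonic (Q n) (rest n)
Φ-divMonic (suc n) _ = ≡.cong (λ ps → divMonic (Q (suc n)) (foldr _*P_ oneP ps))
  (List.map-cong-local (All.tabulate λ {e} e∈ → let 1≤e , e<n , _ = ∈-properDivisors {suc n} e∈ in cyclo-stable e 1≤e n (ℕ.≤-pred e<n)))

Monic-product : ∀ ds → All (λ d → ∃ λ k → Monic k (Φ d)) ds → ∃ λ k → Monic k (product (map Φ ds))
Monic-product [] [] = 0 , ≡.refl , ≡.refl
Monic-product (d ∷ ds) ((j , h) ∷ hs) = let k , h′ = Monic-product ds hs in j ℕ.+ k , Monic-* (Φ d) _ h h′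

-- The induction hypothesis makes `rest n` a monic divisor of qⁿ - 1, so the division that defines Φ
-- n is exact; coprimality then follows for n.
cyclotomic : ∀ n → 1 ≤ n → Good n × ∃ λ k → Monic k (Φ n)
cyclotomic = <-rec _ step
  where
  step : ∀ n → (∀ {d} → d < n → 1 ≤ d → Good d × ∃ λ k → Monic k (Φ d)) → 1 ≤ n → Good n × ∃ λ k → Monic k (Φ n)
  step (suc n) ih 1≤n = (λ _ → eq , comaximal-Q (suc n) 1≤n good eq) , _ , ≡.subst (Monic _) (≡.sym (Φ-divMonic (suc n) 1≤n)) (proj₂ exact)
    where
    good : ∀ d → d < suc n → Good d
    good d l l′ = proj₁ (ih l l′) l′
    exact = divMonic-exact (Q (suc n)) (rest (suc n)) (Monic-Q n)
      (proj₂ (Monic-product (properDivisors (suc n)) (All.tabulate λ {d} d∈ → let l , l′ , _ = ∈-properDivisors {suc n} d∈ in proj₂ (ih l′ l))))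
      (rest-∣-Q (suc n) 1≤n good)
    eq : Q (suc n) ≃ Φ (suc n) *P rest (suc n)
    eq = ≡.subst (λ p → Q (suc n) ≃ p *P rest (suc n)) (≡.sym (Φ-divMonic (suc n) 1≤n)) (proj₁ exact)

Q-Φ : ∀ n → 1 ≤ n → Q n ≃ Φ n *P rest n
Q-Φ n l = proj₁ (proj₁ (cyclotomic n l) l)

Φ-comaximal-Q : ∀ n → 1 ≤ n → ∀ j → ¬ n ∣ j → Comaximal (Φ n) (Q j)
Φ-comaximal-Q n l = proj₂ (proj₁ (cyclotomic n l) l)

Φ-comaximal-Φ : ∀ d e → 1 ≤ d → 1 ≤ e → d ≢ e → Comaximal (Φ d) (Φ e)
Φ-comaximal-Φ d e l l′ = pair (proj₁ (cyclotomic d l)) (proj₁ (cyclotomic e l′)) l l′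

-- Shifted factorials, q-integers and the constant (n² - 1)/24

qpow-^P : ∀ j k → qpow j ^P k ≃ qpow (k ℕ.* j)
qpow-^P j zero = ≃-refl
qpow-^P j (suc k) = ≃-trans (*-congˡ {qpow j} (qpow-^P j k)) (qpow-+ j (k ℕ.* j))

poch-suc : ∀ s t k → poch (qpow s) (qpow t) (suc k) ≃ poch (qpow s) (qpow t) k *P (oneP -P qpow (s ℕ.+ k ℕ.* t))
poch-suc s t k = *-congˡ {poch (qpow s) (qpow t) k} (+-congˡ {oneP} (-‿cong (≃-trans (*-congˡ {qpow s} (qpow-^P t k)) (qpow-+ s (k ℕ.* t)))))

qint-eq : ∀ k → (oneP -P q¹) *P qint k ≃ oneP -P qpow k
qint-eq k = go 0 k (λ i → i) λ i → ≡.refl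
  where
  go : ∀ s k f → (∀ i → f i ≡ s ℕ.+ i) → (oneP -P q¹) *P foldr _+P_ [] (map qpow (applyUpTo f k)) ≃ qpow s -P qpow (s ℕ.+ k)
  go s zero f h = combine₁ {c = oneP} (≃-reflexive (≡.cong qpow (ℕ.+-identityʳ s)))
    (solve 3 (λ q x y → (:1 :- q) :* :0 :- (x :- y) := :1 :* (y :- x)) ≃-refl q¹ (qpow s) (qpow (s ℕ.+ 0)))
  go s (suc k) f h = combine₄ {c = oneP} {c′ = oneP -P q¹} {c″ = negP oneP} {c‴ = negP oneP}
    (go (suc s) k (λ i → f (suc i)) (λ i → ≡.trans (h (suc i)) (ℕ.+-suc s i)))
    (≃-reflexive (≡.cong qpow (≡.trans (h 0) (ℕ.+-identityʳ s)))) (qpow-+ 1 s) (≃-reflexive (≡.cong qpow (≡.sym (ℕ.+-suc s k))))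
    (solve 7 (λ q a r x y y₁ z → (:1 :- q) :* (a :+ r) :- (x :- z) :=
        :1 :* ((:1 :- q) :* r :- (y₁ :- y)) :+ (:1 :- q) :* (a :- x) :+ (:- :1) :* (q :* x :- y₁) :+ (:- :1) :* (y :- z)) ≃-refl
        q¹ (qpow (f 0)) (foldr _+P_ [] (map qpow (applyUpTo (λ i → f (suc i)) k))) (qpow s) (qpow (suc s ℕ.+ k)) (qpow (suc s)) (qpow (s ℕ.+ suc k)))

const-homo-* : ∀ a b → constP a *P constP b ≃ constP (a ℚ.* b)
const-homo-* a b = const-* a (constP b)

fromℕ-+ : ∀ a b → fromℕ (a ℕ.+ b) ≡ fromℕ a ℚ.+ fromℕ b
fromℕ-+ zero b = ≡.sym (ℚ.+-identityˡ _)
fromℕ-+ (suc a) b = ≡.trans (≡.cong (ℚ._+ 1ℚ) (fromℕ-+ a b))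
  (ℚS.solve 2 (λ a b → (a ℚS.:+ b) ℚS.:+ ℚS.:1 ℚS.:= (a ℚS.:+ ℚS.:1) ℚS.:+ b) ≡.refl (fromℕ a) (fromℕ b))

fromℕ-* : ∀ a b → fromℕ (a ℕ.* b) ≡ fromℕ a ℚ.* fromℕ b
fromℕ-* zero b = ≡.sym (ℚ.*-zeroˡ (fromℕ b))
fromℕ-* (suc a) b = ≡.trans (fromℕ-+ b (a ℕ.* b)) (≡.trans (≡.cong (fromℕ b ℚ.+_) (fromℕ-* a b))
  (ℚS.solve 2 (λ a b → b ℚS.:+ a ℚS.:* b ℚS.:= (a ℚS.:+ ℚS.:1) ℚS.:* b) ≡.refl (fromℕ a) (fromℕ b)))

toℚᵘ-fromℕ : ∀ a → ℚ.toℚᵘ (fromℕ a) ℚᵘ.≃ ℚᵘ.mkℚᵘ (+ a) 0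
toℚᵘ-fromℕ zero = ℚᵘ.≃-refl
toℚᵘ-fromℕ (suc a) = ℚᵘ.≃-trans (ℚ.toℚᵘ-homo-+ (fromℕ a) 1ℚ) (ℚᵘ.≃-trans (ℚᵘ.+-congˡ (ℚ.toℚᵘ 1ℚ) (toℚᵘ-fromℕ a))
  (ℚᵘ.*≡* (≡.cong (ℤ._* (+ 1)) (≡.trans (≡.cong (ℤ._+ (+ 1)) (ℤ.*-identityʳ (+ a))) (≡.cong +_ (ℕ.+-comm a 1))))))

-- A rational is stored in lowest terms, so k/24 does not reduce for a variable k; the two sides are
-- compared as unnormalised fractions.
24-/ : ∀ k → fromℕ 24 ℚ.* ((+ k) ℚ./ 24) ≡ fromℕ k
24-/ k = ℚ.toℚᵘ-injective (ℚᵘ.≃-trans (ℚ.toℚᵘ-homo-* (fromℕ 24) ((+ k) ℚ./ 24))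
  (ℚᵘ.≃-trans (ℚᵘ.*-cong (toℚᵘ-fromℕ 24) (ℚ.toℚᵘ-fromℚᵘ (ℚᵘ.mkℚᵘ (+ k) 23)))
  (ℚᵘ.≃-trans (ℚᵘ.*≡* (≡.trans (ℤ.*-identityʳ _) (ℤ.*-comm (+ 24) (+ k)))) (ℚᵘ.≃-sym (toℚᵘ-fromℕ k)))))

square-1-/24 : ∀ n → fromℕ 24 ℚ.* ((+ (suc n ℕ.* suc n ∸ 1)) ℚ./ 24) ≡ fromℕ (suc n) ℚ.* fromℕ (suc n) ℚ.- 1ℚ
square-1-/24 n = ≡.trans (24-/ (suc n ℕ.* suc n ∸ 1))
  (≡.trans (ℚS.solve 1 (λ a → a ℚS.:= (a ℚS.:+ ℚS.:1) ℚS.:- ℚS.:1) ≡.refl _) (≡.cong (ℚ._- 1ℚ) (fromℕ-* (suc n) (suc n))))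

24-eq : ∀ n → (oneP +P oneP) *P (oneP +P oneP) *P (oneP +P oneP) *P (oneP +P oneP +P oneP) *P constP ((+ (suc n ℕ.* suc n ∸ 1)) ℚ./ 24)
  ≃ nat (suc n) *P nat (suc n) -P oneP
24-eq n = ≃-trans (≃-trans (*-congʳ {constP r} twentyfour) (const-homo-* (fromℕ 24) r)) (≃-trans (≃-reflexive (≡.cong constP (square-1-/24 n)))
  (+-congʳ {negP oneP} (≃-sym (≃-trans (*-cong (nat-const (suc n)) (nat-const (suc n))) (const-homo-* (fromℕ (suc n)) (fromℕ (suc n)))))))
  where
  r = (+ (suc n ℕ.* suc n ∸ 1)) ℚ./ 24
  twentyfour : (oneP +P oneP) *P (oneP +P oneP) *P (oneP +P oneP) *P (oneP +P oneP +P oneP) ≃ constP (fromℕ 24)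
  twentyfour = ≐⇒≃ λ { 0 → ≡.refl ; (suc i) → lemma i }
    where
    lemma : ∀ i → ((oneP +P oneP) *P (oneP +P oneP) *P (oneP +P oneP) *P (oneP +P oneP +P oneP)) at suc i ≡ 0ℚ
    lemma i = ≡.refl

-- Rational functions modulo Φₙ⁴

foldR : (ℕ → RatFun) → ℕ → RatFun
foldR h K = foldr _+R_ (polyR []) (applyUpTo h K)

sumR-foldR : ∀ a b f → sumR a b f ≡ foldR (λ i → f (a ℕ.+ i)) (suc b ∸ a)
sumR-foldR a b f = ≡.cong (foldr _+R_ (polyR [])) (List.map-upTo (λ i → f (a ℕ.+ i)) (suc b ∸ a))

-- Values of rational functions in the quotient by M; the denominator need not be a unit.
module Values (M : Poly) where
  R : CommutativeRing 0ℓ 0ℓ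
  R = Quotient.quotient polyRing M
  private module R = CommutativeRing R
  open Quotient polyRing M using (_≋_; multiple; factor; equation; ≈⇒≋; ≋-combine₁; ≋-combine₂) public

  Value : RatFun → Poly → Set
  Value x v = num x ≋ v *P den x

  value-+ : ∀ {x y v w} → Value x v → Value y w → Value (x +R y) (v +P w)
  value-+ {a // b} {a′ // b′} {v} {w} h h′ = ≋-combine₂ {c = b′} {c′ = b} h h′
    (solve 6 (λ a b a′ b′ v w → (a :* b′ :+ a′ :* b) :- (v :+ w) :* (b :* b′) := b′ :* (a :- v :* b) :+ b :* (a′ :- w :* b′)) ≃-refl a b a′ b′ v w)

  value-* : ∀ {x y v w} → Value x v → Value y w → Value (x *R y) (v *P w)
  value-* {a // b} {a′ // b′} {v} {w} h h′ = ≋-combine₂ {c = a′} {c′ = v *P b} h h′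
    (solve 6 (λ a b a′ b′ v w → a :* a′ :- (v :* w) :* (b :* b′) := a′ :* (a :- v :* b) :+ (v :* b) :* (a′ :- w :* b′)) ≃-refl a b a′ b′ v w)

  value-polyR : ∀ p → Value (polyR p) p
  value-polyR p = ≈⇒≋ (≃-sym (*-identityʳ p))

  value-unit : ∀ p {d} → ((i , _) : Units.Unit R d) → Value (p // d) (p *P i)
  value-unit p {d} (i , h) = ≋-combine₁ {c = negP p} h (solve 3 (λ p i d → p :- p :* i :* d := (:- p) :* (d :* i :- :1)) ≃-refl p i d)

  value-fold : ∀ K h v → (∀ i → i < K → Value (h i) (v i)) → Value (foldR h K) (Sums.∑ R K v)
  value-fold K h v hv = R.trans {_} {go-sum K v *P den (foldR h K)} (go K h v hv) (R.*-congʳ {den (foldR h K)} (go-∑ K v))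
    where
    go-sum : ℕ → (ℕ → Poly) → Poly
    go-sum zero v = []
    go-sum (suc K) v = v 0 +P go-sum K (λ i → v (suc i))
    go-∑ : ∀ K v → go-sum K v ≋ Sums.∑ R K v
    go-∑ zero v = R.refl
    go-∑ (suc K) v = R.trans {_} {v 0 +P Sums.∑ R K (λ i → v (suc i))} (R.+-congˡ {v 0} (go-∑ K (λ i → v (suc i)))) (R.sym {_} {_} (MoreSums.∑-head R K v))
    go : ∀ K h v → (∀ i → i < K → Value (h i) (v i)) → Value (foldR h K) (go-sum K v)
    go zero h v hv = ≈⇒≋ ≃-refl
    go (suc K) h v hv = value-+ {h 0} {foldR (λ i → h (suc i)) K} {v 0} {go-sum K (λ i → v (suc i))} (hv 0 z<s) (go K (λ i → h (suc i)) (λ i → v (suc i)) λ i l → hv (suc i) (s<s l))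

  unit-comaximal : ∀ {a} → Units.Unit R a → Comaximal a M
  unit-comaximal {a} (i , multiple d h) = i , negP d , Units.combine₁ polyRing {c = oneP} h
    (solve 4 (λ a i M d → (i :* a :+ (:- d) :* M) :- :1 := :1 :* ((a :* i :- :1) :- M :* d)) ≃-refl a i M d)

  comaximal-unit : ∀ {a} → Comaximal a M → Units.Unit R a
  comaximal-unit {a} (s , t , h) = s , multiple (negP t) (Units.combine₁ polyRing {c = oneP} h
    (solve 4 (λ a s M t → (a :* s :- :1) :- M :* (:- t) := :1 :* ((s :* a :+ t :* M) :- :1)) ≃-refl a s M t))

  open Exp R.semiring using (_^_)

  pow : ∀ k → q¹ ^ k ≋ qpow k
  pow zero = ≈⇒≋ ≃-refl
  pow (suc k) = R.trans {_} {q¹ *P qpow k} (R.*-congˡ {q¹} (pow k)) (≈⇒≋ (qpow-+ 1 k))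

  1-pow : ∀ k → oneP -P qpow k ≋ oneP -P q¹ ^ k
  1-pow k = R.+-congˡ {oneP} (R.-‿cong {qpow k} {q¹ ^ k} (R.sym {q¹ ^ k} (pow k)))

module ModΦ⁴ (m : ℕ) (1≤m : 1 ≤ m) (φ ψ : Poly)
  (Q-φ : Q (suc (m ℕ.* 4)) ≃ φ *P ψ) (φ-Q : ∀ j → ¬ suc (m ℕ.* 4) ∣ j → Comaximal φ (Q j)) where
  private
    n = suc (m ℕ.* 4)

  M : Poly
  M = φ *P (φ ^P 3)
  open Values M
  private module R = CommutativeRing R
  open Exp R.semiring using (_^_)

  comaximal-M : ∀ {a} → Comaximal φ a → Comaximal a M
  comaximal-M {a} h = comaximal-* a-φ (comaximal-* a-φ (comaximal-* a-φ (comaximal-* a-φ comaximal-1)))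
    where
    a-φ : Comaximal a φ
    a-φ = comaximal-sym h

  Q-unit : ∀ j → ¬ n ∣ j → Units.Unit R (oneP -P q¹ ^ j)
  Q-unit j h = Units.unit-resp R {oneP -P qpow j} (1-pow j) (proj₁ u′ , proj₂ u′)
    where
    u : Units.Unit R (Q j)
    u = comaximal-unit (comaximal-M (φ-Q j h))
    u′ : Units.Unit R (oneP -P qpow j)
    u′ = negP (proj₁ u) , ≋-combine₁ {c = oneP} (proj₂ u) (solve 2 (λ x i → (:1 :- x) :* (:- i) :- :1 := :1 :* ((x :- :1) :* i :- :1)) ≃-refl (qpow j) (proj₁ u))

  -- q·qⁿ⁻¹ - φψ = 1.
  q-unit : Units.Unit R q¹
  q-unit = comaximal-unit (comaximal-M (negP (ψ) , qpow (m ℕ.* 4) , Units.combine₂ polyRing {c = oneP} {c′ = oneP} (Q-φ) (qpow-+ (m ℕ.* 4) 1)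
    (≃-trans (solve 6 (λ r φ x q y y′ → ((:- r) :* φ :+ x :* q) :- :1 := :1 :* ((y :- :1) :- φ :* r) :+ :1 :* (x :* q :- y)) ≃-refl (ψ) φ (qpow (m ℕ.* 4)) q¹ (qpow n) [])
      (+-congˡ {oneP *P (Q n -P φ *P ψ)} (*-congˡ {oneP} (+-congˡ {qpow (m ℕ.* 4) *P q¹} (-‿cong (≃-reflexive (≡.cong qpow (ℕ.+-comm 1 (m ℕ.* 4)))))))))))

  modulus : Modulus R
  modulus = record
    { m = m ; 1≤m = 1≤m ; q = q¹ ; π = proj₁ q-unit ; φ = φ ; g = negP (ψ)
    ; qπ = proj₂ q-unit
    ; φ⁴ = multiple oneP (solve 1 (λ f → f :* f :* f :* f :- :0 := (f :* (f :* (f :* (f :* :1)))) :* :1) ≃-refl φ)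
    ; φ-eq = R.trans {oneP -P q¹ ^ n} {oneP -P qpow n} (R.sym {oneP -P qpow n} (1-pow n)) (≈⇒≋ (Units.combine₁ polyRing {c = negP oneP} (Q-φ)
        (solve 3 (λ x f r → (:1 :- x) :- f :* (:- r) := (:- :1) :* ((x :- :1) :- f :* r)) ≃-refl (qpow n) φ (ψ))))
    ; units = Q-unit }

  nat≋ : ∀ k → MoreSums.nat polyRing k ≋ MoreSums.nat R k
  nat≋ zero = ≈⇒≋ ≃-refl
  nat≋ (suc k) = R.+-congʳ {oneP} {MoreSums.nat polyRing k} (nat≋ k)

  nat-unitᴿ : ∀ k → Units.Unit R (MoreSums.nat R (suc k))
  nat-unitᴿ k = proj₁ (nat-unit k) , R.trans {_} {MoreSums.nat polyRing (suc k) *P proj₁ (nat-unit k)} (R.*-congʳ {proj₁ (nat-unit k)} (R.sym {MoreSums.nat polyRing (suc k)} (nat≋ (suc k)))) (≈⇒≋ (proj₂ (nat-unit k)))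

  r : Poly
  r = constP ((+ (n ℕ.* n ∸ 1)) ℚ./ 24)

  24r : (oneP +P oneP) *P (oneP +P oneP) *P (oneP +P oneP) *P (oneP +P oneP +P oneP) *P r ≋ MoreSums.nat R n *P MoreSums.nat R n -P oneP
  24r = R.trans {_} {MoreSums.nat polyRing n *P MoreSums.nat polyRing n -P oneP} (≈⇒≋ (24-eq (m ℕ.* 4)))
    (R.+-congʳ {negP oneP} (R.*-cong (nat≋ n) (nat≋ n)))

qq⁴ qq² q²q² q⁴q⁴ qᵏ⁽ᵏ⁺¹⁾ : ℕ → Poly
qq⁴ k = poch q¹ (qpow 4) k
qq² k = poch q¹ (qpow 2) k
q²q² k = poch (qpow 2) (qpow 2) k
q⁴q⁴ k = poch (qpow 4) (qpow 4) k
qᵏ⁽ᵏ⁺¹⁾ k = qpow (k ℕ.* k ℕ.+ k)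

summand : ℕ → RatFun
summand k = (qint (6 ℕ.* k ℕ.+ 1) *P qq⁴ k *P (qq² k ^P 3) *P qᵏ⁽ᵏ⁺¹⁾ k) // (q²q² k *P (q⁴q⁴ k ^P 3))

w-suc : ∀ k → qᵏ⁽ᵏ⁺¹⁾ (suc k) ≃ qᵏ⁽ᵏ⁺¹⁾ k *P qpow (suc k ℕ.* 2)
w-suc k = ≃-sym (≃-trans (qpow-+ (k ℕ.* k ℕ.+ k) (suc k ℕ.* 2)) (≃-reflexive (≡.cong qpow (eq k))))
  where
  open Data.Nat.Solver.+-*-Solver using () renaming (solve to solveℕ; _:+_ to _:+ℕ_; _:*_ to _:*ℕ_; _:=_ to _:=ℕ_; con to conℕ)
  eq : ∀ k → k ℕ.* k ℕ.+ k ℕ.+ suc k ℕ.* 2 ≡ suc k ℕ.* suc k ℕ.+ suc k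
  eq = solveℕ 1 (λ k → k :*ℕ k :+ℕ k :+ℕ (conℕ 1 :+ℕ k) :*ℕ conℕ 2 :=ℕ (conℕ 1 :+ℕ k) :*ℕ (conℕ 1 :+ℕ k) :+ℕ (conℕ 1 :+ℕ k)) ≡.refl

-- The sum is indexed from 0, which turns 4k - 2 into 4k + 2.
RHS-B : ℕ → RatFun
RHS-B m = polyR (scaleP ((+ (suc (m ℕ.* 4) ℕ.* suc (m ℕ.* 4) ∸ 1)) ℚ./ 24) ((oneP -P q¹) ^P 2))
  +R foldR (λ k → qpow (2 ℕ.+ k ℕ.* 4) // (qint (2 ℕ.+ k ℕ.* 4) ^P 2)) m

RHS-of : ℕ → RatFun
RHS-of m = (poch (qpow 2) (qpow 4) m // poch (qpow 4) (qpow 4) m)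
  *R polyR (qint (suc (m ℕ.* 4)))
  *R (oneP // qpow m)
  *R (polyR oneP +R (polyR (qint (suc (m ℕ.* 4)) ^P 2) *R RHS-B m))

-- The congruence of the theorem, expressed by the equality of `polyRing` so that ring reasoning
-- applies.
Congruent : RatFun → RatFun → Poly → Set
Congruent x y P = Σ Poly λ U → Σ Poly λ V → Comaximal V P ×
  ((num x *P den y -P num y *P den x) *P V ≃ (P *P U) *P (den x *P den y))

module Clear (M : Poly) where
  open Values M
  private module R = CommutativeRing R

  cross-difference : ∀ nx dx ny dy {v v′} → nx ≋ v *P dx → ny ≋ v′ *P dy → v ≋ v′ → nx *P dy -P ny *P dx ≋ []
  cross-difference nx dx ny dy {v} {v′} hx hy e = R.trans {_} {v *P dx *P dy -P v *P dy *P dx}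
    (R.+-cong {nx *P dy} {v *P dx *P dy} {negP (ny *P dx)} {negP (v *P dy *P dx)} (R.*-congʳ {dy} hx)
      (R.-‿cong {ny *P dx} {v *P dy *P dx} (R.*-congʳ {dx} (R.trans {ny} {v′ *P dy} hy (R.*-congʳ {dy} (R.sym {v} e))))))
    (≈⇒≋ (solve 3 (λ v x y → v :* x :* y :- v :* y :* x := :0) ≃-refl v dx dy))

  multiple-difference : ∀ e x y f → e -P [] ≃ M *P f → e *P (x *P y) ≃ (M *P f) *P (x *P y)
  multiple-difference e x y f h = *-congʳ {x *P y} (≃-trans (solve 1 (λ e → e := e :- :0) ≃-refl e) h)

  -- The cross difference of two fractions with equal values is a multiple Mf; then f serves as U
  -- and the product of the denominators, a unit modulo M, as V.
  value-congruent : ∀ x y {v v′} → Value x v → Value y v′ → v ≋ v′ → Units.Unit R (den x) → Units.Unit R (den y) → Congruent x y M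
  value-congruent x y hx hy e ux uy = factor difference , den x *P den y , unit-comaximal (Units.unit-* R {den x} {den y} ux uy) ,
    multiple-difference (num x *P den y -P num y *P den x) (den x) (den y) (factor difference) (equation difference)
    where
    difference : num x *P den y -P num y *P den x ≋ []
    difference = cross-difference (num x) (den x) (num y) (den y) hx hy e

module Modulo-Φ⁴ (m : ℕ) (1≤m : 1 ≤ m) (φ ψ : Poly)
  (Q-φ : Q (suc (m ℕ.* 4)) ≃ φ *P ψ) (φ-Q : ∀ j → ¬ suc (m ℕ.* 4) ∣ j → Comaximal φ (Q j)) where
  private
    n = suc (m ℕ.* 4)

  open ModΦ⁴ m 1≤m φ ψ Q-φ φ-Q
  open Values M
  private
    module R = CommutativeRing R
    module U = Units R
  open Exp R.semiring using (_^_)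
  N : ℕ
  N = m ℕ.* 2

  module T = SeriesTerms R q¹ q-unit
  module V = SeriesValue R modulus nat-unitᴿ r 24r

  step : ∀ x j → x *P (oneP -P qpow j) ≋ x *P (oneP -P q¹ ^ j)
  step x j = R.*-congˡ {x} (1-pow j)

  products : T.Products N qq⁴ qq² q²q² q⁴q⁴ qᵏ⁽ᵏ⁺¹⁾
  products = record
    { a-suc = λ k _ → R.trans {qq⁴ (suc k)} {qq⁴ k *P (oneP -P qpow (1 ℕ.+ k ℕ.* 4))} (≈⇒≋ (poch-suc 1 4 k)) (step (qq⁴ k) (1 ℕ.+ k ℕ.* 4))
    ; b-suc = λ k _ → R.trans {qq² (suc k)} {qq² k *P (oneP -P qpow (1 ℕ.+ k ℕ.* 2))} (≈⇒≋ (poch-suc 1 2 k)) (step (qq² k) (1 ℕ.+ k ℕ.* 2))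
    ; c-suc = λ k _ → R.trans {q²q² (suc k)} {q²q² k *P (oneP -P qpow (2 ℕ.+ k ℕ.* 2))} (≈⇒≋ (poch-suc 2 2 k)) (step (q²q² k) (2 ℕ.+ k ℕ.* 2))
    ; d-suc = λ k _ → R.trans {q⁴q⁴ (suc k)} {q⁴q⁴ k *P (oneP -P qpow (4 ℕ.+ k ℕ.* 4))} (≈⇒≋ (poch-suc 4 4 k)) (step (q⁴q⁴ k) (4 ℕ.+ k ℕ.* 4))
    ; w-suc = λ k _ → R.trans {qᵏ⁽ᵏ⁺¹⁾ (suc k)} {qᵏ⁽ᵏ⁺¹⁾ k *P qpow (suc k ℕ.* 2)} (≈⇒≋ (w-suc k)) (R.*-congˡ {qᵏ⁽ᵏ⁺¹⁾ k} (R.sym {q¹ ^ (suc k ℕ.* 2)} (pow (suc k ℕ.* 2))))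
    }

  qi-eq : ∀ k → (oneP -P q¹) *P qint k ≋ oneP -P q¹ ^ k
  qi-eq k = R.trans {_} {oneP -P qpow k} (≈⇒≋ (qint-eq k)) (1-pow k)

  den-unit : ∀ k → k ≤ N → U.Unit (q²q² k *P (q⁴q⁴ k ^P 3))
  den-unit = V.unit-cd products R.refl R.refl R.refl R.refl R.refl qint qi-eq

  private
    inv : U.Invertible (suc N) (λ k → q²q² k *P (q⁴q⁴ k ^P 3))
    inv = U.invertible (suc N) {λ k → q²q² k *P (q⁴q⁴ k ^P 3)} λ k l → den-unit k (ℕ.≤-pred l)

    J : ℕ → ℕ
    J j = 2 ℕ.+ j ℕ.* 4

  qint-unit : ∀ j → ¬ n ∣ j → U.Unit (qint j)
  qint-unit j h = (oneP -P q¹) *P proj₁ (Q-unit j h) , R.trans {_} {(oneP -P q¹) *P qint j *P proj₁ (Q-unit j h)}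
    (≈⇒≋ (solve 3 (λ u f i → f :* (u :* i) := u :* f :* i) ≃-refl (oneP -P q¹) (qint j) (proj₁ (Q-unit j h))))
    (R.trans {_} {(oneP -P q¹ ^ j) *P proj₁ (Q-unit j h)} (R.*-congʳ {proj₁ (Q-unit j h)} (qi-eq j)) (proj₂ (Q-unit j h)))

  private
    inv-J : U.Invertible m (λ j → qint (J j) ^P 2)
    inv-J = U.invertible m {λ j → qint (J j) ^P 2} λ j l → U.unit-* {qint (J j)} {qint (J j) *P oneP} (u j l) (U.unit-* {qint (J j)} {oneP} (u j l) (oneP , ≈⇒≋ (*-identityˡ oneP)))
      where
      u : ∀ j → j < m → U.Unit (qint (J j))
      u j l = qint-unit (J j) λ h → ℕ.<⇒≱ (s<s (ℕ.≤-trans (ℕ.+-monoˡ-≤ (j ℕ.* 4) (s≤s (s≤s (z≤n {2})))) (ℕ.*-monoˡ-≤ 4 l))) (∣ℕ.∣⇒≤ h)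

  x : ℕ → Poly
  x k = (qint (6 ℕ.* k ℕ.+ 1) *P qq⁴ k *P (qq² k ^P 3) *P qᵏ⁽ᵏ⁺¹⁾ k) *P proj₁ inv k

  x-value : ∀ k → k < suc N → Value (summand k) (x k)
  x-value k l = value-unit (qint (6 ℕ.* k ℕ.+ 1) *P qq⁴ k *P (qq² k ^P 3) *P qᵏ⁽ᵏ⁺¹⁾ k) {q²q² k *P (q⁴q⁴ k ^P 3)} (proj₁ inv k , proj₂ inv k l)

  X : Poly
  X = Sums.∑ R (suc N) x

  X-value : Value (foldR summand (suc N)) X
  X-value = value-fold (suc N) summand x x-value

  β : ℕ → Poly
  β j = qpow (J j) *P proj₁ inv-J j

  βs B-sum : Poly
  βs = Sums.∑ R m β
  B-sum = r *P ((oneP -P q¹) *P (oneP -P q¹)) +P βs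

  B-value : Value (RHS-B m) B-sum
  B-value = value-+ {polyR (scaleP ((+ (n ℕ.* n ∸ 1)) ℚ./ 24) ((oneP -P q¹) ^P 2))} {foldR (λ k → qpow (J k) // (qint (J k) ^P 2)) m} {r *P ((oneP -P q¹) *P (oneP -P q¹))} {βs}
    (R.trans {_} {scaleP ((+ (n ℕ.* n ∸ 1)) ℚ./ 24) ((oneP -P q¹) ^P 2) *P oneP} (value-polyR (scaleP ((+ (n ℕ.* n ∸ 1)) ℚ./ 24) ((oneP -P q¹) ^P 2)))
      (R.*-congʳ {oneP} (≈⇒≋ (≃-trans (≃-sym (const-* ((+ (n ℕ.* n ∸ 1)) ℚ./ 24) ((oneP -P q¹) ^P 2))) (*-congˡ {r} (*-congˡ {oneP -P q¹} (*-identityʳ (oneP -P q¹))))))))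
    (value-fold m (λ k → qpow (J k) // (qint (J k) ^P 2)) β λ k l → value-unit (qpow (J k)) {qint (J k) ^P 2} (proj₁ inv-J k , proj₂ inv-J k l))

  private
    h D : Poly
    h = poch (qpow 2) (qpow 4) m
    D = poch (qpow 4) (qpow 4) m

  D-unit : U.Unit D
  D-unit = V.unit-d products R.refl R.refl R.refl R.refl R.refl qint qi-eq m (ℕ.m≤m*n m 2)

  qpow-unit : U.Unit (qpow m)
  qpow-unit = U.unit-resp (pow m) (^-unit m)
    where
    ^-unit : ∀ k → U.Unit (q¹ ^ k)
    ^-unit zero = oneP , R.*-identityˡ oneP
    ^-unit (suc k) = U.unit-* {q¹} {q¹ ^ k} q-unit (^-unit k)

  Y-B : Poly
  Y-B = oneP +P (qint n ^P 2) *P B-sum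

  Y′ : Poly
  Y′ = (h *P proj₁ D-unit) *P qint n *P (oneP *P proj₁ qpow-unit) *P Y-B

  Y-value : Value (RHS-of m) Y′
  Y-value = value-* {(h // D) *R polyR (qint n) *R (oneP // qpow m)} {polyR oneP +R (polyR (qint n ^P 2) *R RHS-B m)} {(h *P proj₁ D-unit) *P qint n *P (oneP *P proj₁ qpow-unit)} {Y-B}
    (value-* {(h // D) *R polyR (qint n)} {oneP // qpow m} {(h *P proj₁ D-unit) *P qint n} {oneP *P proj₁ qpow-unit}
      (value-* {h // D} {polyR (qint n)} {h *P proj₁ D-unit} {qint n} (value-unit h {D} D-unit) (value-polyR (qint n)))
      (value-unit oneP {qpow m} qpow-unit))
    (value-+ {polyR oneP} {polyR (qint n ^P 2) *R RHS-B m} {oneP} {(qint n ^P 2) *P B-sum} (value-polyR oneP)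
      (value-* {polyR (qint n ^P 2)} {RHS-B m} {qint n ^P 2} {B-sum} (value-polyR (qint n ^P 2)) B-value))

  ∏-poch : ∀ s k → Sums.∏ R k (λ j → oneP -P q¹ ^ (s ℕ.+ j ℕ.* 4)) ≋ poch (qpow s) (qpow 4) k
  ∏-poch s zero = R.refl
  ∏-poch s (suc k) = R.trans {_} {poch (qpow s) (qpow 4) k *P (oneP -P q¹ ^ (s ℕ.+ k ℕ.* 4))} (R.*-congʳ {oneP -P q¹ ^ (s ℕ.+ k ℕ.* 4)} (∏-poch s k))
    (R.sym {poch (qpow s) (qpow 4) (suc k)} (R.trans {poch (qpow s) (qpow 4) (suc k)} {poch (qpow s) (qpow 4) k *P (oneP -P qpow (s ℕ.+ k ℕ.* 4))}
      (≈⇒≋ (poch-suc s 4 k)) (step (poch (qpow s) (qpow 4) k) (s ℕ.+ k ℕ.* 4))))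

  x-eq : ∀ k → k ≤ N → x k *P (q²q² k *P (q⁴q⁴ k ^P 3)) ≋ qint (suc (k ℕ.* 6)) *P qq⁴ k *P (qq² k ^P 3) *P qᵏ⁽ᵏ⁺¹⁾ k
  x-eq k l = R.trans {_} {qint (6 ℕ.* k ℕ.+ 1) *P qq⁴ k *P (qq² k ^P 3) *P qᵏ⁽ᵏ⁺¹⁾ k}
    (≋-combine₁ {c = qint (6 ℕ.* k ℕ.+ 1) *P qq⁴ k *P (qq² k ^P 3) *P qᵏ⁽ᵏ⁺¹⁾ k} (proj₂ inv k (s≤s l))
      (solve 3 (λ p i c → p :* i :* c :- p := p :* (c :* i :- :1)) ≃-refl (qint (6 ℕ.* k ℕ.+ 1) *P qq⁴ k *P (qq² k ^P 3) *P qᵏ⁽ᵏ⁺¹⁾ k) (proj₁ inv k) (q²q² k *P (q⁴q⁴ k ^P 3))))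
    (R.reflexive (≡.cong (λ j → qint j *P qq⁴ k *P (qq² k ^P 3) *P qᵏ⁽ᵏ⁺¹⁾ k) (≡.trans (ℕ.+-comm (6 ℕ.* k) 1) (≡.cong suc (ℕ.*-comm 6 k)))))

  β-eq : ∀ j → j < m → β j *P (qint (J j) *P qint (J j)) ≋ q¹ ^ J j
  β-eq j l = R.trans {_} {qpow (J j)}
    (≋-combine₁ {c = qpow (J j)} (proj₂ inv-J j l)
      (solve 3 (λ p i f → p :* i :* (f :* f) :- p := p :* (f :* (f :* :1) :* i :- :1)) ≃-refl (qpow (J j)) (proj₁ inv-J j) (qint (J j))))
    (R.sym {q¹ ^ J j} (pow (J j)))

  main : X *P (D *P qpow m) ≋ h *P qint n *P Y-B
  main = R.trans {_} {X *P (∏D *P q¹ ^ m)}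
      (R.*-congˡ {X} (R.*-cong {D} {∏D} {qpow m} {q¹ ^ m} (R.sym {∏D} (∏-poch 4 m)) (R.sym {q¹ ^ m} (pow m))))
    (R.trans {_} {∏H *P qint n *P (oneP +P qint n *P qint n *P B-sum)}
      (V.value products R.refl R.refl R.refl R.refl R.refl qint qi-eq x x-eq β β-eq)
      (R.*-cong {∏H *P qint n} {h *P qint n} (R.*-congʳ {qint n} (∏-poch 2 m))
        (≈⇒≋ (solve 2 (λ f B → :1 :+ f :* f :* B := :1 :+ (f :* (f :* :1)) :* B) ≃-refl (qint n) B-sum))))
    where
    ∏D ∏H : Poly
    ∏D = Sums.∏ R m (λ j → oneP -P q¹ ^ (4 ℕ.+ j ℕ.* 4))
    ∏H = Sums.∏ R m (λ j → oneP -P q¹ ^ (2 ℕ.+ j ℕ.* 4))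

  X≋Y : X ≋ Y′
  X≋Y = U.unit-cancel {D *P qpow m} {X} {Y′} (U.unit-* {D} {qpow m} D-unit qpow-unit)
    (U.combine₃ {L = D *P qpow m *P X} {R = D *P qpow m *P Y′} {c = oneP} {c′ = negP (h *P qint n *P Y-B *P (proj₁ qpow-unit *P qpow m))} {c″ = negP (h *P qint n *P Y-B)}
      main (proj₂ D-unit) (proj₂ qpow-unit)
      (≈⇒≋ (solve 8 (λ X D k h f y i i′ → D :* k :* X :- D :* k :* ((h :* i) :* f :* (:1 :* i′) :* y)
        := :1 :* (X :* (D :* k) :- h :* f :* y) :+ (:- (h :* f :* y :* (i′ :* k))) :* (D :* i :- :1) :+ (:- (h :* f :* y)) :* (k :* i′ :- :1))
        ≃-refl X D (qpow m) h (qint n) Y-B (proj₁ D-unit) (proj₁ qpow-unit))))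

  den-fold-unit : ∀ K g → (∀ k → k < K → U.Unit (den (g k))) → U.Unit (den (foldR g K))
  den-fold-unit zero g hg = oneP , R.*-identityˡ oneP
  den-fold-unit (suc K) g hg = U.unit-* {den (g 0)} {den (foldR (λ i → g (suc i)) K)} (hg 0 z<s) (den-fold-unit K (λ i → g (suc i)) λ k l → hg (suc k) (s<s l))

  summands-unit : U.Unit (den (foldR summand (suc N)))
  summands-unit = den-fold-unit (suc N) summand λ k l → den-unit k (ℕ.≤-pred l)

  private
    one-unit : U.Unit oneP
    one-unit = oneP , R.*-identityˡ oneP

    βf : RatFun
    βf = foldR (λ k → qpow (J k) // (qint (J k) ^P 2)) m

    βf-unit : U.Unit (den βf)
    βf-unit = den-fold-unit m (λ k → qpow (J k) // (qint (J k) ^P 2)) λ k l → proj₁ inv-J k , proj₂ inv-J k l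

  RHS-unit : U.Unit (den (RHS-of m))
  RHS-unit = U.unit-* {D *P oneP *P qpow m} {oneP *P (oneP *P (oneP *P den βf))} (U.unit-* {D *P oneP} {qpow m} (U.unit-* {D} {oneP} D-unit one-unit) qpow-unit)
      (U.unit-* {oneP} {oneP *P (oneP *P den βf)} one-unit (U.unit-* {oneP} {oneP *P den βf} one-unit (U.unit-* {oneP} {den βf} one-unit βf-unit)))

  congruent : Congruent (foldR summand (suc N)) (RHS-of m) M
  congruent = Clear.value-congruent M (foldR summand (suc N)) (RHS-of m) {X} {Y′} X-value Y-value X≋Y summands-unit RHS-unit

-- Rational functions modulo Φ_d for a proper divisor d of n

-- The quotient of the shifted factorials of lengths k + r and k, given as a product because the
-- divisor may vanish modulo Φ_d.
tail : (s t k : ℕ) → ℕ → Poly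
tail s t k r = prodP r (λ i → oneP -P qpow (s ℕ.+ (k ℕ.+ i) ℕ.* t))

poch-+ : ∀ s t k r → poch (qpow s) (qpow t) (k ℕ.+ r) ≃ poch (qpow s) (qpow t) k *P tail s t k r
poch-+ s t k zero = ≃-trans (≃-reflexive (≡.cong (poch (qpow s) (qpow t)) (ℕ.+-identityʳ k))) (≃-sym (*-identityʳ _))
poch-+ s t k (suc r) = ≃-trans (≃-reflexive (≡.cong (poch (qpow s) (qpow t)) (ℕ.+-suc k r)))
  (≃-trans (poch-suc s t (k ℕ.+ r)) (≃-trans (*-congʳ {oneP -P qpow (s ℕ.+ (k ℕ.+ r) ℕ.* t)} (poch-+ s t k r))
    (*-assoc (poch (qpow s) (qpow t) k) (tail s t k r) (oneP -P qpow (s ℕ.+ (k ℕ.+ r) ℕ.* t)))))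

prodP-factor : ∀ r f i → i < r → ∃ λ X → prodP r f ≃ f i *P X
prodP-factor (suc r) f i (s≤s l) with ℕ.m≤n⇒m<n∨m≡n l
... | inj₂ ≡.refl = prodP r f , *-comm (prodP r f) (f r)
... | inj₁ i<r = let X , h = prodP-factor r f i i<r in X *P f r , ≃-trans (*-congʳ {f r} h) (*-assoc (f i) X (f r))

infix 4 _~_
_~_ : RatFun → RatFun → Set
x ~ y = (num x ≃ num y) × (den x ≃ den y)

foldR-+ : ∀ h j k → foldR h (j ℕ.+ k) ~ foldR h j +R foldR (λ i → h (j ℕ.+ i)) k
foldR-+ h zero k = solve 2 (λ n d → n := :0 :* d :+ n :* :1) ≃-refl (num (foldR h k)) (den (foldR h k)) , ≃-sym (*-identityˡ (den (foldR h k)))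
foldR-+ h (suc j) k = let hn , hd = foldR-+ (λ i → h (suc i)) j k in assoc (h 0) (foldR (λ i → h (suc i)) (j ℕ.+ k)) (foldR (λ i → h (suc i)) j) (foldR (λ i → h (suc j ℕ.+ i)) k) hn hd
  where
  assoc : ∀ x y z w → num y ≃ num (z +R w) → den y ≃ den (z +R w) → x +R y ~ (x +R z) +R w
  assoc (a // b) (c // d) (c′ // d′) (c″ // d″) hn hd =
    ≃-trans (+-cong (*-congˡ {a} hd) (*-congʳ {b} hn)) (solve 6 (λ a b c d e f → a :* (d :* f) :+ (c :* f :+ e :* d) :* b := (a :* d :+ c :* b) :* f :+ e :* (b :* d)) ≃-refl a b c′ d′ c″ d″)
    , ≃-trans (*-congˡ {b} hd) (≃-sym (*-assoc b d′ d″))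

foldR-cong : ∀ {h h′} k → (∀ i → h i ≡ h′ i) → foldR h k ≡ foldR h′ k
foldR-cong zero e = ≡.refl
foldR-cong (suc k) e = ≡.cong₂ _+R_ (e 0) (foldR-cong k λ i → e (suc i))

-- Integrality at φ: Integral and Divisible are membership in the local ring and in its maximal ideal.
module Local (φ : Poly) where
  open Values φ
  private
    module R = CommutativeRing R
    module U = Units R

  Integral Divisible : RatFun → Set
  Integral x = Σ Poly λ v → Σ Poly λ w → U.Unit v × (num x *P v ≃ w *P den x)
  Divisible x = Σ Poly λ v → Σ Poly λ w → U.Unit v × (num x *P v ≃ (φ *P w) *P den x)

  unit-1 : U.Unit oneP
  unit-1 = oneP , R.*-identityˡ oneP

  unit-*′ : ∀ a b → U.Unit a → U.Unit b → U.Unit (a *P b)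
  unit-*′ a b = U.unit-* {a} {b}

  divisible-resp : ∀ x y → x ~ y → Divisible y → Divisible x
  divisible-resp x y (hn , hd) (v , w , u , e) = v , w , u , ≃-trans (*-congʳ {v} hn) (≃-trans e (*-congˡ {φ *P w} (≃-sym hd)))

  divisible-+ : ∀ x y → Divisible x → Divisible y → Divisible (x +R y)
  divisible-+ (a // b) (c // d) (v , w , u , e) (v′ , w′ , u′ , e′) = v *P v′ , w *P v′ +P w′ *P v , unit-*′ v v′ u u′ ,
    ≃-trans (solve 6 (λ a b c d v v′ → (a :* d :+ c :* b) :* (v :* v′) := (a :* v) :* (d :* v′) :+ (c :* v′) :* (b :* v)) ≃-refl a b c d v v′)
    (≃-trans (+-cong (*-congʳ {d *P v′} e) (*-congʳ {b *P v} e′))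
      (solve 7 (λ b d v v′ w w′ φ → ((φ :* w) :* b) :* (d :* v′) :+ ((φ :* w′) :* d) :* (b :* v) := (φ :* (w :* v′ :+ w′ :* v)) :* (b :* d)) ≃-refl b d v v′ w w′ φ))

  integral-+ : ∀ x y → Integral x → Integral y → Integral (x +R y)
  integral-+ (a // b) (c // d) (v , w , u , e) (v′ , w′ , u′ , e′) = v *P v′ , w *P v′ +P w′ *P v , unit-*′ v v′ u u′ ,
    ≃-trans (solve 6 (λ a b c d v v′ → (a :* d :+ c :* b) :* (v :* v′) := (a :* v) :* (d :* v′) :+ (c :* v′) :* (b :* v)) ≃-refl a b c d v v′)
    (≃-trans (+-cong (*-congʳ {d *P v′} e) (*-congʳ {b *P v} e′))
      (solve 6 (λ b d v v′ w w′ → (w :* b) :* (d :* v′) :+ (w′ :* d) :* (b :* v) := (w :* v′ :+ w′ :* v) :* (b :* d)) ≃-refl b d v v′ w w′))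

  integral-*-divisible : ∀ x y → Integral x → Divisible y → Divisible (x *R y)
  integral-*-divisible (a // b) (c // d) (v , w , u , e) (v′ , w′ , u′ , e′) = v *P v′ , w *P w′ , unit-*′ v v′ u u′ ,
    ≃-trans (solve 4 (λ a c v v′ → (a :* c) :* (v :* v′) := (a :* v) :* (c :* v′)) ≃-refl a c v v′)
    (≃-trans (*-cong e e′) (solve 5 (λ b d w w′ φ → (w :* b) :* ((φ :* w′) :* d) := (φ :* (w :* w′)) :* (b :* d)) ≃-refl b d w w′ φ))

  divisible-*-integral : ∀ x y → Divisible x → Integral y → Divisible (x *R y)
  divisible-*-integral (a // b) (c // d) (v , w , u , e) (v′ , w′ , u′ , e′) = v *P v′ , w *P w′ , unit-*′ v v′ u u′ ,
    ≃-trans (solve 4 (λ a c v v′ → (a :* c) :* (v :* v′) := (a :* v) :* (c :* v′)) ≃-refl a c v v′)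
    (≃-trans (*-cong e e′) (solve 5 (λ b d w w′ φ → ((φ :* w) :* b) :* (w′ :* d) := (φ :* (w :* w′)) :* (b :* d)) ≃-refl b d w w′ φ))

  integral-polyR : ∀ p → Integral (polyR p)
  integral-polyR p = oneP , p , unit-1 , ≃-refl

  integral-unit : ∀ p d → U.Unit d → Integral (p // d)
  integral-unit p d u = d , p , u , ≃-refl

  divisible-congruent : ∀ x y → Divisible x → Divisible y → Congruent x y φ
  divisible-congruent x y (v , w , u , e) (v′ , w′ , u′ , e′) = w *P v′ -P w′ *P v , v *P v′ , unit-comaximal (unit-*′ v v′ u u′) ,
    lemma (num x) (den x) (num y) (den y) v w v′ w′ e e′
    where
    lemma : ∀ a b c d v w v′ w′ → a *P v ≃ (φ *P w) *P b → c *P v′ ≃ (φ *P w′) *P d →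
      (a *P d -P c *P b) *P (v *P v′) ≃ (φ *P (w *P v′ -P w′ *P v)) *P (b *P d)
    lemma a b c d v w v′ w′ e e′ = ≃-trans (solve 6 (λ a b c d v v′ → (a :* d :- c :* b) :* (v :* v′) := (a :* v) :* (d :* v′) :- (c :* v′) :* (b :* v)) ≃-refl a b c d v v′)
      (≃-trans (+-cong (*-congʳ {d *P v′} e) (-‿cong (*-congʳ {b *P v} e′)))
      (solve 7 (λ b d v v′ w w′ φ → ((φ :* w) :* b) :* (d :* v′) :- ((φ :* w′) :* d) :* (b :* v) := (φ :* (w :* v′ :- w′ :* v)) :* (b :* d)) ≃-refl b d v v′ w w′ φ))

  -- A sum whose terms are h xᵢ with h = w / v integral and xᵢ defined modulo φ.
  module Scaled (v w : Poly) (v-unit : U.Unit v) where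
    record Scaled (y : RatFun) (x : Poly) : Set where
      constructor scaled
      field
        u s : Poly
        s-unit : U.Unit s
        y-eq : num y *P (v *P s) ≃ (w *P u) *P den y
        u-eq : u ≋ x *P s

    scaled-+ : ∀ y y′ {x x′} → Scaled y x → Scaled y′ x′ → Scaled (y +R y′) (x +P x′)
    scaled-+ (a // b) (c // d) {x} {x′} (scaled u s h e e₁) (scaled u′ s′ h′ e′ e₁′) = scaled (u *P s′ +P u′ *P s) (s *P s′) (unit-*′ s s′ h h′)
      (≃-trans (solve 7 (λ a b c d v s s′ → (a :* d :+ c :* b) :* (v :* (s :* s′)) := (a :* (v :* s)) :* (d :* s′) :+ (c :* (v :* s′)) :* (b :* s)) ≃-refl a b c d v s s′)
      (≃-trans (+-cong (*-congʳ {d *P s′} e) (*-congʳ {b *P s} e′))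
      (solve 7 (λ b d w u u′ s s′ → ((w :* u) :* b) :* (d :* s′) :+ ((w :* u′) :* d) :* (b :* s) := (w :* (u :* s′ :+ u′ :* s)) :* (b :* d)) ≃-refl b d w u u′ s s′)))
      (≋-combine₂ {c = s′} {c′ = s} e₁ e₁′ (solve 6 (λ u u′ s s′ x x′ → (u :* s′ :+ u′ :* s) :- (x :+ x′) :* (s :* s′) := s′ :* (u :- x :* s) :+ s :* (u′ :- x′ :* s′)) ≃-refl u u′ s s′ x x′))

    sum : ℕ → (ℕ → Poly) → Poly
    sum zero x = []
    sum (suc K) x = x 0 +P sum K (λ i → x (suc i))

    sum-∑ : ∀ K x → sum K x ≋ Sums.∑ R K x
    sum-∑ zero x = R.refl
    sum-∑ (suc K) x = R.trans {_} {x 0 +P Sums.∑ R K (λ i → x (suc i))} (R.+-congˡ {x 0} (sum-∑ K (λ i → x (suc i)))) (R.sym {Sums.∑ R (suc K) x} (MoreSums.∑-head R K x))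

    scaled-fold : ∀ K h x → (∀ i → i < K → Scaled (h i) (x i)) → Scaled (foldR h K) (sum K x)
    scaled-fold zero h x hs = scaled [] oneP unit-1 (solve 2 (λ v w → :0 :* (v :* :1) := (w :* :0) :* :1) ≃-refl v w) R.refl
    scaled-fold (suc K) h x hs = scaled-+ (h 0) (foldR (λ i → h (suc i)) K) {x 0} {sum K (λ i → x (suc i))} (hs 0 z<s) (scaled-fold K (λ i → h (suc i)) (λ i → x (suc i)) λ i l → hs (suc i) (s<s l))

    -- The common factor w/v is integral, so it is enough that the sum of the residues vanishes
    -- modulo φ.
    scaled-divisible : ∀ y x → Scaled y x → x ≋ [] → Divisible y
    scaled-divisible y x (scaled u s h e e₁) x0 = v *P s , w *P factor u0 , unit-*′ v s v-unit h ,
      ≃-trans e (*-congʳ {den y} (lemma (equation u0)))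
      where
      u0 : u ≋ []
      u0 = R.trans {u} {x *P s} e₁ (R.trans {x *P s} {[] *P s} (R.*-congʳ {s} x0) R.refl)
      lemma : ∀ {f} → u -P [] ≃ φ *P f → w *P u ≃ φ *P (w *P f)
      lemma {f} h = ≃-trans (*-congˡ {w} (≃-trans (solve 1 (λ u → u := u :- :0) ≃-refl u) h)) (solve 3 (λ w φ f → w :* (φ :* f) := φ :* (w :* f)) ≃-refl w φ f)

module Modulo-Φ (N : ℕ) (1≤N : 1 ≤ N) (φ ψ : Poly)
  (Q-φ : Q (suc (N ℕ.* 2)) ≃ φ *P ψ) (φ-Q : ∀ j → ¬ suc (N ℕ.* 2) ∣ j → Comaximal φ (Q j)) where
  open Values φ
  open Local φ
  private
    module R = CommutativeRing R
    module U = Units R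
    d′ = N ℕ.* 2
    D = suc d′
  open Exp R.semiring using (_^_)

  2∣ : ∀ {i} → D ∣ i ℕ.* 2 → D ∣ i
  2∣ {i} h = ∣ℕ.∣m+n∣m⇒∣n (≡.subst (D ∣_) eq (∣ℕ.m∣m*n i)) (∣ℕ.∣n⇒∣m*n N h)
    where
    eq : D ℕ.* i ≡ N ℕ.* (i ℕ.* 2) ℕ.+ i
    eq = solveℕ 2 (λ N i → (conℕ 1 :+ℕ N :*ℕ conℕ 2) :*ℕ i :=ℕ N :*ℕ (i :*ℕ conℕ 2) :+ℕ i) ≡.refl N i

  4∣ : ∀ {i} → D ∣ i ℕ.* 4 → D ∣ i
  4∣ {i} h = 2∣ (2∣ (≡.subst (D ∣_) (≡.sym (ℕ.*-assoc i 2 2)) h))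

  below : ∀ {i} → suc i < D → ¬ D ∣ suc i
  below l h = ℕ.<⇒≱ l (∣ℕ.∣⇒≤ h)

  neg-Q-unit : ∀ j → ¬ D ∣ j → U.Unit (oneP -P qpow j)
  neg-Q-unit j h = negP (proj₁ u) , ≋-combine₁ {c = oneP} (proj₂ u) (solve 2 (λ x i → (:1 :- x) :* (:- i) :- :1 := :1 :* ((x :- :1) :* i :- :1)) ≃-refl (qpow j) (proj₁ u))
    where
    u : U.Unit (Q j)
    u = comaximal-unit (comaximal-sym (φ-Q j h))

  qpow-D : qpow D ≋ oneP
  qpow-D = multiple ψ Q-φ

  qpow-period : ∀ j k → qpow (j ℕ.+ k ℕ.* D) ≋ qpow j
  qpow-period j zero = R.reflexive (≡.cong qpow (ℕ.+-identityʳ j))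
  qpow-period j (suc k) = R.trans {_} {qpow (j ℕ.+ k ℕ.* D) *P qpow D} (≈⇒≋ (≃-trans (≃-reflexive (≡.cong qpow eq)) (≃-sym (qpow-+ (j ℕ.+ k ℕ.* D) D))))
    (R.trans {_} {qpow j *P oneP} (R.*-cong {qpow (j ℕ.+ k ℕ.* D)} {qpow j} {qpow D} {oneP} (qpow-period j k) qpow-D) (R.*-identityʳ (qpow j)))
    where
    eq : j ℕ.+ suc k ℕ.* D ≡ j ℕ.+ k ℕ.* D ℕ.+ D
    eq = solveℕ 3 (λ j k d → j :+ℕ (conℕ 1 :+ℕ k) :*ℕ d :=ℕ j :+ℕ k :*ℕ d :+ℕ d) ≡.refl j k D

  q-unit : U.Unit q¹
  q-unit = qpow d′ , R.trans {_} {qpow D} (≈⇒≋ (qpow-+ 1 d′)) qpow-D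

  1-q-unit : U.Unit (oneP -P q¹)
  1-q-unit = neg-Q-unit 1 (below (s<s (ℕ.*-mono-≤ 1≤N (s≤s (z≤n {1})))))

  module T = SeriesTerms R q¹ q-unit

  shift : ∀ s t ℓ i → s ℕ.+ (ℓ ℕ.* D ℕ.+ i) ℕ.* t ≡ (s ℕ.+ i ℕ.* t) ℕ.+ (ℓ ℕ.* t) ℕ.* D
  shift s t ℓ i = solveℕ 5 (λ s t ℓ i d → s :+ℕ (ℓ :*ℕ d :+ℕ i) :*ℕ t :=ℕ (s :+ℕ i :*ℕ t) :+ℕ (ℓ :*ℕ t) :*ℕ d) ≡.refl s t ℓ i D

  qpow-shift : ∀ s t ℓ i → qpow (s ℕ.+ (ℓ ℕ.* D ℕ.+ i) ℕ.* t) ≋ qpow (s ℕ.+ i ℕ.* t)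
  qpow-shift s t ℓ i = R.trans {_} {qpow (s ℕ.+ i ℕ.* t ℕ.+ (ℓ ℕ.* t) ℕ.* D)} (R.reflexive (≡.cong qpow (shift s t ℓ i))) (qpow-period (s ℕ.+ i ℕ.* t) (ℓ ℕ.* t))

  1-shift : ∀ s t ℓ i → oneP -P qpow (s ℕ.+ (ℓ ℕ.* D ℕ.+ i) ℕ.* t) ≋ oneP -P q¹ ^ (s ℕ.+ i ℕ.* t)
  1-shift s t ℓ i = R.trans {_} {oneP -P qpow (s ℕ.+ i ℕ.* t)} (R.+-congˡ {oneP} (R.-‿cong {qpow (s ℕ.+ (ℓ ℕ.* D ℕ.+ i) ℕ.* t)} {qpow (s ℕ.+ i ℕ.* t)} (qpow-shift s t ℓ i))) (1-pow (s ℕ.+ i ℕ.* t))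

  -- The exponents are t(ℓD + i) with 0 < i < D, and by the hypothesis on t none of them is
  -- divisible by D.
  tail-unit : ∀ t ℓ r → (∀ {i} → D ∣ i ℕ.* t → D ∣ i) → r ≤ d′ → U.Unit (tail t t (ℓ ℕ.* D) r)
  tail-unit t ℓ zero t∣ _ = unit-1
  tail-unit t ℓ (suc r) t∣ l = unit-*′ (tail t t (ℓ ℕ.* D) r) (oneP -P qpow (t ℕ.+ (ℓ ℕ.* D ℕ.+ r) ℕ.* t)) (tail-unit t ℓ r t∣ (ℕ.<⇒≤ l))
    (neg-Q-unit (t ℕ.+ (ℓ ℕ.* D ℕ.+ r) ℕ.* t) λ h → below (s≤s l) (t∣ (∣ℕ.∣m+n∣m⇒∣n (≡.subst (D ∣_) (≡.trans (shift t t ℓ r) (ℕ.+-comm (suc r ℕ.* t) _)) h) (∣ℕ.n∣m*n (ℓ ℕ.* t)))))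

  -- The cofactor is k + 1 modulo q^D - 1, hence modulo φ.
  cofactor-unit : ∀ k → U.Unit (cofactor D (suc k))
  cofactor-unit k = U.unit-resp {MoreSums.nat polyRing (suc k)} {C} (R.sym {C} (R.trans {C} {MoreSums.nat polyRing (suc k) +P Q D *P y} (≈⇒≋ (proj₂ (cofactor-nat D (suc k))))
      (multiple (ψ *P y) (Units.combine₁ polyRing {c = y} Q-φ (solve 5 (λ n q y f g → ((n :+ q :* y) :- n) :- f :* (g :* y) := y :* (q :- f :* g)) ≃-refl (MoreSums.nat polyRing (suc k)) (Q D) y φ ψ)))))
    (proj₁ (nat-unit k) , ≈⇒≋ (proj₂ (nat-unit k)))
    where
    C y : Poly
    C = cofactor D (suc k)
    y = proj₁ (cofactor-nat D (suc k))

  -- The ratio of two products in which each block of D factors of the denominator contains exactly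
  -- one multiple of 1 - q^D, while each block of the numerator contains at least one.
  PochIntegral : (s t t′ k : ℕ) → Set
  PochIntegral s t t′ k = Σ Poly λ v → Σ Poly λ w → U.Unit v × (poch (qpow s) (qpow t) k *P v ≃ w *P poch (qpow t′) (qpow t′) k)

  module _ (s t t″ i₀ : ℕ) (i₀<D : i₀ < D) (D∣i₀ : D ∣ s ℕ.+ i₀ ℕ.* t) (t′∣ : ∀ {i} → D ∣ i ℕ.* suc t″ → D ∣ i) where
    private
      t′ = suc t″

    poch-block : ∀ ℓ → PochIntegral s t t′ (ℓ ℕ.* D)
    poch-block zero = oneP , oneP , unit-1 , ≃-refl
    -- In the new block the numerator factor of index i₀ is -(q^D - 1)E and the last denominator
    -- factor is -(q^D - 1)C, so q^D - 1 cancels. The other numerator factors form X, the other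
    -- denominator factors the unit Y, and C is a unit.
    poch-block (suc ℓ) = v *P (Y *P C) , w *P X *P E , unit-*′ v (Y *P C) u (unit-*′ Y C Y-unit C-unit) , eq
      where
      k = ℓ ℕ.* D
      ih = poch-block ℓ
      v = proj₁ ih
      w = proj₁ (proj₂ ih)
      u = proj₁ (proj₂ (proj₂ ih))
      hd : ∀ s t → poch (qpow s) (qpow t) (suc ℓ ℕ.* D) ≃ poch (qpow s) (qpow t) k *P tail s t k D
      hd s t = ≃-trans (≃-reflexive (≡.cong (poch (qpow s) (qpow t)) (ℕ.+-comm D k))) (poch-+ s t k D)
      num-factor = prodP-factor D (λ i → oneP -P qpow (s ℕ.+ (k ℕ.+ i) ℕ.* t)) i₀ i₀<D
      X = proj₁ num-factor
      J = s ℕ.+ (k ℕ.+ i₀) ℕ.* t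
      D∣J : D ∣ J
      D∣J = ≡.subst (D ∣_) (≡.sym (shift s t ℓ i₀)) (∣ℕ.∣m∣n⇒∣m+n D∣i₀ (∣ℕ.n∣m*n (ℓ ℕ.* t)))
      E = proj₁ (Q-∣ D∣J)
      E-eq : Q J ≃ Q D *P E
      E-eq = proj₂ (Q-∣ D∣J)
      Y : Poly
      Y = tail t′ t′ k d′
      Y-unit : U.Unit Y
      Y-unit = tail-unit t′ ℓ d′ t′∣ ℕ.≤-refl
      K : ℕ
      K = suc (t″ ℕ.+ ℓ ℕ.* t′)
      last : t′ ℕ.+ (k ℕ.+ d′) ℕ.* t′ ≡ K ℕ.* D
      last = solveℕ 3 (λ t ℓ d → (conℕ 1 :+ℕ t) :+ℕ (ℓ :*ℕ (conℕ 1 :+ℕ d) :+ℕ d) :*ℕ (conℕ 1 :+ℕ t) :=ℕ (conℕ 1 :+ℕ (t :+ℕ ℓ :*ℕ (conℕ 1 :+ℕ t))) :*ℕ (conℕ 1 :+ℕ d)) ≡.refl t″ ℓ d′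
      C : Poly
      C = cofactor D K
      C-unit : U.Unit C
      C-unit = cofactor-unit (t″ ℕ.+ ℓ ℕ.* t′)
      C-eq : Q (t′ ℕ.+ (k ℕ.+ d′) ℕ.* t′) ≃ Q D *P C
      C-eq = ≃-trans (≃-reflexive (≡.cong Q last)) (Q-cofactor D K)
      eq : poch (qpow s) (qpow t) (suc ℓ ℕ.* D) *P (v *P (Y *P C)) ≃ (w *P X *P E) *P poch (qpow t′) (qpow t′) (suc ℓ ℕ.* D)
      eq = core (poch (qpow s) (qpow t) k) (poch (qpow t′) (qpow t′) k) (hd s t) (hd t′ t′) (proj₂ num-factor) (proj₂ (proj₂ (proj₂ ih)))
        where
        core : ∀ a c {a′ c′ A} → a′ ≃ a *P A → c′ ≃ c *P (Y *P (oneP -P qpow (t′ ℕ.+ (k ℕ.+ d′) ℕ.* t′))) → A ≃ (oneP -P qpow J) *P X → a *P v ≃ w *P c →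
          a′ *P (v *P (Y *P C)) ≃ (w *P X *P E) *P c′
        core a c {a′} {c′} {A} h₁ h₂ h₃ h₄ = ≃-trans (*-congʳ {v *P (Y *P C)} (≃-trans h₁ (*-congˡ {a} (≃-trans h₃ (*-congʳ {X} (neg-eq (qpow J) E E-eq))))))
          (≃-trans (solve 7 (λ a v q E X Y C → (a :* ((:- (q :* E)) :* X)) :* (v :* (Y :* C)) := (a :* v) :* ((:- (q :* E)) :* X :* (Y :* C))) ≃-refl a v (Q D) E X Y C)
          (≃-trans (*-congʳ {negP (Q D *P E) *P X *P (Y *P C)} h₄)
          (≃-trans (solve 7 (λ w c q E X Y C → (w :* c) :* ((:- (q :* E)) :* X :* (Y :* C)) := (w :* X :* E) :* (c :* (Y :* (:- (q :* C))))) ≃-refl w c (Q D) E X Y C)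
          (*-congˡ {w *P X *P E} (≃-sym (≃-trans h₂ (*-congˡ {c} (*-congˡ {Y} (neg-eq (qpow (t′ ℕ.+ (k ℕ.+ d′) ℕ.* t′)) C C-eq)))))))))
          where
          neg-eq : ∀ x E → x -P oneP ≃ Q D *P E → oneP -P x ≃ negP (Q D *P E)
          neg-eq x E h = ≃-trans (solve 1 (λ x → :1 :- x := :- (x :- :1)) ≃-refl x) (-‿cong h)

    -- The fewer than D denominator factors after the last full block are units.
    poch-integral : ∀ k → PochIntegral s t t′ k
    poch-integral k = ≡.subst (PochIntegral s t t′) (≡.sym (≡.trans (ℕ.m≡m%n+[m/n]*n k D) (ℕ.+-comm (k ℕ.% D) (k ℕ./ D ℕ.* D))))
      (v *P tail t′ t′ k₀ r , w *P tail s t k₀ r , unit-*′ v (tail t′ t′ k₀ r) u (tail-unit t′ ℓ r t′∣ (ℕ.≤-pred (ℕ.m%n<n k D)))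
      , core (poch (qpow s) (qpow t) k₀) (poch (qpow t′) (qpow t′) k₀) (poch-+ s t k₀ r) (poch-+ t′ t′ k₀ r) (proj₂ (proj₂ (proj₂ (poch-block ℓ)))))
      where
      ℓ = k ℕ./ D
      r = k ℕ.% D
      k₀ = ℓ ℕ.* D
      v = proj₁ (poch-block ℓ)
      w = proj₁ (proj₂ (poch-block ℓ))
      u = proj₁ (proj₂ (proj₂ (poch-block ℓ)))
      core : ∀ a c {a′ c′ A C} → a′ ≃ a *P A → c′ ≃ c *P C → a *P v ≃ w *P c → a′ *P (v *P C) ≃ (w *P A) *P c′
      core a c {a′} {c′} {A} {C} h₁ h₂ h₃ = ≃-trans (*-congʳ {v *P C} h₁) (≃-trans (solve 4 (λ a A v C → (a :* A) :* (v :* C) := (a :* v) :* (A :* C)) ≃-refl a A v C)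
        (≃-trans (*-congʳ {A *P C} h₃) (≃-trans (solve 4 (λ w c A C → (w :* c) :* (A :* C) := (w :* A) :* (c :* C)) ≃-refl w c A C) (*-congˡ {w *P A} (≃-sym h₂)))))

  parity : ∀ k → ∃ λ t → k ≡ t ℕ.* 2 ⊎ k ≡ suc (t ℕ.* 2)
  parity zero = 0 , inj₁ ≡.refl
  parity (suc k) with parity k
  ... | t , inj₁ ≡.refl = t , inj₂ ≡.refl
  ... | t , inj₂ ≡.refl = suc t , inj₁ ≡.refl

  -- i is -1/4 modulo D: for D = 4t + 1 take i = t, and for D = 4t + 3 use 3D = 4(3t + 2) + 1.
  quarter : ∃ λ i → i < D × D ∣ 1 ℕ.+ i ℕ.* 4
  quarter with parity N
  ... | t , inj₁ e = t , s≤s (ℕ.≤-trans (ℕ.m≤m*n t 2) (ℕ.≤-trans (ℕ.≤-reflexive (≡.sym e)) (ℕ.m≤m*n N 2)))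
      , divides 1 (≡.trans (≡.cong suc (≡.sym (ℕ.*-assoc t 2 2))) (≡.trans (≡.cong (λ k → suc (k ℕ.* 2)) (≡.sym e)) (≡.sym (ℕ.*-identityˡ D))))
  ... | t , inj₂ e = t ℕ.* 3 ℕ.+ 2 , ≡.subst (λ k → t ℕ.* 3 ℕ.+ 2 < suc (k ℕ.* 2)) (≡.sym e)
        (≡.subst₂ _<_ ≡.refl (solveℕ 1 (λ t → (t :*ℕ conℕ 3 :+ℕ conℕ 2) :+ℕ (conℕ 1 :+ℕ t) :=ℕ conℕ 1 :+ℕ (conℕ 1 :+ℕ t :*ℕ conℕ 2) :*ℕ conℕ 2) ≡.refl t) (ℕ.m<m+n (t ℕ.* 3 ℕ.+ 2) z<s))
      , divides 3 (≡.trans (solveℕ 1 (λ t → conℕ 1 :+ℕ (t :*ℕ conℕ 3 :+ℕ conℕ 2) :*ℕ conℕ 4 :=ℕ conℕ 3 :*ℕ (conℕ 1 :+ℕ (conℕ 1 :+ℕ t :*ℕ conℕ 2) :*ℕ conℕ 2)) ≡.refl t) (≡.cong (λ k → 3 ℕ.* suc (k ℕ.* 2)) (≡.sym e)))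

  i₄ : ℕ
  i₄ = proj₁ quarter

  -- The summand is split into (q;q⁴)ₖ/(q²;q²)ₖ and the cube of (q;q²)ₖ/(q⁴;q⁴)ₖ, so that each
  -- quotient is integral by itself.
  integral-ac : ∀ k → PochIntegral 1 4 2 k
  integral-ac = poch-integral 1 4 1 i₄ (proj₁ (proj₂ quarter)) (proj₂ (proj₂ quarter)) 2∣

  N<D : N < D
  N<D = s≤s (ℕ.m≤m*n N 2)

  integral-bd : ∀ k → PochIntegral 1 2 4 k
  integral-bd = poch-integral 1 2 3 N N<D ∣ℕ.∣-refl 4∣

  integral-hd : ∀ k → PochIntegral 2 4 4 k
  integral-hd = poch-integral 2 4 3 N N<D (divides 2 (solveℕ 1 (λ N → conℕ 2 :+ℕ N :*ℕ conℕ 4 :=ℕ conℕ 2 :*ℕ (conℕ 1 :+ℕ N :*ℕ conℕ 2)) ≡.refl N)) 4∣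

  open T using (Products; products-Term; zero-sum; p; s; β; cube; q^6)
  open Quadratic R p using (Term; total)

  module _ (ℓ : ℕ) where
    private
      k₀ : ℕ
      k₀ = ℓ ℕ.* D

    -- The parts of the products that belong to the block starting at ℓD. As q^D is 1 modulo φ,
    -- their recurrences are those of the first block.
    a′ b′ c′ e′ w′ : ℕ → Poly
    a′ = tail 1 4 k₀
    b′ = tail 1 2 k₀
    c′ = tail 2 2 k₀
    e′ = tail 4 4 k₀
    w′ r = qᵏ⁽ᵏ⁺¹⁾ (k₀ ℕ.+ r)

    w′-suc : ∀ r → w′ (suc r) ≋ w′ r *P q¹ ^ (suc r ℕ.* 2)
    w′-suc r = R.trans {w′ (suc r)} {qᵏ⁽ᵏ⁺¹⁾ (suc (k₀ ℕ.+ r))} (R.reflexive (≡.cong qᵏ⁽ᵏ⁺¹⁾ (ℕ.+-suc k₀ r)))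
      (R.trans {qᵏ⁽ᵏ⁺¹⁾ (suc (k₀ ℕ.+ r))} {w′ r *P qpow (suc (k₀ ℕ.+ r) ℕ.* 2)} (≈⇒≋ (w-suc (k₀ ℕ.+ r)))
        (R.*-congˡ {w′ r} (R.trans {qpow (suc (k₀ ℕ.+ r) ℕ.* 2)} {qpow (suc r ℕ.* 2)} (qpow-shift 2 2 ℓ r) (R.sym {q¹ ^ (suc r ℕ.* 2)} (pow (suc r ℕ.* 2))))))

    products : Products d′ a′ b′ c′ e′ w′
    products = record
      { a-suc = λ r _ → R.*-congˡ {a′ r} (1-shift 1 4 ℓ r)
      ; b-suc = λ r _ → R.*-congˡ {b′ r} (1-shift 1 2 ℓ r)
      ; c-suc = λ r _ → R.*-congˡ {c′ r} (1-shift 2 2 ℓ r)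
      ; d-suc = λ r _ → R.*-congˡ {e′ r} (1-shift 4 4 ℓ r)
      ; w-suc = λ r _ → w′-suc r }

    unit-c : ∀ r → r ≤ d′ → U.Unit (c′ r)
    unit-c r = tail-unit 2 ℓ r 2∣
    unit-e : ∀ r → r ≤ d′ → U.Unit (e′ r)
    unit-e r = tail-unit 4 ℓ r 4∣

    den′ num′ : ℕ → Poly
    den′ r = c′ r *P (e′ r ^P 3)
    num′ r = a′ r *P (b′ r ^P 3) *P w′ r

    den′-unit : ∀ r → r ≤ d′ → U.Unit (den′ r)
    den′-unit r l = unit-*′ (c′ r) (e′ r ^P 3) (unit-c r l) (unit-*′ (e′ r) (e′ r ^P 2) (unit-e r l) (unit-*′ (e′ r) (e′ r ^P 1) (unit-e r l) (unit-*′ (e′ r) oneP (unit-e r l) unit-1)))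

    inv : U.Invertible D den′
    inv = U.invertible D {den′} λ r l → den′-unit r (ℕ.≤-pred l)

    τ : ℕ → Poly
    τ r = num′ r *P proj₁ inv r

    τ-eq : ∀ r → r ≤ d′ → τ r *P den′ r ≋ num′ r
    τ-eq r l = ≋-combine₁ {c = num′ r} (proj₂ inv r (s≤s l)) (solve 3 (λ p i c → p :* i :* c :- p := p :* (c :* i :- :1)) ≃-refl (num′ r) (proj₁ inv r) (den′ r))

    τ-total : total q¹ (suc N) τ ≋ []
    τ-total = zero-sum N (R.trans {q¹ ^ D} {qpow D} (pow D) qpow-D)
      (λ i l → U.unit-resp {oneP -P qpow (suc i ℕ.* 2)} (1-pow (suc i ℕ.* 2)) (neg-Q-unit (suc i ℕ.* 2) λ h → below (s≤s l) (2∣ h)))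
      (λ i l → U.unit-resp {oneP -P qpow (suc i ℕ.* 4)} (1-pow (suc i ℕ.* 4)) (neg-Q-unit (suc i ℕ.* 4) λ h → below (s≤s (ℕ.≤-trans (s≤s l) 1+N≤d′)) (4∣ h)))
      τ (λ k l → products-Term products τ unit-c unit-e τ-eq k (ℕ.<-≤-trans l (ℕ.m≤m*n N 2)))
      where
      1+N≤d′ : suc N ≤ d′
      1+N≤d′ = ℕ.≤-trans (ℕ.+-monoˡ-≤ N 1≤N) (ℕ.≤-reflexive (≡.trans (≡.cong (N ℕ.+_) (≡.sym (ℕ.+-identityʳ N))) (ℕ.*-comm 2 N)))

    x : ℕ → Poly
    x r = qint (6 ℕ.* (k₀ ℕ.+ r) ℕ.+ 1) *P τ r

    x-τ : ∀ r → (oneP -P q¹) *P x r ≋ (oneP -P q¹ *P p ^ r *P p ^ r *P p ^ r) *P τ r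
    x-τ r = R.trans {_} {(oneP -P q¹) *P qint J *P τ r} (R.sym {(oneP -P q¹) *P qint J *P τ r} (R.*-assoc (oneP -P q¹) (qint J) (τ r)))
      (R.*-congʳ {τ r} (R.trans {_} {oneP -P qpow J} (≈⇒≋ (qint-eq J))
        (R.trans {_} {oneP -P qpow (1 ℕ.+ (k₀ ℕ.+ r) ℕ.* 6)} (R.reflexive (≡.cong (λ j → oneP -P qpow j) (≡.trans (ℕ.+-comm (6 ℕ.* (k₀ ℕ.+ r)) 1) (≡.cong suc (ℕ.*-comm 6 (k₀ ℕ.+ r))))))
        (R.trans {_} {oneP -P q¹ ^ (1 ℕ.+ r ℕ.* 6)} (1-shift 1 6 ℓ r)
          (R.+-congˡ {oneP} (R.-‿cong {q¹ ^ (1 ℕ.+ r ℕ.* 6)} {q¹ *P p ^ r *P p ^ r *P p ^ r}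
            (R.trans {_} {q¹ *P (p ^ r *P p ^ r *P p ^ r)} (R.*-congˡ {q¹} (q^6 r))
              (≈⇒≋ (solve 2 (λ q P → q :* (P :* P :* P) := q :* P :* P :* P) ≃-refl q¹ (p ^ r))))))))))
      where
      J : ℕ
      J = 6 ℕ.* (k₀ ℕ.+ r) ℕ.+ 1

    x-half : Sums.∑ R (suc N) x ≋ []
    x-half = U.unit-cancel {oneP -P q¹} {Sums.∑ R (suc N) x} {[]} 1-q-unit
      (R.trans {_} {total q¹ (suc N) τ} (R.trans {_} {Sums.∑ R (suc N) (λ r → (oneP -P q¹) *P x r)} (Sums.∑-distribˡ R (suc N) (oneP -P q¹) x) (Sums.∑-cong R (suc N) λ r _ → x-τ r))
        (R.trans {total q¹ (suc N) τ} {[]} τ-total (R.sym {(oneP -P q¹) *P []} (R.zeroʳ (oneP -P q¹)))))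

    -- From r = N + 1 on the product contains 1 - q^(D + 2k₀), which vanishes modulo φ.
    b′-zero : ∀ j → b′ (j ℕ.+ suc N) ≋ []
    b′-zero zero = R.trans {_} {b′ N *P []} (R.*-congˡ {b′ N} (R.trans {_} {oneP -P qpow D}
        (R.trans {_} {oneP -P q¹ ^ D} (1-shift 1 2 ℓ N) (R.sym {oneP -P qpow D} (1-pow D)))
        (R.trans {_} {oneP -P oneP} (R.+-congˡ {oneP} (R.-‿cong {qpow D} {oneP} qpow-D)) (R.-‿inverseʳ oneP)))) (R.zeroʳ (b′ N))
    b′-zero (suc j) = R.trans {_} {[] *P f} (R.*-congʳ {f} (b′-zero j)) R.refl
      where
      f : Poly
      f = oneP -P qpow (1 ℕ.+ (k₀ ℕ.+ (j ℕ.+ suc N)) ℕ.* 2)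

    x-zero : ∀ r → b′ r ≋ [] → x r ≋ []
    x-zero r h = R.trans {x r} {qint J *P ((a′ r *P ([] *P (b′ r ^P 2)) *P w′ r) *P proj₁ inv r)}
        (R.*-congˡ {qint J} (R.*-congʳ {proj₁ inv r} (R.*-congʳ {w′ r} (R.*-congˡ {a′ r} (R.*-congʳ {b′ r ^P 2} h)))))
        (≈⇒≋ (solve 4 (λ f a w i → f :* ((a :* :0 :* w) :* i) := :0) ≃-refl (qint J) (a′ r) (w′ r) (proj₁ inv r)))
      where
      J : ℕ
      J = 6 ℕ.* (k₀ ℕ.+ r) ℕ.+ 1

    -- j = 0 is the half block of the vanishing sum and j = N the full block; the terms in between
    -- are zero.
    x-sum : ∀ j → Sums.∑ R (j ℕ.+ suc N) x ≋ []
    x-sum zero = x-half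
    x-sum (suc j) = R.trans {_} {[] +P []} (R.+-cong {Sums.∑ R (j ℕ.+ suc N) x} {[]} {x (j ℕ.+ suc N)} {[]} (x-sum j) (x-zero (j ℕ.+ suc N) (b′-zero j))) R.refl

    private
      Ia = integral-ac k₀
      Ib = integral-bd k₀
      va wa vb wb : Poly
      va = proj₁ Ia
      wa = proj₁ (proj₂ Ia)
      vb = proj₁ Ib
      wb = proj₁ (proj₂ Ib)

    open Scaled (va *P (vb *P (vb *P vb))) (wa *P (wb *P (wb *P wb)))
      (unit-*′ va (vb *P (vb *P vb)) (proj₁ (proj₂ (proj₂ Ia))) (unit-*′ vb (vb *P vb) (proj₁ (proj₂ (proj₂ Ib))) (unit-*′ vb vb (proj₁ (proj₂ (proj₂ Ib))) (proj₁ (proj₂ (proj₂ Ib))))))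

    -- The factors before the block make up the common integral factor (wa/va)(wb/vb)³.
    scaled-summand : ∀ r → r ≤ d′ → Scaled (summand (k₀ ℕ.+ r)) (x r)
    scaled-summand r l = scaled (qint J *P num′ r) (den′ r) (den′-unit r l)
        (core (qint J) (qᵏ⁽ᵏ⁺¹⁾ (k₀ ℕ.+ r)) va wa vb wb {qq⁴ (k₀ ℕ.+ r)} {qq⁴ k₀} {a′ r} {qq² (k₀ ℕ.+ r)} {qq² k₀} {b′ r} {q²q² (k₀ ℕ.+ r)} {q²q² k₀} {c′ r} {q⁴q⁴ (k₀ ℕ.+ r)} {q⁴q⁴ k₀} {e′ r} (poch-+ 1 4 k₀ r) (poch-+ 1 2 k₀ r) (poch-+ 2 2 k₀ r) (poch-+ 4 4 k₀ r) (proj₂ (proj₂ (proj₂ Ia))) (proj₂ (proj₂ (proj₂ Ib))))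
        (R.sym {x r *P den′ r} (R.trans {_} {qint J *P (τ r *P den′ r)} (R.*-assoc (qint J) (τ r) (den′ r)) (R.*-congˡ {qint J} (τ-eq r l))))
      where
      J : ℕ
      J = 6 ℕ.* (k₀ ℕ.+ r) ℕ.+ 1
      cong³ : ∀ {x y} → x ≃ y → x *P (x *P (x *P oneP)) ≃ y *P (y *P (y *P oneP))
      cong³ h = *-cong h (*-cong h (*-congʳ {oneP} h))
      core : ∀ f W va wa vb wb {A A₀ A′ B B₀ B′ C C₀ C′ E E₀ E′} → A ≃ A₀ *P A′ → B ≃ B₀ *P B′ → C ≃ C₀ *P C′ → E ≃ E₀ *P E′ →
        A₀ *P va ≃ wa *P C₀ → B₀ *P vb ≃ wb *P E₀ →
        (f *P A *P (B ^P 3) *P W) *P ((va *P (vb *P (vb *P vb))) *P (C′ *P (E′ ^P 3)))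
          ≃ ((wa *P (wb *P (wb *P wb))) *P (f *P (A′ *P (B′ ^P 3) *P W))) *P (C *P (E ^P 3))
      core f W va wa vb wb {A} {A₀} {A′} {B} {B₀} {B′} {C} {C₀} {C′} {E} {E₀} {E′} hA hB hC hE ha hb =
        ≃-trans (*-congʳ {(va *P (vb *P (vb *P vb))) *P (C′ *P (E′ ^P 3))} (*-congʳ {W} (*-cong (*-congˡ {f} hA) (cong³ hB))))
        (≃-trans (solve 10 (λ f W va vb A₀ A′ B₀ B′ C′ E′ → let cb = λ x → x :* (x :* (x :* :1)) in
            (f :* (A₀ :* A′) :* cb (B₀ :* B′) :* W) :* ((va :* (vb :* (vb :* vb))) :* (C′ :* cb E′))
            := (A₀ :* va) :* cb (B₀ :* vb) :* (f :* (A′ :* cb B′ :* W) :* (C′ :* cb E′))) ≃-refl f W va vb A₀ A′ B₀ B′ C′ E′)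
        (≃-trans (*-congʳ {f *P (A′ *P (B′ ^P 3) *P W) *P (C′ *P (E′ ^P 3))} (*-cong ha (cong³ hb)))
        (≃-trans (solve 10 (λ f W wa wb C₀ A′ E₀ B′ C′ E′ → let cb = λ x → x :* (x :* (x :* :1)) in
            (wa :* C₀) :* cb (wb :* E₀) :* (f :* (A′ :* cb B′ :* W) :* (C′ :* cb E′))
            := ((wa :* (wb :* (wb :* wb))) :* (f :* (A′ :* cb B′ :* W))) :* ((C₀ :* C′) :* cb (E₀ :* E′))) ≃-refl f W wa wb C₀ A′ E₀ B′ C′ E′)
          (*-congˡ {(wa *P (wb *P (wb *P wb))) *P (f *P (A′ *P (B′ ^P 3) *P W))} (≃-sym (*-cong hC (cong³ hE)))))))

    block-divisible : ∀ j → j ℕ.+ suc N ≤ D → Divisible (foldR (λ r → summand (k₀ ℕ.+ r)) (j ℕ.+ suc N))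
    block-divisible j l = scaled-divisible (foldR (λ r → summand (k₀ ℕ.+ r)) (j ℕ.+ suc N)) (sum (j ℕ.+ suc N) x)
      (scaled-fold (j ℕ.+ suc N) (λ r → summand (k₀ ℕ.+ r)) x λ r r< → scaled-summand r (ℕ.≤-pred (ℕ.≤-trans r< l)))
      (R.trans {sum (j ℕ.+ suc N) x} {Sums.∑ R (j ℕ.+ suc N) x} (sum-∑ (j ℕ.+ suc N) x) (x-sum j))

  sum-divisible : ∀ t ℓ → Divisible (foldR (λ r → summand (ℓ ℕ.* D ℕ.+ r)) (t ℕ.* D ℕ.+ suc N))
  sum-divisible zero ℓ = block-divisible ℓ 0 (s≤s (ℕ.m≤m*n N 2))
  sum-divisible (suc t) ℓ = ≡.subst (λ k → Divisible (foldR h k)) (≡.sym (ℕ.+-assoc D (t ℕ.* D) (suc N)))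
    (divisible-resp (foldR h (D ℕ.+ (t ℕ.* D ℕ.+ suc N))) (foldR h D +R foldR (λ r → h (D ℕ.+ r)) (t ℕ.* D ℕ.+ suc N)) (foldR-+ h D (t ℕ.* D ℕ.+ suc N))
      (divisible-+ (foldR h D) (foldR (λ r → h (D ℕ.+ r)) (t ℕ.* D ℕ.+ suc N))
        (≡.subst (λ k → Divisible (foldR h k)) N+1+N (block-divisible ℓ N (ℕ.≤-reflexive N+1+N)))
        (≡.subst Divisible (foldR-cong (t ℕ.* D ℕ.+ suc N) λ r → ≡.cong summand (≡.trans (≡.cong (ℕ._+ r) (ℕ.+-comm D (ℓ ℕ.* D))) (ℕ.+-assoc (ℓ ℕ.* D) D r))) (sum-divisible t (suc ℓ)))))
    where
    h : ℕ → RatFun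
    h r = summand (ℓ ℕ.* D ℕ.+ r)
    N+1+N : N ℕ.+ suc N ≡ D
    N+1+N = solveℕ 1 (λ N → N :+ℕ (conℕ 1 :+ℕ N) :=ℕ conℕ 1 :+ℕ N :*ℕ conℕ 2) ≡.refl N

  -- n/D is odd, say 2t + 1, so (n - 1)/2 = tD + N: the sum consists of t full blocks and one half
  -- block.
  LHS-divisible : ∀ m → D ∣ suc (m ℕ.* 4) → Divisible (foldR summand (suc (m ℕ.* 2)))
  LHS-divisible m (divides e n≡) with parity e
  ... | t , inj₁ ≡.refl = contradiction (∣ℕ.∣⇒≤ (∣ℕ.∣m+n∣m⇒∣n {2} {m ℕ.* 4} {1} (≡.subst (2 ∣_) (ℕ.+-comm 1 (m ℕ.* 4)) (divides (t ℕ.* D) (≡.trans n≡ (solveℕ 2 (λ t d → t :*ℕ conℕ 2 :*ℕ d :=ℕ t :*ℕ d :*ℕ conℕ 2) ≡.refl t D))))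
          (divides (m ℕ.* 2) (≡.sym (ℕ.*-assoc m 2 2))))) λ { (s≤s ()) }
  ... | t , inj₂ ≡.refl = ≡.subst (λ k → Divisible (foldR summand k)) count (sum-divisible t 0)
    where
    count : t ℕ.* D ℕ.+ suc N ≡ suc (m ℕ.* 2)
    count = ≡.trans (ℕ.+-suc (t ℕ.* D) N) (≡.cong suc (ℕ.*-cancelʳ-≡ (t ℕ.* D ℕ.+ N) (m ℕ.* 2) 2 (ℕ.suc-injective (≡.trans
      (solveℕ 2 (λ t N → conℕ 1 :+ℕ (t :*ℕ (conℕ 1 :+ℕ N :*ℕ conℕ 2) :+ℕ N) :*ℕ conℕ 2 :=ℕ (conℕ 1 :+ℕ t :*ℕ conℕ 2) :*ℕ (conℕ 1 :+ℕ N :*ℕ conℕ 2)) ≡.refl t N)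
      (≡.trans (≡.sym n≡) (≡.cong suc (≡.sym (ℕ.*-assoc m 2 2))))))))

  module _ (m : ℕ) (D∣n : D ∣ suc (m ℕ.* 4)) where
    private
      n = suc (m ℕ.* 4)

      [n] : Poly
      [n] = qint n

      E : Poly
      E = proj₁ (Q-∣ D∣n)

    1-q-Q : ∀ j → (oneP -P q¹) *P qint j ≃ negP (Q j)
    1-q-Q j = ≃-trans (qint-eq j) (solve 1 (λ x → :1 :- x := :- (x :- :1)) ≃-refl (qpow j))

    [n]-divisible : Divisible (polyR [n])
    [n]-divisible = oneP -P q¹ , negP (ψ *P E) , 1-q-unit ,
      ≃-trans (*-comm [n] (oneP -P q¹)) (≃-trans (1-q-Q n) (≃-trans (-‿cong (≃-trans (proj₂ (Q-∣ D∣n)) (*-congʳ {E} Q-φ)))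
        (solve 3 (λ φ ψ E → :- (φ :* ψ :* E) := (φ :* (:- (ψ :* E))) :* :1) ≃-refl φ ψ E)))

    -- [n]/[j] is integral even when D divides j, since [n] has the same factor 1 - q^D.
    ratio : ∀ j → Σ Poly λ v → Σ Poly λ w → U.Unit v × ([n] *P v ≃ w *P qint (suc j))
    ratio j with D ∣? suc j
    ... | no h = qint (suc j) , [n] , qint-unit , ≃-refl
      where
      qint-unit : U.Unit (qint (suc j))
      qint-unit = (oneP -P q¹) *P proj₁ (neg-Q-unit (suc j) h) , R.trans {_} {(oneP -P qpow (suc j)) *P proj₁ (neg-Q-unit (suc j) h)}
        (≈⇒≋ (≃-trans (solve 3 (λ f u i → f :* (u :* i) := (u :* f) :* i) ≃-refl (qint (suc j)) (oneP -P q¹) (proj₁ (neg-Q-unit (suc j) h)))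
          (*-congʳ {proj₁ (neg-Q-unit (suc j) h)} (qint-eq (suc j))))) (proj₂ (neg-Q-unit (suc j) h))
    ... | yes (divides (suc k) j≡) = C , E , C-unit , Q-regular 0 {[n] *P C} {E *P qint (suc j)} (core (qint n) (qint (suc j)) (1-q-Q n) (1-q-Q (suc j)) (proj₂ (Q-∣ D∣n)) C-eq)
      where
      C : Poly
      C = cofactor D (suc k)
      C-eq : Q (suc j) ≃ Q D *P C
      C-eq = ≃-trans (≃-reflexive (≡.cong Q j≡)) (Q-cofactor D (suc k))
      C-unit : U.Unit C
      C-unit = cofactor-unit k
      core : ∀ f f′ → (oneP -P q¹) *P f ≃ negP (Q n) → (oneP -P q¹) *P f′ ≃ negP (Q (suc j)) → Q n ≃ Q D *P E → Q (suc j) ≃ Q D *P C →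
        Q 1 *P (f *P C) ≃ Q 1 *P (E *P f′)
      core f f′ h h′ e e′ = ≃-trans (solve 3 (λ q f C → (q :- :1) :* (f :* C) := (:- ((:1 :- q) :* f)) :* C) ≃-refl q¹ f C)
        (≃-trans (*-congʳ {C} (-‿cong (≃-trans h (-‿cong e))))
        (≃-trans (solve 3 (λ q E C → (:- (:- (q :* E))) :* C := E :* (:- (:- (q :* C)))) ≃-refl (Q D) E C)
        (≃-trans (*-congˡ {E} (-‿cong (≃-sym (≃-trans h′ (-‿cong e′)))))
          (solve 3 (λ q f E → E :* (:- ((:1 :- q) :* f)) := (q :- :1) :* (E :* f)) ≃-refl q¹ f′ E))))

    -- B has poles at φ, but [n]²B is integral.
    IntegralN : RatFun → Set
    IntegralN y = Σ Poly λ v → Σ Poly λ w → U.Unit v × (([n] ^P 2) *P num y *P v ≃ w *P den y)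

    integralN-+ : ∀ x y → IntegralN x → IntegralN y → IntegralN (x +R y)
    integralN-+ (a // b) (c // d) (v , w , u , e) (v′ , w′ , u′ , e′) = v *P v′ , w *P v′ +P w′ *P v , unit-*′ v v′ u u′ ,
      ≃-trans (solve 7 (λ a b c d v v′ F → F :* (a :* d :+ c :* b) :* (v :* v′) := (F :* a :* v) :* (d :* v′) :+ (F :* c :* v′) :* (b :* v)) ≃-refl a b c d v v′ ([n] ^P 2))
      (≃-trans (+-cong (*-congʳ {d *P v′} e) (*-congʳ {b *P v} e′))
        (solve 6 (λ b d v v′ w w′ → (w :* b) :* (d :* v′) :+ (w′ :* d) :* (b :* v) := (w :* v′ :+ w′ :* v) :* (b :* d)) ≃-refl b d v v′ w w′))

    integralN-term : ∀ j → IntegralN (qpow (suc j) // (qint (suc j) ^P 2))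
    integralN-term j = v *P v , w *P w *P qpow (suc j) , unit-*′ v v u u , core [n] (qint (suc j)) (qpow (suc j)) (proj₂ (proj₂ (proj₂ (ratio j))))
      where
      v = proj₁ (ratio j)
      w = proj₁ (proj₂ (ratio j))
      u = proj₁ (proj₂ (proj₂ (ratio j)))
      core : ∀ f g x → f *P v ≃ w *P g → (f *P (f *P oneP)) *P x *P (v *P v) ≃ (w *P w *P x) *P (g *P (g *P oneP))
      core f g x h = ≃-trans (solve 3 (λ f x v → (f :* (f :* :1)) :* x :* (v :* v) := (f :* v) :* (f :* v) :* x) ≃-refl f x v)
        (≃-trans (*-congʳ {x} (*-cong h h)) (solve 3 (λ w g x → (w :* g) :* (w :* g) :* x := (w :* w :* x) :* (g :* (g :* :1))) ≃-refl w g x))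

    integralN-fold : ∀ K (g : ℕ → ℕ) → IntegralN (foldR (λ k → qpow (suc (g k)) // (qint (suc (g k)) ^P 2)) K)
    integralN-fold zero g = oneP , [] , unit-1 , solve 1 (λ F → F :* :0 :* :1 := :0 :* :1) ≃-refl ([n] ^P 2)
    integralN-fold (suc K) g = integralN-+ (qpow (suc (g 0)) // (qint (suc (g 0)) ^P 2)) (foldR (λ k → qpow (suc (g (suc k))) // (qint (suc (g (suc k))) ^P 2)) K)
      (integralN-term (g 0)) (integralN-fold K (λ k → g (suc k)))

    integralN-integral : ∀ y → IntegralN y → Integral (polyR ([n] ^P 2) *R y)
    integralN-integral y (v , w , u , e) = v , w , u , ≃-trans e (*-congˡ {w} (≃-sym (*-identityˡ (den y))))

    integralN-polyR : ∀ x → IntegralN (polyR x)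
    integralN-polyR x = oneP , ([n] ^P 2) *P x , unit-1 , ≃-refl

    -- The factor [n] supplies φ; the other factors are integral.
    RHS-divisible : Divisible (RHS-of m)
    RHS-divisible = divisible-*-integral (hD *R polyR [n] *R (oneP // qpow m)) (polyR oneP +R (polyR ([n] ^P 2) *R RHS-B m))
      (divisible-*-integral (hD *R polyR [n]) (oneP // qpow m)
        (integral-*-divisible hD (polyR [n]) (integral-hd m) [n]-divisible)
        (integral-unit oneP (qpow m) (qpow-unit m)))
      (integral-+ (polyR oneP) (polyR ([n] ^P 2) *R RHS-B m) (integral-polyR oneP)
        (integralN-integral (RHS-B m) (integralN-+ (polyR rB) (foldR (λ k → qpow (2 ℕ.+ k ℕ.* 4) // (qint (2 ℕ.+ k ℕ.* 4) ^P 2)) m)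
          (integralN-polyR rB) (integralN-fold m (λ k → 1 ℕ.+ k ℕ.* 4)))))
      where
      hD : RatFun
      hD = poch (qpow 2) (qpow 4) m // poch (qpow 4) (qpow 4) m
      rB : Poly
      rB = scaleP ((+ (n ℕ.* n ∸ 1)) ℚ./ 24) ((oneP -P q¹) ^P 2)
      qpow-unit : ∀ k → U.Unit (qpow k)
      qpow-unit zero = unit-1
      qpow-unit (suc k) = U.unit-resp {q¹ *P qpow k} {qpow (suc k)} (≈⇒≋ (qpow-+ 1 k)) (unit-*′ q¹ (qpow k) q-unit (qpow-unit k))

    congruent-φ : Congruent (foldR summand (suc (m ℕ.* 2))) (RHS-of m) φ
    congruent-φ = divisible-congruent (foldR summand (suc (m ℕ.* 2))) (RHS-of m) (LHS-divisible m D∣n) RHS-divisible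

-- Chinese remaindering

comaximal-+ : ∀ a k m → Comaximal a m → Comaximal (a +P k *P m) m
comaximal-+ a k m (s , t , h) = s , t -P s *P k , ≃-trans (solve 5 (λ a k m s t → s :* (a :+ k :* m) :+ (t :- s :* k) :* m := s :* a :+ t :* m) ≃-refl a k m s t) h

-- Multiply the two equations by B and A and add them. VB + V′A is coprime to A because V and B are,
-- and to B because V′ and A are.
congruent-* : ∀ x y A B → Comaximal A B → Congruent x y A → Congruent x y B → Congruent x y (A *P B)
congruent-* x y A B AB (U , V , c , e) (U′ , V′ , c′ , e′) = U +P U′ , V *P B +P V′ *P A ,
  comaximal-* (comaximal-+ (V *P B) V′ A (comaximal-sym (comaximal-* (comaximal-sym c) AB)))
    (comaximal-resp (+-comm (V′ *P A) (V *P B)) ≃-refl (comaximal-+ (V′ *P A) V B (comaximal-sym (comaximal-* (comaximal-sym c′) (comaximal-sym AB))))) ,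
  core (num x *P den y -P num y *P den x) (den x *P den y) e e′
  where
  core : ∀ D E → D *P V ≃ (A *P U) *P E → D *P V′ ≃ (B *P U′) *P E → D *P (V *P B +P V′ *P A) ≃ ((A *P B) *P (U +P U′)) *P E
  core D E e e′ = ≃-trans (solve 5 (λ D V V′ A B → D :* (V :* B :+ V′ :* A) := (D :* V) :* B :+ (D :* V′) :* A) ≃-refl D V V′ A B)
    (≃-trans (+-cong (*-congʳ {B} e) (*-congʳ {A} e′))
      (solve 5 (λ A B U U′ E → ((A :* U) :* E) :* B :+ ((B :* U′) :* E) :* A := ((A :* B) :* (U :+ U′)) :* E) ≃-refl A B U U′ E))

congruent-1 : ∀ x y → Congruent x y oneP
congruent-1 x y = num x *P den y -P num y *P den x , den x *P den y , comaximal-1 , *-congʳ {den x *P den y} (≃-sym (*-identityˡ (num x *P den y -P num y *P den x)))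

congruent-product : ∀ x y ds → AllPairs (λ d e → Comaximal (Φ d) (Φ e)) ds → All (λ d → Congruent x y (Φ d)) ds → Congruent x y (product (map Φ ds))
congruent-product x y [] _ _ = congruent-1 x y
congruent-product x y (d ∷ ds) (p ∷ ps) (h ∷ hs) = congruent-* x y (Φ d) (product (map Φ ds)) (comaximal-foldr Φ ds p) h (congruent-product x y ds ps hs)

congruent⇒≡R : ∀ x y P P′ → P ≃ P′ → Congruent x y P → x ≡R y [mod P′ ]
congruent⇒≡R x y P P′ e (U , V , (s , t , c) , h) = U , V ,
  (s , t , ≃⇒≈P (≃-trans (+-congˡ {s *P V} (*-congˡ {t} (≃-sym e))) c)) ,
  ≃⇒≈P (≃-trans h (*-congʳ {den x *P den y} (*-congʳ {U} e)))

odd-divisor : ∀ m d → d ∣ suc (m ℕ.* 4) → 1 < d → ∃ λ N → 1 ≤ N × d ≡ suc (N ℕ.* 2)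
odd-divisor m d d∣n 1<d with parity d
  where
  parity : ∀ k → ∃ λ t → k ≡ t ℕ.* 2 ⊎ k ≡ suc (t ℕ.* 2)
  parity zero = 0 , inj₁ ≡.refl
  parity (suc k) with parity k
  ... | t , inj₁ ≡.refl = t , inj₂ ≡.refl
  ... | t , inj₂ ≡.refl = suc t , inj₁ ≡.refl
... | t , inj₁ ≡.refl = contradiction (∣ℕ.∣⇒≤ (∣ℕ.∣m+n∣m⇒∣n {2} {m ℕ.* 4} {1} (≡.subst (2 ∣_) (ℕ.+-comm 1 (m ℕ.* 4)) (∣ℕ.∣-trans (∣ℕ.n∣m*n t) d∣n)) (divides (m ℕ.* 2) (≡.sym (ℕ.*-assoc m 2 2))))) λ { (s≤s ()) }
... | zero , inj₂ ≡.refl = contradiction 1<d (ℕ.<-irrefl ≡.refl)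
... | suc t , inj₂ ≡.refl = suc t , z<s , ≡.refl

-- Combination of the moduli for n = 4m + 1 with m > 0

module Main (m′ : ℕ) where
  m n : ℕ
  m = suc m′
  n = suc (m ℕ.* 4)

  x y : RatFun
  x = foldR summand (suc (m ℕ.* 2))
  y = RHS-of m

  φ T : Poly
  φ = Φ n
  -- The divisors d of n with 1 < d < n. The range 2, ..., 4m is written out so that 1 splits off
  -- the list of proper divisors by computation.
  ds : List ℕ
  ds = filter (_∣? n) (map suc (applyUpTo suc (3 ℕ.+ m′ ℕ.* 4)))
  T = product (map Φ ds)

  divisors≡ : properDivisors n ≡ 1 ∷ ds
  divisors≡ = List.filter-accept (_∣? n) {1} {map suc (applyUpTo suc (3 ℕ.+ m′ ℕ.* 4))} (∣ℕ.1∣ n)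

  unique : AllPairs _≢_ (1 ∷ ds)
  unique = ≡.subst (AllPairs _≢_) divisors≡ (properDivisors-unique n)

  ∈-ds : ∀ {d} → d ∈ ds → 1 < d × d < n × d ∣ n
  ∈-ds {d} d∈ = let l , l′ , h = ∈-properDivisors {n} (≡.subst (d ∈_) (≡.sym divisors≡) (there d∈)) in ℕ.≤∧≢⇒< l (1≢ unique) , l′ , h
    where
    1≢ : AllPairs _≢_ (1 ∷ ds) → 1 ≢ d
    1≢ (u ∷ _) = All.lookup u d∈

  pairwise : ∀ es → (∀ {d} → d ∈ es → 1 ≤ d) → AllPairs _≢_ es → AllPairs (λ d e → Comaximal (Φ d) (Φ e)) es
  pairwise [] _ _ = []
  pairwise (e ∷ es) h (u ∷ us) = All.tabulate (λ {d} d∈ → Φ-comaximal-Φ e d (h (here ≡.refl)) (h (there d∈)) (All.lookup u d∈)) ∷ pairwise es (λ d∈ → h (there d∈)) us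

  congruent-Φ : ∀ {d} → d ∈ ds → Congruent x y (Φ d)
  congruent-Φ {d} d∈ = from (odd-divisor m d (proj₂ (proj₂ (∈-ds d∈))) (proj₁ (∈-ds d∈)))
    where
    from : (∃ λ N → 1 ≤ N × d ≡ suc (N ℕ.* 2)) → Congruent x y (Φ d)
    from (N , 1≤N , ≡.refl) = Modulo-Φ.congruent-φ N 1≤N (Φ d) (rest d) (Q-Φ d z<s) (Φ-comaximal-Q d z<s) m (proj₂ (proj₂ (∈-ds d∈)))

  congruent-T : Congruent x y T
  congruent-T = congruent-product x y ds (pairwise ds (λ d∈ → ℕ.<⇒≤ (proj₁ (∈-ds d∈))) (tail-unique unique)) (All.tabulate congruent-Φ)
    where
    tail-unique : AllPairs _≢_ (1 ∷ ds) → AllPairs _≢_ ds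
    tail-unique (_ ∷ us) = us

  congruent-Φ⁴ : Congruent x y (φ *P (φ ^P 3))
  congruent-Φ⁴ = Modulo-Φ⁴.congruent m z<s φ (rest n) (Q-Φ n z<s) (Φ-comaximal-Q n z<s)

  φ-T : Comaximal (φ *P (φ ^P 3)) T
  φ-T = comaximal-sym (comaximal-* T-φ (comaximal-* T-φ (comaximal-* T-φ (comaximal-* T-φ comaximal-1))))
    where
    T-φ : Comaximal T φ
    T-φ = comaximal-sym (comaximal-foldr Φ ds (All.tabulate λ {d} d∈ → let l , l′ , _ = ∈-ds d∈ in
      Φ-comaximal-Φ n d z<s (ℕ.<⇒≤ l) λ e → ℕ.<-irrefl (≡.sym e) l′))

  -- qⁿ - 1 = ΦₙΦ₁T, and Φ₁ = q - 1 can be cancelled.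
  qint-n : qint n ≃ φ *P T
  qint-n = Q-regular 0 {qint n} {φ *P T} (core (qint n) φ (Φ 1) T (qint-eq n) (≃-trans (Q-Φ n z<s) (*-congˡ {φ} (≃-reflexive (≡.cong (λ es → product (map Φ es)) divisors≡)))) (Q-Φ 1 z<s))
    where
    core : ∀ f φ φ₁ T → (oneP -P q¹) *P f ≃ oneP -P qpow n → Q n ≃ φ *P (φ₁ *P T) → Q 1 ≃ φ₁ *P oneP → Q 1 *P f ≃ Q 1 *P (φ *P T)
    core f φ φ₁ T h e e₁ = ≃-trans (solve 2 (λ q f → (q :- :1) :* f := :- ((:1 :- q) :* f)) ≃-refl q¹ f)
      (≃-trans (-‿cong h) (≃-trans (solve 1 (λ x → :- (:1 :- x) := x :- :1) ≃-refl (qpow n)) (≃-trans e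
        (≃-trans (solve 3 (λ φ φ₁ T → φ :* (φ₁ :* T) := (φ₁ :* :1) :* (φ :* T)) ≃-refl φ φ₁ T) (*-congʳ {φ *P T} (≃-sym e₁))))))

  congruence : x ≡R y [mod qint n *P (Φ n ^P 3) ]
  congruence = congruent⇒≡R x y ((φ *P (φ ^P 3)) *P T) (qint n *P (φ ^P 3))
    (≃-trans (modulus-eq φ (φ ^P 3) T) (*-congʳ {φ ^P 3} (≃-sym qint-n)))
    (congruent-* x y (φ *P (φ ^P 3)) T φ-T congruent-Φ⁴ congruent-T)
    where
    modulus-eq : ∀ f g T → (f *P g) *P T ≃ (f *P T) *P g
    modulus-eq = solve 3 (λ f g T → (f :* g) :* T := (f :* T) :* g) ≃-refl

LHS-foldR : ∀ m → LHS (suc (m ℕ.* 4)) ≡ foldR summand (suc (m ℕ.* 2))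
LHS-foldR m = ≡.trans (sumR-foldR 0 (m ℕ.* 4 ℕ./ 2) summand) (≡.cong (λ k → foldR summand (suc k)) (≡.trans (≡.cong (ℕ._/ 2) (≡.sym (ℕ.*-assoc m 2 2))) (ℕ.m*n/n≡m (m ℕ.* 2) 2)))

RHS-RHS-of : ∀ m → RHS (suc (m ℕ.* 4)) ≡ RHS-of m
RHS-RHS-of m = ≡.trans (≡.cong (λ b → prefix (m ℕ.* 4 ℕ./ 4) *R (polyR oneP +R (polyR (qint n ^P 2) *R (c +R b)))) (≡.trans (sumR-foldR 1 (m ℕ.* 4 ℕ./ 4) term) (foldR-cong (m ℕ.* 4 ℕ./ 4) λ i → ≡.cong term′ (≡.cong (_∸ 2) (ℕ.*-comm 4 (suc i))))))
    (≡.cong (λ k → prefix k *R (polyR oneP +R (polyR (qint n ^P 2) *R (c +R foldR (λ k → term′ (2 ℕ.+ k ℕ.* 4)) k)))) (ℕ.m*n/n≡m m 4))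
  where
  n : ℕ
  n = suc (m ℕ.* 4)
  prefix : ℕ → RatFun
  prefix k = (poch (qpow 2) (qpow 4) k // poch (qpow 4) (qpow 4) k) *R polyR (qint n) *R (oneP // qpow k)
  term term′ : ℕ → RatFun
  term′ j = qpow j // (qint j ^P 2)
  term k = term′ (4 ℕ.* k ∸ 2)
  c : RatFun
  c = polyR (scaleP ((+ (n ℕ.* n ∸ 1)) ℚ./ 24) ((oneP -P q¹) ^P 2))

-- For n = 1 the factor 1 - q is not a unit modulo Φ₁, so the general argument does not apply. Both
-- sides are 1, and the cross difference is computed to be zero.
theorem2-1 : LHS 1 ≡R RHS 1 [mod qint 1 *P (Φ 1 ^P 3) ]
theorem2-1 = [] , oneP , (oneP , [] , is-zero _) , is-zero _
  where
  is-zero : ∀ p {_ : True (All.all? (ℚ._≟ 0ℚ) p)} → IsZeroP p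
  is-zero p {h} = toWitness h

theorem2-suc : ∀ m → LHS (suc (m ℕ.* 4)) ≡R RHS (suc (m ℕ.* 4)) [mod qint (suc (m ℕ.* 4)) *P (Φ (suc (m ℕ.* 4)) ^P 3) ]
theorem2-suc zero = theorem2-1
theorem2-suc (suc m) = ≡.subst₂ (λ x y → x ≡R y [mod qint n *P (Φ n ^P 3) ]) (≡.sym (LHS-foldR (suc m))) (≡.sym (RHS-RHS-of (suc m))) congruence
  where open Main m using (n; congruence)

theorem2 : (n : ℕ) → n % 4 ≡ 1 →
    LHS n ≡R RHS n [mod qint n *P (Φ n ^P 3) ]
theorem2 n n%4≡1 = ≡.subst (λ n → LHS n ≡R RHS n [mod qint n *P (Φ n ^P 3) ])
  (≡.sym (≡.trans (ℕ.m≡m%n+[m/n]*n n 4) (≡.cong (ℕ._+ n ℕ./ 4 ℕ.* 4) n%4≡1))) (theorem2-suc (n ℕ./ 4))
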